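{- For every prime number $p$, the Fibonacci polynomial $F_p(x)$, the Pell polynomial $P_p(x)$ and the Fermat polynomial $\Phi_p(x)$ are irreducible over $\mathbb{Q}$.
   Context: The polynomial sequences are defined for $n\ge 2$ by: Fibonacci: $F_0=0$, $F_1=1$, $F_n(x)=xF_{n-1}(x)+F_{n-2}(x)$; Pell: $P_0=0$, $P_1=1$, $P_n(x)=2xP_{n-1}(x)+P_{n-2}(x)$; Fermat: $\Phi_0=0$, $\Phi_1=1$, $\Phi_n(x)=3x\Phi_{n-1}(x)-2\Phi_{n-2}(x)$. -}

module Defs where

open import Algebra.Bundles.Raw using (RawRing)
open import Data.Integer.Base using (+_)
open import Data.List.Base using (List; []; _∷_; map)
open import Data.Nat.Base using (ℕ; zero; suc)
open import Data.Rational.Base using (ℚ; _/_; +-*-rawRing)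
import Algebra.Definitions.RawSemiring as RawSemiringDefinitions

-- A polynomial over R is the list of its coefficients, constant term first.
-- Trailing zeros are allowed, so equality of polynomials is _≈_ below
-- (equality of all coefficients), not propositional equality of lists.

module Polynomial {c ℓ} (R : RawRing c ℓ) where

  private module R = RawRing R

  Poly : Set c
  Poly = List R.Carrier

  coeff : Poly → ℕ → R.Carrier
  coeff []      _       = R.0#
  coeff (a ∷ f) zero    = a
  coeff (a ∷ f) (suc n) = coeff f n

  infix 4 _≈_
  record _≈_ (f g : Poly) : Set ℓ where
    constructor coeffwise
    field
      coeff-≈ : ∀ n → coeff f n R.≈ coeff g n

  const : R.Carrier → Poly
  const a = a ∷ []

  X : Poly
  X = R.0# ∷ R.1# ∷ []

  infixl 6 _+_ _-_
  infixl 7 _*_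
  infix  8 -_

  _+_ : Poly → Poly → Poly
  []      + g       = g
  (a ∷ f) + []      = a ∷ f
  (a ∷ f) + (b ∷ g) = (a R.+ b) ∷ (f + g)

  -_ : Poly → Poly
  -_ = map R.-_

  _-_ : Poly → Poly → Poly
  f - g = f + (- g)

  -- (a + X f) g = a g + X (f g)
  _*_ : Poly → Poly → Poly
  []      * g = []
  (a ∷ f) * g = map (a R.*_) g + (R.0# ∷ (f * g))

  rawRing : RawRing c ℓ
  rawRing = record
    { Carrier = Poly
    ; _≈_     = _≈_
    ; _+_     = _+_
    ; _*_     = _*_
    ; -_      = -_
    ; 0#      = []
    ; 1#      = const R.1#
    }

  -- Irreducibility in the ring R[X]: f is not a unit, and in every
  -- factorisation f ≈ g * h one of g, h is a unit (divides 1).  In particular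
  -- f ≉ 0 when R is non-trivial, since 0 ≈ 0 * 0.
  open RawSemiringDefinitions (RawRing.rawSemiring rawRing) public
    using (Irreducible)

module ℚ[X] = Polynomial +-*-rawRing

open ℚ[X]

fibonacci : ℕ → Poly
fibonacci 0             = []
fibonacci 1             = const (+ 1 / 1)
fibonacci (suc (suc n)) = X * fibonacci (suc n) + fibonacci n

pell : ℕ → Poly
pell 0             = []
pell 1             = const (+ 1 / 1)
pell (suc (suc n)) = const (+ 2 / 1) * X * pell (suc n) + pell n

fermat : ℕ → Poly
fermat 0             = []
fermat 1             = const (+ 1 / 1)
fermat (suc (suc n)) =
  const (+ 3 / 1) * X * fermat (suc n) - const (+ 2 / 1) * fermat n

{-# OPTIONS --safe #-}

-- All three sequences satisfy V (n+2) = c x V (n+1) - s V n with s = -1 or 2.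
-- For an odd prime p = 2m+1, V p is a polynomial s^m g in w, where
-- (c x)² = s (w + 4), and g is Eisenstein at p with constant term p.  Write
-- a + b ξ for the elements of ℚ[x], where ξ = c x and a, b ∈ ℚ[w].  If
-- V p = (D (a + b ξ)) (A + B ξ) with a, b coprime, then b A + a B = 0 gives
-- A + B ξ = K (a - b ξ), so that s^m g = D K (a² - s (w + 4) b²).  As g is
-- irreducible over ℚ, either one factor of V p is a unit, or a rational multiple
-- of g is of the form a² - s (w + 4) b².  The latter is excluded by a 2-adic
-- descent based on ± g = P² - (w + 4) Q² with P and Q nonzero modulo 2.

module Submission where

open import Defs
open import Algebra.Bundles using (CommutativeRing)
open import Algebra.Definitions.RawMagma using (_,_)
open import Algebra.Definitions.RawSemiring using (mkIrred)
open import Algebra.Structures using (IsCommutativeRing)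
open import Data.Integer.Base as ℤ using (ℤ; +_; -[1+_]; ∣_∣)
open import Data.Integer.Divisibility.Signed as ℤ using (divides; ∣ᵤ⇒∣; ∣⇒∣ᵤ)
open import Data.Integer.DivMod using (_%ℕ_; _/ℕ_; a≡a%ℕn+[a/ℕn]*n; n%ℕd<d)
import Data.Integer.Properties as ℤ
import Data.Integer.Tactic.RingSolver as ℤ-Tactic
open import Data.List.Base using ([]; _∷_; length; map)
open import Data.Maybe.Base using (Maybe; just; nothing)
open import Data.Nat.Base as ℕ using (ℕ; zero; suc; z≤n; s≤s)
open import Data.Nat.Combinatorics using (_C_; nCn≡1; nC1≡n; k>n⇒nCk≡0; nCk+nC[k+1]≡[n+1]C[k+1])
import Data.Nat.Divisibility as ℕ
open import Data.Nat.Primality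
  using (Prime; euclidsLemma; prime?; prime⇒irreducible; prime⇒nonTrivial; prime⇒nonZero; ¬prime[1])
import Data.Nat.Properties as ℕ
import Data.Nat.Tactic.RingSolver as ℕ-Tactic
open import Data.Product.Base using (_,_; _×_; proj₁; proj₂; ∃; ∃₂)
open import Data.Rational.Base as ℚ using (ℚ; _/_; ↥_; ↧_; toℚᵘ)
import Data.Rational.Properties as ℚ
open import Data.Rational.Properties using () renaming (+-*-commutativeRing to ℚ-ring)
open import Data.Rational.Unnormalised.Base as ℚᵘ using (mkℚᵘ; *≡*)
import Data.Rational.Unnormalised.Properties as ℚᵘ
open import Data.Sum.Base as Sum using (_⊎_; inj₁; inj₂; [_,_]′)
open import Function.Base using (id)
open import Level using (_⊔_; 0ℓ) renaming (suc to lsuc)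
open import Relation.Binary.Bundles using (Setoid)
open import Relation.Binary.Definitions using (tri<; tri≈; tri>)
open import Relation.Binary.PropositionalEquality as ≡ using (_≡_; _≢_)
import Relation.Binary.Reasoning.Setoid as SetoidReasoning
open import Relation.Nullary.Decidable using (Dec; yes; no; toWitness)
open import Relation.Nullary.Negation using (¬_; contradiction)

-- The shift by 4 comes from the characteristic equation t² = ξ t - s, whose discriminant is ξ² - 4
-- s = s w. Modulo p, V p is congruent to the m-th power of this discriminant, and at w = 0, where
-- the two roots coincide, its value is p s^m; this is why `g` is Eisenstein in w. The obstacle is
-- that w = 0 means ξ = 2 √s or -2 √s, which is irrational for s = -1 and s = 2. The substitution is
-- therefore available for ξ² only, and ℚ[x] is a quadratic extension of the ring ℚ[w] in which
-- Eisenstein's criterion applies. Irreducibility below still allows a splitting above into two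
-- conjugate factors, and the norm argument has to exclude it. The prime 2 suits this purpose
-- because w + 4 reduces to w, and a² + w b² vanishes modulo 2 only if a and b do: the degrees of a²
-- and w b² have different parity. For s = -1 the forms P² - (w + 4) Q² and a² + (w + 4) b² agree
-- modulo 2, so that this case has to be pursued modulo 4.

module IntegerSolver {c ℓ} (R : CommutativeRing c ℓ) where

  open CommutativeRing R
  open import Algebra.Properties.AbelianGroup +-abelianGroup
    using (⁻¹-∙-comm; ⁻¹-involutive; ε⁻¹≈ε)
  open import Algebra.Properties.Ring ring using (-‿distribˡ-*; -‿distribʳ-*)
  open import Algebra.Properties.Semiring.Mult.TCOptimised semiring renaming (_×_ to _×′_)
  open import Algebra.Solver.Ring.AlmostCommutativeRing
  open import Relation.Binary.Reasoning.Setoid setoid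

  -- Solver coefficients are integers because their equality is decidable, whereas equality in `R`
  -- may not be. The optimised multiple `×′` adds no stray `0#`, so that in `ℤ[w]` the numeral
  -- `con (+ 4)` computes to `const (+ 4)`.
  fromℤ : ℤ → Carrier
  fromℤ (+ n)      = n ×′ 1#
  fromℤ (-[1+ n ]) = - (suc n ×′ 1#)

  private
    1+-cancel : ∀ x y → (1# + x) + - (1# + y) ≈ x + - y
    1+-cancel x y = begin
      (1# + x) + - (1# + y)    ≈⟨ +-cong (+-comm 1# x) (sym (⁻¹-∙-comm 1# y)) ⟩
      (x + 1#) + (- 1# + - y)  ≈⟨ +-assoc x 1# _ ⟩
      x + (1# + (- 1# + - y))  ≈⟨ +-congˡ (+-assoc 1# (- 1#) (- y)) ⟨
      x + ((1# + - 1#) + - y)  ≈⟨ +-congˡ (+-congʳ (-‿inverseʳ 1#)) ⟩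
      x + (0# + - y)           ≈⟨ +-congˡ (+-identityˡ (- y)) ⟩
      x + - y                  ∎

  fromℤ-⊖ : ∀ m n → fromℤ (m ℤ.⊖ n) ≈ m ×′ 1# + - (n ×′ 1#)
  fromℤ-⊖ zero    zero    = sym (-‿inverseʳ 0#)
  fromℤ-⊖ zero    (suc n) = sym (+-identityˡ _)
  fromℤ-⊖ (suc m) zero    = sym (trans (+-congˡ ε⁻¹≈ε) (+-identityʳ _))
  fromℤ-⊖ (suc m) (suc n) = begin
    fromℤ (suc m ℤ.⊖ suc n)                ≡⟨ ≡.cong fromℤ (ℤ.[1+m]⊖[1+n]≡m⊖n m n) ⟩
    fromℤ (m ℤ.⊖ n)                        ≈⟨ fromℤ-⊖ m n ⟩
    m ×′ 1# + - (n ×′ 1#)                    ≈⟨ 1+-cancel _ _ ⟨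
    (1# + m ×′ 1#) + - (1# + n ×′ 1#)        ≈⟨ +-cong (1+× m 1#) (-‿cong (1+× n 1#)) ⟨
    suc m ×′ 1# + - (suc n ×′ 1#)            ∎

  fromℤ-neg : ∀ i → fromℤ (ℤ.- i) ≈ - fromℤ i
  fromℤ-neg (+ zero)  = sym ε⁻¹≈ε
  fromℤ-neg (+ suc n) = refl
  fromℤ-neg -[1+ n ]  = sym (⁻¹-involutive _)

  fromℤ-+ : ∀ i j → fromℤ (i ℤ.+ j) ≈ fromℤ i + fromℤ j
  fromℤ-+ (+ m)    (+ n)    = ×-homo-+ 1# m n
  fromℤ-+ (+ m)    -[1+ n ] = fromℤ-⊖ m (suc n)
  fromℤ-+ -[1+ m ] (+ n)    = trans (fromℤ-⊖ n (suc m)) (+-comm _ _)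
  fromℤ-+ -[1+ m ] -[1+ n ] = begin
    fromℤ (-[1+ m ] ℤ.+ -[1+ n ])     ≡⟨ ≡.cong fromℤ (ℤ.neg-distrib-+ (+ suc m) (+ suc n)) ⟨
    fromℤ (ℤ.- (+ suc m ℤ.+ + suc n)) ≈⟨ fromℤ-neg (+ suc m ℤ.+ + suc n) ⟩
    - ((suc m ℕ.+ suc n) ×′ 1#)        ≈⟨ -‿cong (×-homo-+ 1# (suc m) (suc n)) ⟩
    - (suc m ×′ 1# + suc n ×′ 1#)       ≈⟨ ⁻¹-∙-comm _ _ ⟨
    - (suc m ×′ 1#) + - (suc n ×′ 1#)   ∎

  private
    fromℤ-*⁺ : ∀ m n → fromℤ (+ m ℤ.* + n) ≈ m ×′ 1# * (n ×′ 1#)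
    fromℤ-*⁺ m n = begin
      fromℤ (+ m ℤ.* + n)  ≡⟨ ≡.cong fromℤ (ℤ.pos-* m n) ⟨
      (m ℕ.* n) ×′ 1#       ≈⟨ ×1-homo-* m n ⟩
      m ×′ 1# * (n ×′ 1#)    ∎

  fromℤ-* : ∀ i j → fromℤ (i ℤ.* j) ≈ fromℤ i * fromℤ j
  fromℤ-* (+ m)    (+ n)    = fromℤ-*⁺ m n
  fromℤ-* (+ m)    -[1+ n ] = begin
    fromℤ (+ m ℤ.* -[1+ n ])           ≡⟨ ≡.cong fromℤ (ℤ.neg-distribʳ-* (+ m) (+ suc n)) ⟨
    fromℤ (ℤ.- (+ m ℤ.* + suc n))      ≈⟨ fromℤ-neg (+ m ℤ.* + suc n) ⟩
    - fromℤ (+ m ℤ.* + suc n)          ≈⟨ -‿cong (fromℤ-*⁺ m (suc n)) ⟩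
    - (m ×′ 1# * (suc n ×′ 1#))          ≈⟨ -‿distribʳ-* _ _ ⟩
    m ×′ 1# * - (suc n ×′ 1#)            ∎
  fromℤ-* -[1+ m ] j        = begin
    fromℤ (-[1+ m ] ℤ.* j)             ≡⟨ ≡.cong fromℤ (ℤ.neg-distribˡ-* (+ suc m) j) ⟨
    fromℤ (ℤ.- (+ suc m ℤ.* j))        ≈⟨ fromℤ-neg (+ suc m ℤ.* j) ⟩
    - fromℤ (+ suc m ℤ.* j)            ≈⟨ -‿cong (case j) ⟩
    - (suc m ×′ 1# * fromℤ j)           ≈⟨ -‿distribˡ-* _ _ ⟩
    - (suc m ×′ 1#) * fromℤ j           ∎
    where
    case : ∀ j → fromℤ (+ suc m ℤ.* j) ≈ suc m ×′ 1# * fromℤ j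
    case (+ n)    = fromℤ-*⁺ (suc m) n
    case -[1+ n ] = begin
      fromℤ (+ suc m ℤ.* -[1+ n ])       ≡⟨ ≡.cong fromℤ (ℤ.neg-distribʳ-* (+ suc m) (+ suc n)) ⟨
      fromℤ (ℤ.- (+ suc m ℤ.* + suc n))  ≈⟨ fromℤ-neg (+ suc m ℤ.* + suc n) ⟩
      - fromℤ (+ suc m ℤ.* + suc n)      ≈⟨ -‿cong (fromℤ-*⁺ (suc m) (suc n)) ⟩
      - (suc m ×′ 1# * (suc n ×′ 1#))      ≈⟨ -‿distribʳ-* _ _ ⟩
      suc m ×′ 1# * - (suc n ×′ 1#)        ∎

  private
    morphism : ℤ.+-*-rawRing -Raw-AlmostCommutative⟶ fromCommutativeRing R
    morphism = record
      { ⟦_⟧    = fromℤ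
      ; +-homo = fromℤ-+
      ; *-homo = fromℤ-*
      ; -‿homo = fromℤ-neg
      ; 0-homo = refl
      ; 1-homo = refl
      }

    _≟_ : ∀ i j → Maybe (fromℤ i ≈ fromℤ j)
    i ≟ j with i ℤ.≟ j
    ... | yes ≡.refl = just refl
    ... | no  _      = nothing

  open import Algebra.Solver.Ring ℤ.+-*-rawRing (fromCommutativeRing R) morphism _≟_ public
    using (solve; con; _:+_; _:*_; _:-_; :-_; _:=_)

-- Polynomials over a commutative ring

module PolynomialRing {c ℓ} (R : CommutativeRing c ℓ) where

  private module R = CommutativeRing R
  open import Algebra.Properties.AbelianGroup R.+-abelianGroup using (ε⁻¹≈ε)
  open Polynomial R.rawRing public
  open _≈_ public

  infixr 7 _·_
  _·_ : R.Carrier → Poly → Poly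
  a · f = map (a R.*_) f

  ≈-refl : ∀ {f} → f ≈ f
  ≈-refl = coeffwise λ _ → R.refl

  ≈-sym : ∀ {f g} → f ≈ g → g ≈ f
  ≈-sym p = coeffwise λ n → R.sym (coeff-≈ p n)

  ≈-trans : ∀ {f g h} → f ≈ g → g ≈ h → f ≈ h
  ≈-trans p q = coeffwise λ n → R.trans (coeff-≈ p n) (coeff-≈ q n)

  ≈-setoid : Setoid c ℓ
  ≈-setoid = record
    { Carrier = Poly ; _≈_ = _≈_
    ; isEquivalence = record { refl = ≈-refl ; sym = ≈-sym ; trans = ≈-trans } }

  open SetoidReasoning ≈-setoid

  ∷-cong : ∀ {a b f g} → a R.≈ b → f ≈ g → a ∷ f ≈ b ∷ g
  ∷-cong a≈b f≈g = coeffwise λ { zero → a≈b ; (suc n) → coeff-≈ f≈g n }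

  tail-≈ : ∀ {a b f g} → a ∷ f ≈ b ∷ g → f ≈ g
  tail-≈ p = coeffwise λ n → coeff-≈ p (suc n)

  tail-≈[] : ∀ {a f} → a ∷ f ≈ [] → f ≈ []
  tail-≈[] p = coeffwise λ n → coeff-≈ p (suc n)

  0∷-≈[] : ∀ {a f} → a R.≈ R.0# → f ≈ [] → a ∷ f ≈ []
  0∷-≈[] a≈0 f≈0 = coeffwise λ { zero → a≈0 ; (suc n) → coeff-≈ f≈0 n }

  coeff-+ : ∀ f g n → coeff (f + g) n R.≈ coeff f n R.+ coeff g n
  coeff-+ []      g       n       = R.sym (R.+-identityˡ _)
  coeff-+ (a ∷ f) []      n       = R.sym (R.+-identityʳ _)
  coeff-+ (a ∷ f) (b ∷ g) zero    = R.refl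
  coeff-+ (a ∷ f) (b ∷ g) (suc n) = coeff-+ f g n

  coeff-neg : ∀ f n → coeff (- f) n R.≈ R.- coeff f n
  coeff-neg []      n       = R.sym ε⁻¹≈ε
  coeff-neg (a ∷ f) zero    = R.refl
  coeff-neg (a ∷ f) (suc n) = coeff-neg f n

  coeff-· : ∀ a f n → coeff (a · f) n R.≈ a R.* coeff f n
  coeff-· a []      n       = R.sym (R.zeroʳ a)
  coeff-· a (b ∷ f) zero    = R.refl
  coeff-· a (b ∷ f) (suc n) = coeff-· a f n

  +-cong : ∀ {f f′ g g′} → f ≈ f′ → g ≈ g′ → f + g ≈ f′ + g′
  +-cong {f} {f′} {g} {g′} p q = coeffwise λ n →
    R.trans (coeff-+ f g n)
      (R.trans (R.+-cong (coeff-≈ p n) (coeff-≈ q n)) (R.sym (coeff-+ f′ g′ n)))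

  -‿cong : ∀ {f g} → f ≈ g → - f ≈ - g
  -‿cong {f} {g} p = coeffwise λ n →
    R.trans (coeff-neg f n) (R.trans (R.-‿cong (coeff-≈ p n)) (R.sym (coeff-neg g n)))

  ·-cong : ∀ {a b f g} → a R.≈ b → f ≈ g → a · f ≈ b · g
  ·-cong {a} {b} {f} {g} p q = coeffwise λ n →
    R.trans (coeff-· a f n)
      (R.trans (R.*-cong p (coeff-≈ q n)) (R.sym (coeff-· b g n)))

  +-identityʳ : ∀ f → f + [] ≈ f
  +-identityʳ []      = ≈-refl
  +-identityʳ (a ∷ f) = ≈-refl

  +-assoc : ∀ f g h → (f + g) + h ≈ f + (g + h)
  +-assoc []      g       h       = ≈-refl
  +-assoc (a ∷ f) []      h       = ≈-refl
  +-assoc (a ∷ f) (b ∷ g) []      = ≈-refl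
  +-assoc (a ∷ f) (b ∷ g) (d ∷ h) = ∷-cong (R.+-assoc a b d) (+-assoc f g h)

  +-comm : ∀ f g → f + g ≈ g + f
  +-comm []      []      = ≈-refl
  +-comm []      (b ∷ g) = ≈-refl
  +-comm (a ∷ f) []      = ≈-refl
  +-comm (a ∷ f) (b ∷ g) = ∷-cong (R.+-comm a b) (+-comm f g)

  -‿inverseʳ : ∀ f → f + - f ≈ []
  -‿inverseʳ []      = ≈-refl
  -‿inverseʳ (a ∷ f) = 0∷-≈[] (R.-‿inverseʳ a) (-‿inverseʳ f)

  +-interchange : ∀ f g h k → (f + g) + (h + k) ≈ (f + h) + (g + k)
  +-interchange f g h k = begin
    (f + g) + (h + k)  ≈⟨ +-assoc f g (h + k) ⟩
    f + (g + (h + k))  ≈⟨ +-cong (≈-refl {f}) (+-assoc g h k) ⟨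
    f + ((g + h) + k)  ≈⟨ +-cong (≈-refl {f}) (+-cong (+-comm g h) (≈-refl {k})) ⟩
    f + ((h + g) + k)  ≈⟨ +-cong (≈-refl {f}) (+-assoc h g k) ⟩
    f + (h + (g + k))  ≈⟨ +-assoc f h (g + k) ⟨
    (f + h) + (g + k)  ∎

  ·-distribˡ : ∀ a f g → a · (f + g) ≈ a · f + a · g
  ·-distribˡ a []      g       = ≈-refl
  ·-distribˡ a (b ∷ f) []      = ≈-refl
  ·-distribˡ a (b ∷ f) (d ∷ g) = ∷-cong (R.distribˡ a b d) (·-distribˡ a f g)

  ·-assoc : ∀ a b f → a · (b · f) ≈ (a R.* b) · f
  ·-assoc a b []      = ≈-refl
  ·-assoc a b (d ∷ f) = ∷-cong (R.sym (R.*-assoc a b d)) (·-assoc a b f)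

  0·f≈[] : ∀ f → R.0# · f ≈ []
  0·f≈[] []      = ≈-refl
  0·f≈[] (a ∷ f) = 0∷-≈[] (R.zeroˡ a) (0·f≈[] f)

  1·f≈f : ∀ f → R.1# · f ≈ f
  1·f≈f []      = ≈-refl
  1·f≈f (a ∷ f) = ∷-cong (R.*-identityˡ a) (1·f≈f f)

  0∷-+ : ∀ f g → R.0# ∷ (f + g) ≈ (R.0# ∷ f) + (R.0# ∷ g)
  0∷-+ f g = ∷-cong (R.sym (R.+-identityˡ R.0#)) ≈-refl

  *-zeroʳ : ∀ f → f * [] ≈ []
  *-zeroʳ []      = ≈-refl
  *-zeroʳ (a ∷ f) = 0∷-≈[] R.refl (*-zeroʳ f)

  *-congˡ : ∀ f {g g′} → g ≈ g′ → f * g ≈ f * g′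
  *-congˡ []      p = ≈-refl
  *-congˡ (a ∷ f) p = +-cong (·-cong R.refl p) (∷-cong R.refl (*-congˡ f p))

  -- The defining recursion of `_*_` mirrored in the second argument. Comparing the two recursions
  -- gives `*-comm`, from which congruence on the left and right distributivity follow.
  *-∷ : ∀ f b g → f * (b ∷ g) ≈ b · f + (R.0# ∷ (f * g))
  *-∷ []      b g = coeffwise λ { zero → R.refl ; (suc n) → R.refl }
  *-∷ (a ∷ f) b g = ∷-cong (R.+-congʳ (R.*-comm a b)) (begin
    a · g + (f * (b ∷ g))              ≈⟨ +-cong (≈-refl {a · g}) (*-∷ f b g) ⟩
    a · g + (b · f + (R.0# ∷ (f * g))) ≈⟨ +-assoc (a · g) (b · f) _ ⟨
    a · g + b · f + (R.0# ∷ (f * g))   ≈⟨ +-cong (+-comm (a · g) (b · f)) (≈-refl {R.0# ∷ (f * g)}) ⟩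
    b · f + a · g + (R.0# ∷ (f * g))   ≈⟨ +-assoc (b · f) (a · g) _ ⟩
    b · f + (a · g + (R.0# ∷ (f * g))) ∎)

  *-comm : ∀ f g → f * g ≈ g * f
  *-comm []      g = ≈-sym (*-zeroʳ g)
  *-comm (a ∷ f) g = begin
    a · g + (R.0# ∷ (f * g))  ≈⟨ +-cong (≈-refl {a · g}) (∷-cong R.refl (*-comm f g)) ⟩
    a · g + (R.0# ∷ (g * f))  ≈⟨ *-∷ g a f ⟨
    g * (a ∷ f)               ∎

  *-cong : ∀ {f f′ g g′} → f ≈ f′ → g ≈ g′ → f * g ≈ f′ * g′
  *-cong {f} {f′} {g} {g′} p q = begin
    f * g   ≈⟨ *-congˡ f q ⟩
    f * g′  ≈⟨ *-comm f g′ ⟩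
    g′ * f  ≈⟨ *-congˡ g′ p ⟩
    g′ * f′ ≈⟨ *-comm g′ f′ ⟩
    f′ * g′ ∎

  *-distribˡ : ∀ f g h → f * (g + h) ≈ f * g + f * h
  *-distribˡ []      g h = ≈-refl
  *-distribˡ (a ∷ f) g h = begin
    a · (g + h) + (R.0# ∷ (f * (g + h)))
      ≈⟨ +-cong (·-distribˡ a g h) (∷-cong R.refl (*-distribˡ f g h)) ⟩
    (a · g + a · h) + (R.0# ∷ (f * g + f * h))
      ≈⟨ +-cong (≈-refl {a · g + a · h}) (0∷-+ (f * g) (f * h)) ⟩
    (a · g + a · h) + ((R.0# ∷ (f * g)) + (R.0# ∷ (f * h)))
      ≈⟨ +-interchange (a · g) (a · h) _ _ ⟩
    (a ∷ f) * g + (a ∷ f) * h ∎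

  *-distribʳ : ∀ f g h → (g + h) * f ≈ g * f + h * f
  *-distribʳ f g h = begin
    (g + h) * f    ≈⟨ *-comm (g + h) f ⟩
    f * (g + h)    ≈⟨ *-distribˡ f g h ⟩
    f * g + f * h  ≈⟨ +-cong (*-comm f g) (*-comm f h) ⟩
    g * f + h * f  ∎

  ·-*-assoc : ∀ a f g → (a · f) * g ≈ a · (f * g)
  ·-*-assoc a []      g = ≈-refl
  ·-*-assoc a (b ∷ f) g = begin
    (a R.* b) · g + (R.0# ∷ ((a · f) * g))
      ≈⟨ +-cong (≈-sym (·-assoc a b g)) (∷-cong (R.sym (R.zeroʳ a)) (·-*-assoc a f g)) ⟩
    a · (b · g) + a · (R.0# ∷ (f * g))
      ≈⟨ ·-distribˡ a (b · g) _ ⟨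
    a · (b · g + (R.0# ∷ (f * g))) ∎

  0∷-* : ∀ f g → (R.0# ∷ f) * g ≈ R.0# ∷ (f * g)
  0∷-* f g = +-cong (0·f≈[] g) ≈-refl

  *-assoc : ∀ f g h → (f * g) * h ≈ f * (g * h)
  *-assoc []      g h = ≈-refl
  *-assoc (a ∷ f) g h = begin
    (a · g + (R.0# ∷ (f * g))) * h
      ≈⟨ *-distribʳ h (a · g) _ ⟩
    (a · g) * h + (R.0# ∷ (f * g)) * h
      ≈⟨ +-cong (·-*-assoc a g h) (≈-trans (0∷-* (f * g) h) (∷-cong R.refl (*-assoc f g h))) ⟩
    a · (g * h) + (R.0# ∷ (f * (g * h))) ∎

  const-* : ∀ a f → const a * f ≈ a · f
  const-* a f = ≈-trans (+-cong (≈-refl {a · f}) (0∷-≈[] R.refl ≈-refl)) (+-identityʳ (a · f))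

  *-identityˡ : ∀ f → const R.1# * f ≈ f
  *-identityˡ f = ≈-trans (const-* R.1# f) (1·f≈f f)

  opaque
    isCommutativeRing : IsCommutativeRing _≈_ _+_ _*_ -_ [] (const R.1#)
    isCommutativeRing = record
      { isRing = record
        { +-isAbelianGroup = record
          { isGroup = record
            { isMonoid = record
              { isSemigroup = record
                { isMagma = record
                  { isEquivalence = Setoid.isEquivalence ≈-setoid
                  ; ∙-cong = +-cong
                  }
                ; assoc = +-assoc
                }
              ; identity = (λ _ → ≈-refl) , +-identityʳ
              }
            ; inverse = (λ f → ≈-trans (+-comm (- f) f) (-‿inverseʳ f)) , -‿inverseʳ
            ; ⁻¹-cong = -‿cong
            }
          ; comm = +-comm
          }
        ; *-cong = *-cong
        ; *-assoc = *-assoc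
        ; *-identity = *-identityˡ , λ f → ≈-trans (*-comm f _) (*-identityˡ f)
        ; distrib = *-distribˡ , *-distribʳ
        }
      ; *-comm = *-comm
      }

  commutativeRing : CommutativeRing c ℓ
  commutativeRing = record { isCommutativeRing = isCommutativeRing }

  X-* : ∀ f → X * f ≈ R.0# ∷ f
  X-* f = ≈-trans (0∷-* (const R.1#) f) (∷-cong R.refl (*-identityˡ f))

  ∷-split : ∀ a f → a ∷ f ≈ const a + X * f
  ∷-split a f = ≈-sym (≈-trans (+-cong (≈-refl {const a}) (X-* f)) (∷-cong (R.+-identityʳ a) ≈-refl))

  coeff-const-* : ∀ a f n → coeff (const a * f) n R.≈ a R.* coeff f n
  coeff-const-* a f n = R.trans (coeff-≈ (const-* a f) n) (coeff-· a f n)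

  const-+ : ∀ a b → const (a R.+ b) ≈ const a + const b
  const-+ a b = ≈-refl

  const-*-const : ∀ a b → const a * const b ≈ const (a R.* b)
  const-*-const a b = const-* a (const b)

  const-cong : ∀ {a b} → a R.≈ b → const a ≈ const b
  const-cong p = ∷-cong p ≈-refl

  coeff-*-zero : ∀ f g → coeff (f * g) 0 R.≈ coeff f 0 R.* coeff g 0
  coeff-*-zero []      g = R.sym (R.zeroˡ _)
  coeff-*-zero (a ∷ f) g = R.trans (coeff-+ (a · g) _ 0) (R.trans (R.+-identityʳ _) (coeff-· a g 0))

  coeff-∷-*-suc : ∀ a f g n →
    coeff ((a ∷ f) * g) (suc n) R.≈ a R.* coeff g (suc n) R.+ coeff (f * g) n
  coeff-∷-*-suc a f g n =
    R.trans (coeff-+ (a · g) _ (suc n)) (R.+-congʳ (coeff-· a g (suc n)))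

-- Ring homomorphisms, evaluation and quadratic extensions

infix 9 _[X]
_[X] : ∀ {c ℓ} → CommutativeRing c ℓ → CommutativeRing c ℓ
R [X] = PolynomialRing.commutativeRing R

record RingHom {a b c d} (R : CommutativeRing a b) (S : CommutativeRing c d) : Set (a ⊔ b ⊔ c ⊔ d) where
  private
    module R = CommutativeRing R
    module S = CommutativeRing S
  field
    ⟦_⟧    : R.Carrier → S.Carrier
    cong   : ∀ {x y} → x R.≈ y → ⟦ x ⟧ S.≈ ⟦ y ⟧
    +-homo : ∀ x y → ⟦ x R.+ y ⟧ S.≈ ⟦ x ⟧ S.+ ⟦ y ⟧
    *-homo : ∀ x y → ⟦ x R.* y ⟧ S.≈ ⟦ x ⟧ S.* ⟦ y ⟧
    0-homo : ⟦ R.0# ⟧ S.≈ S.0#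
    1-homo : ⟦ R.1# ⟧ S.≈ S.1#

  neg-homo : ∀ x → ⟦ R.- x ⟧ S.≈ S.- ⟦ x ⟧
  neg-homo x = inverseˡ-unique _ _
    (S.trans (S.sym (+-homo (R.- x) x)) (S.trans (cong (R.-‿inverseˡ x)) 0-homo))
    where open import Algebra.Properties.Group S.+-group using (inverseˡ-unique)

  sub-homo : ∀ x y → ⟦ x R.- y ⟧ S.≈ ⟦ x ⟧ S.- ⟦ y ⟧
  sub-homo x y = S.trans (+-homo x (R.- y)) (S.+-congˡ (neg-homo y))

module Evaluation {a b c d} {R : CommutativeRing a b} {S : CommutativeRing c d}
                  (ι : RingHom R S) (t : CommutativeRing.Carrier S) where

  private
    module R = CommutativeRing R
    module S = CommutativeRing S
    module ι = RingHom ι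
    open PolynomialRing R
    open IntegerSolver S
    open SetoidReasoning S.setoid

  eval : Poly → S.Carrier
  eval []      = S.0#
  eval (a ∷ f) = ι.⟦ a ⟧ S.+ t S.* eval f

  private
    0+t0 : ∀ {a x} → a S.≈ S.0# → x S.≈ S.0# → a S.+ t S.* x S.≈ S.0#
    0+t0 p q = S.trans (S.+-cong p (S.trans (S.*-congˡ q) (S.zeroʳ t))) (S.+-identityˡ S.0#)

    eval-≈[] : ∀ f → f ≈ [] → eval f S.≈ S.0#
    eval-≈[] []      p = S.refl
    eval-≈[] (a ∷ f) p = 0+t0 (S.trans (ι.cong (coeff-≈ p 0)) ι.0-homo) (eval-≈[] f (tail-≈[] p))

    eval-cong : ∀ f g → f ≈ g → eval f S.≈ eval g
    eval-cong []      g       p = S.sym (eval-≈[] g (≈-sym p))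
    eval-cong (a ∷ f) []      p = eval-≈[] (a ∷ f) p
    eval-cong (a ∷ f) (b ∷ g) p =
      S.+-cong (ι.cong (coeff-≈ p 0)) (S.*-congˡ (eval-cong f g (tail-≈ p)))

    eval-+ : ∀ f g → eval (f + g) S.≈ eval f S.+ eval g
    eval-+ []      g       = S.sym (S.+-identityˡ _)
    eval-+ (a ∷ f) []      = S.sym (S.+-identityʳ _)
    eval-+ (a ∷ f) (b ∷ g) = S.trans
      (S.+-cong (ι.+-homo a b) (S.*-congˡ (eval-+ f g)))
      (solve 5 (λ a b t x y → (a :+ b) :+ t :* (x :+ y) := (a :+ t :* x) :+ (b :+ t :* y))
        S.refl ι.⟦ a ⟧ ι.⟦ b ⟧ t (eval f) (eval g))

    eval-· : ∀ a f → eval (a · f) S.≈ ι.⟦ a ⟧ S.* eval f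
    eval-· a []      = S.sym (S.zeroʳ _)
    eval-· a (b ∷ f) = S.trans
      (S.+-cong (ι.*-homo a b) (S.*-congˡ (eval-· a f)))
      (solve 4 (λ a b t x → a :* b :+ t :* (a :* x) := a :* (b :+ t :* x))
        S.refl ι.⟦ a ⟧ ι.⟦ b ⟧ t (eval f))

    eval-* : ∀ f g → eval (f * g) S.≈ eval f S.* eval g
    eval-* []      g = S.sym (S.zeroˡ _)
    eval-* (a ∷ f) g = begin
      eval (a · g + (R.0# ∷ (f * g)))                      ≈⟨ eval-+ (a · g) _ ⟩
      eval (a · g) S.+ (ι.⟦ R.0# ⟧ S.+ t S.* eval (f * g))
        ≈⟨ S.+-cong (eval-· a g) (S.+-cong ι.0-homo (S.*-congˡ (eval-* f g))) ⟩
      ι.⟦ a ⟧ S.* eval g S.+ (S.0# S.+ t S.* (eval f S.* eval g))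
        ≈⟨ solve 4 (λ a t x y → a :* y :+ (con (+ 0) :+ t :* (x :* y)) := (a :+ t :* x) :* y)
             S.refl ι.⟦ a ⟧ t (eval f) (eval g) ⟩
      (ι.⟦ a ⟧ S.+ t S.* eval f) S.* eval g ∎

  eval-const : ∀ a → eval (const a) S.≈ ι.⟦ a ⟧
  eval-const a = S.trans (S.+-congˡ (S.zeroʳ t)) (S.+-identityʳ _)

  evalHom : RingHom commutativeRing S
  evalHom = record
    { ⟦_⟧    = eval
    ; cong   = λ {f} {g} → eval-cong f g
    ; +-homo = eval-+
    ; *-homo = eval-*
    ; 0-homo = S.refl
    ; 1-homo = S.trans (eval-const R.1#) ι.1-homo
    }

  eval-X : eval X S.≈ t
  eval-X = S.trans (S.+-cong ι.0-homo (S.*-congˡ (S.trans (eval-const R.1#) ι.1-homo)))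
    (S.trans (S.+-identityˡ _) (S.*-identityʳ t))

module PolynomialHom {a b c d} {R : CommutativeRing a b} {S : CommutativeRing c d}
                     (ι : RingHom R S) (t : CommutativeRing.Carrier S) where

  open PolynomialRing R using (const; X)
  open CommutativeRing S using (_≈_)

  -- Opaque because type checking the concrete instances over ℚ[x] becomes
  -- infeasible as soon as they unfold.
  opaque
    hom : RingHom (R [X]) S
    hom = Evaluation.evalHom ι t

    hom-const : ∀ a → RingHom.⟦_⟧ hom (const a) ≈ RingHom.⟦_⟧ ι a
    hom-const = Evaluation.eval-const ι t

    hom-X : RingHom.⟦_⟧ hom X ≈ t
    hom-X = Evaluation.eval-X ι t

-- S[ξ] with ξ² = σ, the pair (a , b) standing for a + b ξ.
module QuadraticExtension {c ℓ} (S : CommutativeRing c ℓ) (σ : CommutativeRing.Carrier S) where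

  open CommutativeRing S
  open IntegerSolver S

  private
    Pair = Carrier × Carrier

  _≈₂_ : Pair → Pair → Set ℓ
  (a , b) ≈₂ (c , d) = (a ≈ c) × (b ≈ d)

  _+₂_ _*₂_ : Pair → Pair → Pair
  (a , b) +₂ (c , d) = a + c , b + d
  (a , b) *₂ (c , d) = a * c + σ * (b * d) , a * d + b * c

  -₂_ : Pair → Pair
  -₂ (a , b) = - a , - b

  opaque
    isCommutativeRing₂ : IsCommutativeRing _≈₂_ _+₂_ _*₂_ -₂_ (0# , 0#) (1# , 0#)
    isCommutativeRing₂ = record
      { isRing = record
        { +-isAbelianGroup = record
          { isGroup = record
            { isMonoid = record
              { isSemigroup = record
                { isMagma = record
                  { isEquivalence = record
                    { refl  = refl , refl
                    ; sym   = λ (p , q) → sym p , sym q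
                    ; trans = λ (p , q) (r , s) → trans p r , trans q s
                    }
                  ; ∙-cong = λ (p , q) (r , s) → +-cong p r , +-cong q s
                  }
                ; assoc = λ _ _ _ → +-assoc _ _ _ , +-assoc _ _ _
                }
              ; identity = (λ _ → +-identityˡ _ , +-identityˡ _)
                         , (λ _ → +-identityʳ _ , +-identityʳ _)
              }
            ; inverse = (λ _ → -‿inverseˡ _ , -‿inverseˡ _)
                      , (λ _ → -‿inverseʳ _ , -‿inverseʳ _)
            ; ⁻¹-cong = λ (p , q) → -‿cong p , -‿cong q
            }
          ; comm = λ _ _ → +-comm _ _ , +-comm _ _
          }
        ; *-cong = λ (p , q) (r , s) →
            +-cong (*-cong p r) (*-congˡ (*-cong q s)) , +-cong (*-cong p s) (*-cong q r)
        ; *-assoc = λ (a , b) (c , d) (e , f) →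
            solve 7 (λ a b c d e f σ →
                (a :* c :+ σ :* (b :* d)) :* e :+ σ :* ((a :* d :+ b :* c) :* f)
                := a :* (c :* e :+ σ :* (d :* f)) :+ σ :* (b :* (c :* f :+ d :* e)))
              refl a b c d e f σ
          , solve 7 (λ a b c d e f σ →
                (a :* c :+ σ :* (b :* d)) :* f :+ (a :* d :+ b :* c) :* e
                := a :* (c :* f :+ d :* e) :+ b :* (c :* e :+ σ :* (d :* f)))
              refl a b c d e f σ
        ; *-identity =
            (λ (a , b) →
                solve 3 (λ a b σ → con (+ 1) :* a :+ σ :* (con (+ 0) :* b) := a) refl a b σ
              , solve 2 (λ a b → con (+ 1) :* b :+ con (+ 0) :* a := b) refl a b)
          , (λ (a , b) →
                solve 3 (λ a b σ → a :* con (+ 1) :+ σ :* (b :* con (+ 0)) := a) refl a b σ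
              , solve 2 (λ a b → a :* con (+ 0) :+ b :* con (+ 1) := b) refl a b)
        ; distrib =
            (λ (a , b) (c , d) (e , f) →
                solve 7 (λ a b c d e f σ →
                    a :* (c :+ e) :+ σ :* (b :* (d :+ f))
                    := (a :* c :+ σ :* (b :* d)) :+ (a :* e :+ σ :* (b :* f)))
                  refl a b c d e f σ
              , solve 6 (λ a b c d e f →
                    a :* (d :+ f) :+ b :* (c :+ e)
                    := (a :* d :+ b :* c) :+ (a :* f :+ b :* e))
                  refl a b c d e f)
          , (λ (a , b) (c , d) (e , f) →
                solve 7 (λ a b c d e f σ →
                    (c :+ e) :* a :+ σ :* ((d :+ f) :* b)
                    := (c :* a :+ σ :* (d :* b)) :+ (e :* a :+ σ :* (f :* b)))
                  refl a b c d e f σ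
              , solve 6 (λ a b c d e f →
                    (c :+ e) :* b :+ (d :+ f) :* a
                    := (c :* b :+ d :* a) :+ (e :* b :+ f :* a))
                  refl a b c d e f)
        }
      ; *-comm = λ (a , b) (c , d) →
            solve 5 (λ a b c d σ → a :* c :+ σ :* (b :* d) := c :* a :+ σ :* (d :* b))
              refl a b c d σ
          , solve 4 (λ a b c d → a :* d :+ b :* c := c :* b :+ d :* a) refl a b c d
      }

  commutativeRing₂ : CommutativeRing c ℓ
  commutativeRing₂ = record { isCommutativeRing = isCommutativeRing₂ }

  embed : RingHom S commutativeRing₂
  embed = record
    { ⟦_⟧    = λ a → a , 0#
    ; cong   = λ p → p , refl
    ; +-homo = λ a b → refl , sym (+-identityˡ 0#)
    ; *-homo = λ a b →
        solve 3 (λ a b σ → a :* b := a :* b :+ σ :* (con (+ 0) :* con (+ 0))) refl a b σ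
      , solve 2 (λ a b → con (+ 0) := a :* con (+ 0) :+ con (+ 0) :* b) refl a b
    ; 0-homo = refl , refl
    ; 1-homo = refl , refl
    }

  embed-*-ξ : ∀ a b → ((a , 0#) *₂ (0# , b)) ≈₂ (0# , a * b)
  embed-*-ξ a b =
      solve 3 (λ a b σ → a :* con (+ 0) :+ σ :* (con (+ 0) :* b) := con (+ 0)) refl a b σ
    , solve 2 (λ a b → a :* b :+ con (+ 0) :* con (+ 0) := a :* b) refl a b

-- Polynomials modulo a prime ideal

record PrimeIdeal {c ℓ} (R : CommutativeRing c ℓ) p : Set (c ⊔ ℓ ⊔ lsuc p) where
  open CommutativeRing R
  field
    Mem   : Carrier → Set p
    Mem?  : ∀ a → Dec (Mem a)
    resp  : ∀ {a b} → a ≈ b → Mem a → Mem b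
    0∈    : Mem 0#
    +-∈   : ∀ {a b} → Mem a → Mem b → Mem (a + b)
    *-∈   : ∀ a {b} → Mem b → Mem (a * b)
    prime : ∀ a b → Mem (a * b) → Mem a ⊎ Mem b

module PolynomialsModPrime {c ℓ p} {R : CommutativeRing c ℓ} (P : PrimeIdeal R p) where

  private module R = CommutativeRing R
  open PrimeIdeal P
  open PolynomialRing R
  open IntegerSolver commutativeRing using (solve; _:+_; _:*_; :-_; _:=_)
  private module S = IntegerSolver R

  -- The polynomials that vanish in (R/P)[X]. The quotient is never formed, so that the ideals (2)
  -- and (p) of ℤ and the zero ideals of ℤ and ℚ share the same lemmas.
  In : Poly → Set p
  In f = ∀ n → Mem (coeff f n)

  cancel-∈ : ∀ {a b} → Mem a → Mem (a R.+ b) → Mem b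
  cancel-∈ {a} {b} a∈ a+b∈ =
    resp (S.solve 2 (λ a b → S.con (ℤ.- + 1) S.:* a S.:+ (a S.:+ b) S.:= b) R.refl a b)
      (+-∈ (*-∈ (R.- R.1#) a∈) a+b∈)

  ∈-* : ∀ {a} b → Mem a → Mem (a R.* b)
  ∈-* {a} b a∈ = resp (R.*-comm b a) (*-∈ b a∈)

  In-resp : ∀ {f g} → f ≈ g → In f → In g
  In-resp p f∈ n = resp (coeff-≈ p n) (f∈ n)

  In-+ : ∀ {f g} → In f → In g → In (f + g)
  In-+ {f} {g} f∈ g∈ n = resp (R.sym (coeff-+ f g n)) (+-∈ (f∈ n) (g∈ n))

  In-* : ∀ f {g} → In g → In (f * g)
  In-* []      g∈ n       = 0∈
  In-* (a ∷ f) {g} g∈ zero    =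
    resp (R.sym (coeff-*-zero (a ∷ f) g)) (*-∈ a (g∈ 0))
  In-* (a ∷ f) {g} g∈ (suc n) =
    resp (R.sym (coeff-∷-*-suc a f g n)) (+-∈ (*-∈ a (g∈ (suc n))) (In-* f g∈ n))

  In-cancel-+ : ∀ {f g} → In f → In (f + g) → In g
  In-cancel-+ {f} {g} f∈ f+g∈ n = cancel-∈ (f∈ n) (resp (coeff-+ f g n) (f+g∈ n))

  In-const : ∀ {a} → Mem a → In (const a)
  In-const a∈ zero    = a∈
  In-const a∈ (suc n) = 0∈

  In-∷ : ∀ {a f} → Mem a → In f → In (a ∷ f)
  In-∷ a∈ f∈ zero    = a∈
  In-∷ a∈ f∈ (suc n) = f∈ n

  In-X* : ∀ f → In (X * f) → In f
  In-X* f Xf∈ n = In-resp (X-* f) Xf∈ (suc n)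

  private
    coeff-*-∷-suc : ∀ f b g n →
      coeff (f * (b ∷ g)) (suc n) R.≈ b R.* coeff f (suc n) R.+ coeff (f * g) n
    coeff-*-∷-suc f b g n = R.trans (coeff-≈ (*-∷ f b g) (suc n))
      (R.trans (coeff-+ (b · f) _ (suc n)) (R.+-congʳ (coeff-· b f (suc n))))

  -- One of the two constant terms lies in P. Its contribution to the product can then be discarded,
  -- which leaves a shorter list in its place with the product still in P[X].
  In-prime : ∀ f g → In (f * g) → In f ⊎ In g
  In-prime []      g       _   = inj₁ λ _ → 0∈
  In-prime (a ∷ f) []      _   = inj₂ λ _ → 0∈
  In-prime (a ∷ f) (b ∷ g) fg∈ =
    [ (λ a∈ → [ (λ f∈ → inj₁ (In-∷ a∈ f∈)) , inj₂ ]′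
        (In-prime f (b ∷ g) λ n →
          cancel-∈ (∈-* _ a∈) (resp (coeff-∷-*-suc a f (b ∷ g) n) (fg∈ (suc n)))))
    , (λ b∈ → [ inj₁ , (λ g∈ → inj₂ (In-∷ b∈ g∈)) ]′
        (In-prime (a ∷ f) g λ n →
          cancel-∈ (∈-* _ b∈) (resp (coeff-*-∷-suc (a ∷ f) b g n) (fg∈ (suc n)))))
    ]′ (prime a b (resp (coeff-*-zero (a ∷ f) (b ∷ g)) (fg∈ 0)))

  In-square : ∀ f → In (f * f) → In f
  In-square f f²∈ = [ id , id ]′ (In-prime f f f²∈)

  -- If f² + X g² vanishes, so does the constant term of f; writing f = X f′
  -- leaves g² + X f′², which is smaller and of the same shape.
  In-f²+Xg² : ∀ f g → In (f * f + X * (g * g)) → In f × In g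
  In-f²+Xg² []      g p = (λ _ → 0∈) , In-square g (In-X* (g * g) p)
  In-f²+Xg² (a ∷ f) g p = In-∷ a∈ (proj₂ rec) , proj₁ rec
    where
    constant-term : coeff ((a ∷ f) * (a ∷ f) + X * (g * g)) 0 R.≈ a R.* a
    constant-term = R.trans (coeff-+ ((a ∷ f) * (a ∷ f)) (X * (g * g)) 0)
      (R.trans (R.+-cong (coeff-*-zero (a ∷ f) (a ∷ f)) (coeff-≈ (X-* (g * g)) 0)) (R.+-identityʳ _))

    a∈ : Mem a
    a∈ = [ id , id ]′ (prime a a (resp constant-term (p 0)))

    split : (a ∷ f) * (a ∷ f) + X * (g * g)
          ≈ (const a + X * f + X * f) * const a + X * (g * g + X * (f * f))
    split = ≈-trans (+-cong (*-cong (∷-split a f) (∷-split a f)) (≈-refl {X * (g * g)}))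
      (solve 4 (λ a x f g → (a :+ x :* f) :* (a :+ x :* f) :+ x :* (g :* g)
          := (a :+ x :* f :+ x :* f) :* a :+ x :* (g :* g :+ x :* (f :* f)))
        ≈-refl (const a) X f g)

    rec : In g × In f
    rec = In-f²+Xg² g f (In-X* (g * g + X * (f * f))
      (In-cancel-+ {f = (const a + X * f + X * f) * const a}
        (In-* (const a + X * f + X * f) (In-const a∈)) (In-resp split p)))

  -- The lowest coefficient of g outside P, multiplied by the constant term of f, would survive at
  -- the same position of f g. The induction strips the constant term of g, which must lie in P.
  In-low : ∀ f g m → ¬ Mem (coeff f 0) → (∀ j → j ℕ.< m → Mem (coeff (f * g) j)) →
           ∀ j → j ℕ.< m → Mem (coeff g j)
  In-low f []      m       a∉ fg∈ j       j<m       = 0∈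
  In-low f (b ∷ g) (suc m) a∉ fg∈ j       (s≤s j≤m) with prime _ b (resp (coeff-*-zero f (b ∷ g)) (fg∈ 0 (s≤s z≤n)))
  ... | inj₁ a∈ = contradiction a∈ a∉
  In-low f (b ∷ g) (suc m) a∉ fg∈ zero    (s≤s j≤m) | inj₂ b∈ = b∈
  In-low f (b ∷ g) (suc m) a∉ fg∈ (suc j) (s≤s j≤m) | inj₂ b∈ =
    In-low f g m a∉
      (λ i i<m → cancel-∈ (∈-* _ b∈) (resp (coeff-*-∷-suc f b g i) (fg∈ (suc i) (s≤s i<m))))
      j j≤m

-- Degrees over a domain and Bézout identities over a field

IsZeroIdeal : ∀ {c ℓ p} {R : CommutativeRing c ℓ} → PrimeIdeal R p → Set (c ⊔ ℓ ⊔ p)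
IsZeroIdeal {R = R} P = ∀ {a} → PrimeIdeal.Mem P a → a ≈ 0#
  where open CommutativeRing R

module PolynomialsOverDomain {c ℓ p} {R : CommutativeRing c ℓ} (P : PrimeIdeal R p)
                             (∈⇒≈0 : IsZeroIdeal P) where

  private module R = CommutativeRing R
  open PrimeIdeal P
  open PolynomialsModPrime P
  open PolynomialRing R

  *-zero-divisor : ∀ f g → f * g ≈ [] → f ≈ [] ⊎ g ≈ []
  *-zero-divisor f g fg≈0 =
    [ (λ f∈ → inj₁ (In⇒≈[] f∈)) , (λ g∈ → inj₂ (In⇒≈[] g∈)) ]′
      (In-prime f g λ n → resp (R.sym (coeff-≈ fg≈0 n)) 0∈)
    where
    In⇒≈[] : ∀ {f} → In f → f ≈ []
    In⇒≈[] f∈ = coeffwise λ n → ∈⇒≈0 (f∈ n)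

  -- Coefficient lists may end in zeros, so the degree is read off the coefficients and not the
  -- length. `Mem` acts as the zero test, and the zero polynomial has no degree.
  record HasDegree (f : Poly) (d : ℕ) : Set (ℓ ⊔ p) where
    field
      leading : ¬ Mem (coeff f d)
      above   : ∀ i → d ℕ.< i → coeff f i R.≈ R.0#
  open HasDegree

  degree? : ∀ f → f ≈ [] ⊎ ∃ (HasDegree f)
  degree? []      = inj₁ ≈-refl
  degree? (a ∷ f) with degree? f | Mem? a
  ... | inj₂ (d , f-deg) | _ = inj₂ (suc d , record
    { leading = leading f-deg
    ; above   = λ { (suc i) (s≤s d<i) → above f-deg i d<i } })
  ... | inj₁ f≈0 | yes a∈ = inj₁ (0∷-≈[] (∈⇒≈0 a∈) f≈0)
  ... | inj₁ f≈0 | no  a∉ = inj₂ (0 , record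
    { leading = a∉ ; above = λ { (suc i) _ → coeff-≈ f≈0 i } })

  degree-resp : ∀ {f g d} → f ≈ g → HasDegree f d → HasDegree g d
  degree-resp p f-deg = record
    { leading = λ g∈ → leading f-deg (resp (R.sym (coeff-≈ p _)) g∈)
    ; above   = λ i d<i → R.trans (R.sym (coeff-≈ p i)) (above f-deg i d<i)
    }

  degree-unique : ∀ {f d e} → HasDegree f d → HasDegree f e → d ≡ e
  degree-unique {f} {d} {e} f-d f-e with ℕ.<-cmp d e
  ... | tri≈ _ d≡e _ = d≡e
  ... | tri< d<e _ _ = contradiction (resp (R.sym (above f-d e d<e)) 0∈) (leading f-e)
  ... | tri> _ _ e<d = contradiction (resp (R.sym (above f-e d e<d)) 0∈) (leading f-d)

  degree-* : ∀ f g {d e} → HasDegree f d → HasDegree g e → HasDegree (f * g) (d ℕ.+ e)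
  degree-* []      g f-d g-e = contradiction 0∈ (leading f-d)
  degree-* (a ∷ f) g {zero} {e} f-d g-e = record
    { leading = λ ag∈ → [ leading f-d , leading g-e ]′ (prime _ _ (resp (coeff-ag e) ag∈))
    ; above   = λ i e<i → R.trans (coeff-ag i) (R.trans (R.*-congˡ (above g-e i e<i)) (R.zeroʳ a))
    }
    where
    a∷f≈a : a ∷ f ≈ const a
    a∷f≈a = ∷-cong R.refl (coeffwise λ n → above f-d (suc n) (s≤s z≤n))
    coeff-ag : ∀ i → coeff ((a ∷ f) * g) i R.≈ a R.* coeff g i
    coeff-ag i = R.trans (coeff-≈ (*-cong a∷f≈a (≈-refl {g})) i) (coeff-const-* a g i)
  degree-* (a ∷ f) g {suc d} {e} f-d g-e = record
    { leading = λ fg∈ → leading fg-deg (resp (shift (d ℕ.+ e) (ℕ.m≤n+m e d)) fg∈)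
    ; above   = λ { (suc i) (s≤s d+e<i) →
        R.trans (shift i (ℕ.≤-trans (ℕ.m≤n+m e d) (ℕ.<⇒≤ d+e<i))) (above fg-deg i d+e<i) }
    }
    where
    fg-deg : HasDegree (f * g) (d ℕ.+ e)
    fg-deg = degree-* f g
      (record { leading = leading f-d ; above = λ i d<i → above f-d (suc i) (s≤s d<i) }) g-e
    shift : ∀ i → e ℕ.≤ i → coeff ((a ∷ f) * g) (suc i) R.≈ coeff (f * g) i
    shift i e≤i = R.trans (coeff-∷-*-suc a f g i)
      (R.trans (R.+-congʳ (R.trans (R.*-congˡ (above g-e (suc i) (s≤s e≤i))) (R.zeroʳ a)))
        (R.+-identityˡ _))

-- The identity concerns the cofactors instead of `gcd`: they are coprime without any cancellation,
-- even when f and g both vanish.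
record Bézout {c ℓ} (R : CommutativeRing c ℓ) (f g : CommutativeRing.Carrier R) : Set (c ⊔ ℓ) where
  open CommutativeRing R
  field
    gcd f/gcd g/gcd u v : Carrier
    f≈       : f ≈ gcd * f/gcd
    g≈       : g ≈ gcd * g/gcd
    identity : u * f/gcd + v * g/gcd ≈ 1#

HasInverses : ∀ {c ℓ} → CommutativeRing c ℓ → Set (c ⊔ ℓ)
HasInverses F = ∀ a → (a ≈ 0#) ⊎ ∃ λ b → b * a ≈ 1#
  where open CommutativeRing F

module PolynomialsOverField {c ℓ} (F : CommutativeRing c ℓ) (inverse : HasInverses F) where

  private module F = CommutativeRing F
  open PolynomialRing F
  open IntegerSolver commutativeRing using (solve; con; _:+_; _:*_; _:-_; :-_; _:=_)
  open SetoidReasoning ≈-setoid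

  private
    Bézoutᴾ : Poly → Poly → Set (c ⊔ ℓ)
    Bézoutᴾ = Bézout commutativeRing

  Bézout-swap : ∀ {f g} → Bézoutᴾ f g → Bézoutᴾ g f
  Bézout-swap B = record
    { gcd = gcd ; f/gcd = g/gcd ; g/gcd = f/gcd ; u = v ; v = u
    ; f≈ = g≈ ; g≈ = f≈
    ; identity = ≈-trans (+-comm (v * g/gcd) (u * f/gcd)) identity }
    where open Bézout B

  private
    Bézout-0ˡ : ∀ g → Bézoutᴾ [] g
    Bézout-0ˡ g = record
      { gcd = g ; f/gcd = [] ; g/gcd = const F.1# ; u = [] ; v = const F.1#
      ; f≈ = ≈-sym (*-zeroʳ g)
      ; g≈ = ≈-sym (≈-trans (*-comm g _) (*-identityˡ g))
      ; identity = *-identityˡ (const F.1#) }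

    Bézout-X* : ∀ {a b f g} → a F.≈ F.0# → b F.≈ F.0# → Bézoutᴾ f g → Bézoutᴾ (a ∷ f) (b ∷ g)
    Bézout-X* {a} {b} {f} {g} a≈0 b≈0 B = record
      { gcd = X * gcd ; f/gcd = f/gcd ; g/gcd = g/gcd ; u = u ; v = v
      ; f≈ = shift a≈0 f≈ ; g≈ = shift b≈0 g≈
      ; identity = identity }
      where
      open Bézout B
      shift : ∀ {a f k} → a F.≈ F.0# → f ≈ gcd * k → a ∷ f ≈ X * gcd * k
      shift {a} {f} {k} a≈0 f≈ = begin
        a ∷ f           ≈⟨ ∷-cong a≈0 ≈-refl ⟩
        F.0# ∷ f        ≈⟨ X-* f ⟨
        X * f           ≈⟨ *-congˡ X f≈ ⟩
        X * (gcd * k)   ≈⟨ *-assoc X gcd k ⟨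
        X * gcd * k     ∎

    -- b, hence the constant term β of g/gcd, is invertible, so that X is
    -- invertible modulo g/gcd and may be cancelled from f.
    Bézout-step : ∀ {f f′ g} q b′ → b′ F.* coeff g 0 F.≈ F.1# →
                  f ≈ q * g + X * f′ → Bézoutᴾ f′ g → Bézoutᴾ f g
    Bézout-step {f} {f′} {g} q b′ b′b≈1 f-split B = record
      { gcd = gcd ; f/gcd = q * g/gcd + X * f/gcd ; g/gcd = g/gcd
      ; u = u′ ; v = v′ - u′ * q
      ; f≈ = begin
          f                                      ≈⟨ f-split ⟩
          q * g + X * f′                         ≈⟨ +-cong (*-congˡ q g≈) (*-congˡ X f≈) ⟩
          q * (gcd * g/gcd) + X * (gcd * f/gcd)
            ≈⟨ solve 5 (λ q x d f g → q :* (d :* g) :+ x :* (d :* f) := d :* (q :* g :+ x :* f))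
                 ≈-refl q X gcd f/gcd g/gcd ⟩
          gcd * (q * g/gcd + X * f/gcd)          ∎
      ; g≈ = g≈
      ; identity = begin
          u′ * (q * g/gcd + X * f/gcd) + (v′ - u′ * q) * g/gcd
            ≈⟨ solve 8 (λ q x f g i t u v →
                   (:- (i :* t :* u)) :* (q :* g :+ x :* f)
                     :+ (i :- i :* x :* t :* v :- (:- (i :* t :* u)) :* q) :* g
                   := i :* g :- i :* x :* t :* (u :* f :+ v :* g))
                 ≈-refl q X f/gcd g/gcd (const i) t u v ⟩
          const i * g/gcd - const i * X * t * (u * f/gcd + v * g/gcd)
            ≈⟨ +-cong (*-congˡ (const i) g/gcd-split)
                 (-‿cong (*-congˡ (const i * X * t) identity)) ⟩
          const i * (const β + X * t) - const i * X * t * const F.1#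
            ≈⟨ solve 4 (λ i b x t → i :* (b :+ x :* t) :- i :* x :* t :* con (+ 1) := i :* b)
                 ≈-refl (const i) (const β) X t ⟩
          const i * const β      ≈⟨ const-*-const i β ⟩
          const (i F.* β)        ≈⟨ const-cong iβ≈1 ⟩
          const F.1#             ∎ }
      where
      open Bézout B
      β = coeff g/gcd 0
      -- The inverse of β: the constant term of g is `coeff gcd 0` times β, and b′ inverts it.
      i = b′ F.* coeff gcd 0
      iβ≈1 : i F.* β F.≈ F.1#
      iβ≈1 = F.trans (F.*-assoc b′ _ β)
        (F.trans (F.*-congˡ (F.sym (F.trans (coeff-≈ g≈ 0) (coeff-*-zero gcd g/gcd)))) b′b≈1)
      tail : Poly → Poly
      tail []      = []
      tail (_ ∷ k) = k
      split : ∀ k → k ≈ const (coeff k 0) + X * tail k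
      split []      = ≈-sym (≈-trans (+-cong (≈-refl {const F.0#}) (*-zeroʳ X)) (0∷-≈[] F.refl ≈-refl))
      split (a ∷ k) = ∷-split a k
      t  = tail g/gcd
      g/gcd-split : g/gcd ≈ const β + X * t
      g/gcd-split = split g/gcd
      -- Start from 1 = i (g/gcd - X t), multiply X t by the old identity, and replace X f/gcd by
      -- the new cofactor minus q g/gcd.
      u′ = - (const i * t * u)
      v′ = const i - const i * X * t * v

    length-·-+ : ∀ f a g → length g ℕ.≤ length f → length (f + a · g) ≡ length f
    length-·-+ []      a []      _         = ≡.refl
    length-·-+ (b ∷ f) a []      _         = ≡.refl
    length-·-+ (b ∷ f) a (d ∷ g) (s≤s g≤f) = ≡.cong suc (length-·-+ f a g g≤f)

    reduce : ∀ a f b g b′ → b′ F.* b F.≈ F.1# →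
             a ∷ f ≈ const (a F.* b′) * (b ∷ g) + X * (f + (F.- (a F.* b′)) · g)
    reduce a f b g b′ b′b≈1 = begin
      a ∷ f                      ≈⟨ ∷-split a f ⟩
      const a + X * f            ≈⟨ +-cong (const-cong a≈qb) (≈-refl {X * f}) ⟩
      const (q F.* b) + X * f    ≈⟨ +-cong (≈-sym (const-*-const q b)) (≈-refl {X * f}) ⟩
      const q * const b + X * f
        ≈⟨ solve 5 (λ q b x f g → q :* b :+ x :* f := q :* (b :+ x :* g) :+ x :* (f :+ (:- q) :* g))
             ≈-refl (const q) (const b) X f g ⟩
      const q * (const b + X * g) + X * (f + const (F.- q) * g)
        ≈⟨ +-cong (*-congˡ (const q) (≈-sym (∷-split b g)))
             (*-congˡ X (+-cong (≈-refl {f}) (const-* (F.- q) g))) ⟩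
      const q * (b ∷ g) + X * (f + (F.- q) · g) ∎
      where
      q = a F.* b′
      a≈qb : a F.≈ q F.* b
      a≈qb = F.sym (F.trans (F.*-assoc a b′ b) (F.trans (F.*-congˡ b′b≈1) (F.*-identityʳ a)))

    flip : ∀ (g f : Poly) → length g ℕ.+ suc (length f) ≡ length f ℕ.+ suc (length g)
    flip g f = ≡.trans (ℕ.+-suc _ _) (≡.trans (≡.cong suc (ℕ.+-comm (length g) _)) (≡.sym (ℕ.+-suc _ _)))

    -- Euclid's algorithm at the constant term instead of the leading term.
    bézout-fuel : ∀ n f g → length f ℕ.+ length g ℕ.≤ n → Bézoutᴾ f g
    bézout-fuel n       []      g       _ = Bézout-0ˡ g
    bézout-fuel n       (a ∷ f) []      _ = Bézout-swap (Bézout-0ˡ (a ∷ f))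
    bézout-fuel (suc n) (a ∷ f) (b ∷ g) (s≤s |f|+|g|≤n)
      with inverse a | inverse b
    ... | inj₁ a≈0 | inj₁ b≈0 = Bézout-X* a≈0 b≈0
      (bézout-fuel n f g (ℕ.≤-trans (ℕ.+-monoʳ-≤ (length f) (ℕ.n≤1+n _)) |f|+|g|≤n))
    ... | inj₁ a≈0 | inj₂ (b′ , b′b≈1) = Bézout-step [] b′ b′b≈1
      (≈-trans (∷-cong a≈0 ≈-refl) (≈-sym (X-* f))) (bézout-fuel n f (b ∷ g) |f|+|g|≤n)
    ... | inj₂ (a′ , a′a≈1) | inj₁ b≈0 = Bézout-swap (Bézout-step [] a′ a′a≈1
      (≈-trans (∷-cong b≈0 ≈-refl) (≈-sym (X-* g)))
      (bézout-fuel n g (a ∷ f) (ℕ.≤-trans (ℕ.≤-reflexive (flip g f)) |f|+|g|≤n)))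
    -- The shorter list is subtracted from the longer one, so that removing the cancelled constant
    -- term really shortens the input.
    ... | inj₂ (a′ , a′a≈1) | inj₂ (b′ , b′b≈1) with ℕ.≤-total (length g) (length f)
    ...   | inj₁ g≤f = Bézout-step (const (a F.* b′)) b′ b′b≈1 (reduce a f b g b′ b′b≈1)
      (bézout-fuel n (f + (F.- (a F.* b′)) · g) (b ∷ g)
        (ℕ.≤-trans (ℕ.≤-reflexive (≡.cong (ℕ._+ suc (length g)) (length-·-+ f _ g g≤f))) |f|+|g|≤n))
    ...   | inj₂ f≤g = Bézout-swap (Bézout-step (const (b F.* a′)) a′ a′a≈1 (reduce b g a f a′ a′a≈1)
      (bézout-fuel n (g + (F.- (b F.* a′)) · f) (a ∷ f)
        (ℕ.≤-trans (ℕ.≤-reflexive (≡.trans (≡.cong (ℕ._+ suc (length f)) (length-·-+ g _ f f≤g)) (flip g f))) |f|+|g|≤n)))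

  bézout : ∀ f g → Bézout commutativeRing f g
  bézout f g = bézout-fuel _ f g ℕ.≤-refl

-- Binomial sums divisible by p, and the half-angle sequences

[k+1]*nC[k+1]+k*nCk≡n*nCk : ∀ n k → suc k ℕ.* (n C suc k) ℕ.+ k ℕ.* (n C k) ≡ n ℕ.* (n C k)
[k+1]*nC[k+1]+k*nCk≡n*nCk n zero = begin
  1 ℕ.* (n C 1) ℕ.+ 0  ≡⟨ ≡.trans (ℕ.+-identityʳ _) (ℕ.*-identityˡ _) ⟩
  n C 1                ≡⟨ nC1≡n n ⟩
  n                    ≡⟨ ℕ.*-identityʳ n ⟨
  n ℕ.* (n C 0)        ∎
  where open ≡.≡-Reasoning
[k+1]*nC[k+1]+k*nCk≡n*nCk zero (suc k) = begin
  suc (suc k) ℕ.* (0 C suc (suc k)) ℕ.+ suc k ℕ.* (0 C suc k)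
    ≡⟨ ≡.cong₂ (λ x y → suc (suc k) ℕ.* x ℕ.+ suc k ℕ.* y)
         (k>n⇒nCk≡0 {0} {suc (suc k)} (s≤s z≤n)) (k>n⇒nCk≡0 {0} {suc k} (s≤s z≤n)) ⟩
  suc (suc k) ℕ.* 0 ℕ.+ suc k ℕ.* 0
    ≡⟨ ≡.cong₂ ℕ._+_ (ℕ.*-zeroʳ (suc (suc k))) (ℕ.*-zeroʳ (suc k)) ⟩
  0 ∎
  where open ≡.≡-Reasoning
[k+1]*nC[k+1]+k*nCk≡n*nCk (suc n) (suc k)
  rewrite ≡.sym (nCk+nC[k+1]≡[n+1]C[k+1] n k) | ≡.sym (nCk+nC[k+1]≡[n+1]C[k+1] n (suc k)) =
  begin
  suc (suc k) ℕ.* (b ℕ.+ d) ℕ.+ suc k ℕ.* (a ℕ.+ b)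
    ≡⟨ rearrange k a b d ⟩
  (suc (suc k) ℕ.* d ℕ.+ suc k ℕ.* b) ℕ.+ (suc k ℕ.* b ℕ.+ k ℕ.* a) ℕ.+ (a ℕ.+ b)
    ≡⟨ ≡.cong₂ (λ x y → x ℕ.+ y ℕ.+ (a ℕ.+ b))
         ([k+1]*nC[k+1]+k*nCk≡n*nCk n (suc k)) ([k+1]*nC[k+1]+k*nCk≡n*nCk n k) ⟩
  n ℕ.* b ℕ.+ n ℕ.* a ℕ.+ (a ℕ.+ b)
    ≡⟨ collect n a b ⟩
  suc n ℕ.* (a ℕ.+ b) ∎
  where
  open ≡.≡-Reasoning
  a = n C k
  b = n C suc k
  d = n C suc (suc k)
  rearrange : ∀ k a b d → suc (suc k) ℕ.* (b ℕ.+ d) ℕ.+ suc k ℕ.* (a ℕ.+ b) ≡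
    (suc (suc k) ℕ.* d ℕ.+ suc k ℕ.* b) ℕ.+ (suc k ℕ.* b ℕ.+ k ℕ.* a) ℕ.+ (a ℕ.+ b)
  rearrange = ℕ-Tactic.solve-∀
  collect : ∀ n a b → n ℕ.* b ℕ.+ n ℕ.* a ℕ.+ (a ℕ.+ b) ≡ suc n ℕ.* (a ℕ.+ b)
  collect = ℕ-Tactic.solve-∀

-- The coefficient of w^j in `g m`, equal to the quotient (2m+1) C(m+j, 2j) / (2j+1). The form as a
-- sum shows at once that it is an integer.
lucasCoeff : ℕ → ℕ → ℕ
lucasCoeff m j = (m ℕ.+ j) C (2 ℕ.* j) ℕ.+ 2 ℕ.* ((m ℕ.+ j) C suc (2 ℕ.* j))

-- With (k+1) C(n, k+1) = (n-k) C(n, k) for n = m + j and k = 2 j, the left side is (2j+1) + 2 (m-j)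
-- = 2m+1 times C(m+j, 2j). A common term is added to both sides to avoid subtraction.
[2j+1]*lucasCoeff : ∀ m j →
  suc (2 ℕ.* j) ℕ.* lucasCoeff m j ≡ suc (2 ℕ.* m) ℕ.* ((m ℕ.+ j) C (2 ℕ.* j))
[2j+1]*lucasCoeff m j = ℕ.+-cancelʳ-≡ (2 ℕ.* (2 ℕ.* j) ℕ.* a) _ _ (begin
  suc (2 ℕ.* j) ℕ.* (a ℕ.+ 2 ℕ.* b) ℕ.+ 2 ℕ.* (2 ℕ.* j) ℕ.* a
    ≡⟨ expand (2 ℕ.* j) a b ⟩
  suc (2 ℕ.* j) ℕ.* a ℕ.+ 2 ℕ.* (suc (2 ℕ.* j) ℕ.* b ℕ.+ 2 ℕ.* j ℕ.* a)
    ≡⟨ ≡.cong (λ x → suc (2 ℕ.* j) ℕ.* a ℕ.+ 2 ℕ.* x)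
         ([k+1]*nC[k+1]+k*nCk≡n*nCk (m ℕ.+ j) (2 ℕ.* j)) ⟩
  suc (2 ℕ.* j) ℕ.* a ℕ.+ 2 ℕ.* ((m ℕ.+ j) ℕ.* a)
    ≡⟨ collect m j a ⟩
  suc (2 ℕ.* m) ℕ.* a ℕ.+ 2 ℕ.* (2 ℕ.* j) ℕ.* a ∎)
  where
  open ≡.≡-Reasoning
  a = (m ℕ.+ j) C (2 ℕ.* j)
  b = (m ℕ.+ j) C suc (2 ℕ.* j)
  expand : ∀ t a b → suc t ℕ.* (a ℕ.+ 2 ℕ.* b) ℕ.+ 2 ℕ.* t ℕ.* a
         ≡ suc t ℕ.* a ℕ.+ 2 ℕ.* (suc t ℕ.* b ℕ.+ t ℕ.* a)
  expand = ℕ-Tactic.solve-∀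
  collect : ∀ m j a → suc (2 ℕ.* j) ℕ.* a ℕ.+ 2 ℕ.* ((m ℕ.+ j) ℕ.* a)
          ≡ suc (2 ℕ.* m) ℕ.* a ℕ.+ 2 ℕ.* (2 ℕ.* j) ℕ.* a
  collect = ℕ-Tactic.solve-∀

-- In the preceding identity p divides the right side, while 2j+1 is positive and smaller than p.
prime∣lucasCoeff : ∀ {m} → Prime (suc (2 ℕ.* m)) → ∀ j → j ℕ.< m →
                   suc (2 ℕ.* m) ℕ.∣ lucasCoeff m j
prime∣lucasCoeff {m} p-prime j j<m =
  [ (λ p∣2j+1 → contradiction p∣2j+1 (ℕ.>⇒∤ (s≤s (ℕ.*-monoʳ-< 2 j<m))))
  , id
  ]′ (euclidsLemma (suc (2 ℕ.* j)) (lucasCoeff m j) p-prime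
       (≡.subst (suc (2 ℕ.* m) ℕ.∣_) (≡.sym ([2j+1]*lucasCoeff m j)) (ℕ.m∣m*n _)))

lucasCoeff-0 : ∀ m → lucasCoeff m 0 ≡ suc (2 ℕ.* m)
lucasCoeff-0 m = ≡.cong (λ x → suc (2 ℕ.* x)) (≡.trans (nC1≡n (m ℕ.+ 0)) (ℕ.+-identityʳ m))

m+m≡2*m : ∀ m → m ℕ.+ m ≡ 2 ℕ.* m
m+m≡2*m = ℕ-Tactic.solve-∀

lucasCoeff-m : ∀ m → lucasCoeff m m ≡ 1
lucasCoeff-m m rewrite m+m≡2*m m = ≡.cong₂ (λ x y → x ℕ.+ 2 ℕ.* y)
  (nCn≡1 (2 ℕ.* m)) (k>n⇒nCk≡0 (ℕ.n<1+n (2 ℕ.* m)))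

lucasCoeff-above : ∀ m j → m ℕ.< j → lucasCoeff m j ≡ 0
lucasCoeff-above m j m<j = ≡.cong₂ (λ x y → x ℕ.+ 2 ℕ.* y)
  (k>n⇒nCk≡0 m+j<2j) (k>n⇒nCk≡0 (ℕ.m<n⇒m<1+n m+j<2j))
  where
  m+j<2j : m ℕ.+ j ℕ.< 2 ℕ.* j
  m+j<2j = ≡.subst (m ℕ.+ j ℕ.<_) (m+m≡2*m j) (ℕ.+-monoˡ-< j m<j)

-- With w = 4 sinh² t, these are e m = sinh 2mt / sinh 2t,
-- h m = cosh (2m+1)t / cosh t and g m = sinh (2m+1)t / sinh t.
module HalfAngle {c ℓ} (A : CommutativeRing c ℓ) (w : CommutativeRing.Carrier A) where

  open CommutativeRing A
  open IntegerSolver A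
  open SetoidReasoning setoid

  e h : ℕ → Carrier
  e zero    = 0#
  e (suc m) = e m + h m
  h zero    = 1#
  h (suc m) = h m + w * e (suc m)

  g : ℕ → Carrier
  g m = h m + (e m + e m)

  -- The addition theorems of sinh and cosh; the term in w corrects the odd multiples of t in `h`.
  -- They serve to halve the index of `g`.
  e-+ : ∀ m n → e (m ℕ.+ n) ≈ e m * h n + h m * e n - w * (e m * e n)
  h-+ : ∀ m n → h (m ℕ.+ n) ≈ h m * h n + w * (e m * e n)
  e-+ zero    n = solve 3 (λ x y w → x := con (+ 0) :* y :+ con (+ 1) :* x :- w :* (con (+ 0) :* x)) refl (e n) (h n) w
  e-+ (suc m) n = trans (+-cong (e-+ m n) (h-+ m n))
    (solve 5 (λ a b x y w →
        (a :* y :+ b :* x :- w :* (a :* x)) :+ (b :* y :+ w :* (a :* x))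
        := (a :+ b) :* y :+ (b :+ w :* (a :+ b)) :* x :- w :* ((a :+ b) :* x))
      refl (e m) (h m) (e n) (h n) w)
  h-+ zero    n = solve 3 (λ x y w → y := con (+ 1) :* y :+ w :* (con (+ 0) :* x)) refl (e n) (h n) w
  h-+ (suc m) n = trans (+-cong (h-+ m n) (*-congˡ (e-+ (suc m) n)))
    (solve 5 (λ a b x y w →
        (b :* y :+ w :* (a :* x))
          :+ w :* ((a :+ b) :* y :+ (b :+ w :* (a :+ b)) :* x :- w :* ((a :+ b) :* x))
        := (b :+ w :* (a :+ b)) :* y :+ w :* ((a :+ b) :* x))
      refl (e m) (h m) (e n) (h n) w)

  four : Carrier
  four = (1# + 1#) + (1# + 1#)

  -- This is sinh (A+B) sinh (A-B) = sinh² A - sinh² B for A = (2m+1)t and B = 2mt, divided by sinh²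
  -- t. As w + 4 = 4 cosh² t, the square of sinh 2mt / sinh t is (w + 4) (e m)².
  g-even : ∀ m → g (m ℕ.+ m) ≈ g m * g m - (w + four) * (e m * e m)
  g-even m = trans (+-cong (h-+ m m) (+-cong (e-+ m m) (e-+ m m)))
    (solve 3 (λ e h w →
        let e₂ = e :* h :+ h :* e :- w :* (e :* e)
            g  = h :+ (e :+ e)
            four = (con (+ 1) :+ con (+ 1)) :+ (con (+ 1) :+ con (+ 1)) in
        (h :* h :+ w :* (e :* e)) :+ (e₂ :+ e₂) := g :* g :- (w :+ four) :* (e :* e))
      refl (e m) (h m) w)

  -- The same identity for A = (2m+2)t and B = (2m+1)t. Now `e` belongs to the larger angle, which
  -- accounts for the sign.
  g-odd : ∀ m → g (m ℕ.+ suc m) ≈ - (g m * g m - (w + four) * (e (suc m) * e (suc m)))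
  g-odd m = trans (+-cong (h-+ m (suc m)) (+-cong (e-+ m (suc m)) (e-+ m (suc m))))
    (solve 3 (λ e h w →
        let e′ = e :+ h
            h′ = h :+ w :* e′
            e₂ = e :* h′ :+ h :* e′ :- w :* (e :* e′)
            g  = h :+ (e :+ e)
            four = (con (+ 1) :+ con (+ 1)) :+ (con (+ 1) :+ con (+ 1)) in
        (h :* h′ :+ w :* (e :* e′)) :+ (e₂ :+ e₂) := :- (g :* g :- (w :+ four) :* (e′ :* e′)))
      refl (e m) (h m) w)

module _ {a b c d} {A : CommutativeRing a b} {B : CommutativeRing c d} (φ : RingHom A B)
         {w : CommutativeRing.Carrier A} {w′ : CommutativeRing.Carrier B}
         (φw≈w′ : CommutativeRing._≈_ B (RingHom.⟦_⟧ φ w) w′) where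

  private
    module HA = HalfAngle A w
    module HB = HalfAngle B w′
  open CommutativeRing B
  open RingHom φ

  e-homo : ∀ m → ⟦ HA.e m ⟧ ≈ HB.e m
  h-homo : ∀ m → ⟦ HA.h m ⟧ ≈ HB.h m
  e-homo zero    = 0-homo
  e-homo (suc m) = trans (+-homo _ _) (+-cong (e-homo m) (h-homo m))
  h-homo zero    = 1-homo
  h-homo (suc m) = trans (+-homo _ _)
    (+-cong (h-homo m) (trans (*-homo _ _) (*-cong φw≈w′ (e-homo (suc m)))))

  -- Coefficients and congruences of `g` are established in ℤ[w], whereas factorisations take place
  -- in ℚ[w]; this connects the two.
  g-homo : ∀ m → ⟦ HA.g m ⟧ ≈ HB.g m
  g-homo m = trans (+-homo _ _)
    (+-cong (h-homo m) (trans (+-homo _ _) (+-cong (e-homo m) (e-homo m))))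

-- Integer coefficients of the half-angle sequences

module ℤ[w] where
  open PolynomialRing ℤ.+-*-commutativeRing public
  open HalfAngle commutativeRing X public
  open CommutativeRing commutativeRing public using (reflexive)
  open IntegerSolver commutativeRing public

module IntegerPolynomials where

  open ℤ[w] hiding (four)

  -- Both recursions are Pascal's rule: adding `h m` to `e m` moves to the next row, and the factor
  -- w in the step of `h` shifts j by one, hence the lower index by two.
  coeff-e : ∀ m j → coeff (e m) j ≡ + ((m ℕ.+ j) C suc (2 ℕ.* j))
  coeff-h : ∀ m j → coeff (h m) j ≡ + ((m ℕ.+ j) C (2 ℕ.* j))
  coeff-e zero    j = ≡.cong +_ (≡.sym (k>n⇒nCk≡0 (s≤s (ℕ.m≤n*m j 2))))
  coeff-e (suc m) j = begin
    coeff (e m + h m) j            ≡⟨ coeff-+ (e m) (h m) j ⟩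
    coeff (e m) j ℤ.+ coeff (h m) j
      ≡⟨ ≡.cong₂ ℤ._+_ (coeff-e m j) (coeff-h m j) ⟩
    + ((m ℕ.+ j) C suc (2 ℕ.* j) ℕ.+ (m ℕ.+ j) C (2 ℕ.* j))
      ≡⟨ ≡.cong +_ (≡.trans (ℕ.+-comm ((m ℕ.+ j) C suc (2 ℕ.* j)) _)
           (nCk+nC[k+1]≡[n+1]C[k+1] (m ℕ.+ j) (2 ℕ.* j))) ⟩
    + (suc (m ℕ.+ j) C suc (2 ℕ.* j)) ∎
    where open ≡.≡-Reasoning
  coeff-h zero    zero    = ≡.refl
  coeff-h zero    (suc j) = ≡.cong +_ (≡.sym (k>n⇒nCk≡0 (≡.subst (suc j ℕ.<_) (m+m≡2*m (suc j)) (ℕ.m<m+n (suc j) (s≤s z≤n)))))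
  coeff-h (suc m) zero    = begin
    coeff (h m + X * e (suc m)) 0             ≡⟨ coeff-+ (h m) (X * e (suc m)) 0 ⟩
    coeff (h m) 0 ℤ.+ coeff (X * e (suc m)) 0
      ≡⟨ ≡.cong₂ ℤ._+_ (coeff-h m 0) (coeff-≈ (X-* (e (suc m))) 0) ⟩
    + 1 ∎
    where open ≡.≡-Reasoning
  coeff-h (suc m) (suc j) = begin
    coeff (h m + X * e (suc m)) (suc j)       ≡⟨ coeff-+ (h m) (X * e (suc m)) (suc j) ⟩
    coeff (h m) (suc j) ℤ.+ coeff (X * e (suc m)) (suc j)
      ≡⟨ ≡.cong₂ ℤ._+_ (coeff-h m (suc j))
           (≡.trans (coeff-≈ (X-* (e (suc m))) (suc j)) (coeff-e (suc m) j)) ⟩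
    + ((m ℕ.+ suc j) C (2 ℕ.* suc j) ℕ.+ suc (m ℕ.+ j) C suc (2 ℕ.* j))
      ≡⟨ ≡.cong +_ pascal ⟩
    + (suc (m ℕ.+ suc j) C (2 ℕ.* suc j)) ∎
    where
    open ≡.≡-Reasoning
    pascal : (m ℕ.+ suc j) C (2 ℕ.* suc j) ℕ.+ suc (m ℕ.+ j) C suc (2 ℕ.* j)
           ≡ suc (m ℕ.+ suc j) C (2 ℕ.* suc j)
    pascal = begin
      (m ℕ.+ suc j) C (2 ℕ.* suc j) ℕ.+ suc (m ℕ.+ j) C suc (2 ℕ.* j)
        ≡⟨ ≡.cong (ℕ._+ (suc (m ℕ.+ j) C suc (2 ℕ.* j))) (≡.cong₂ _C_ (ℕ.+-suc m j) (ℕ.*-suc 2 j)) ⟩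
      suc (m ℕ.+ j) C suc (suc (2 ℕ.* j)) ℕ.+ suc (m ℕ.+ j) C suc (2 ℕ.* j)
        ≡⟨ ℕ.+-comm (suc (m ℕ.+ j) C suc (suc (2 ℕ.* j))) _ ⟩
      suc (m ℕ.+ j) C suc (2 ℕ.* j) ℕ.+ suc (m ℕ.+ j) C suc (suc (2 ℕ.* j))
        ≡⟨ nCk+nC[k+1]≡[n+1]C[k+1] (suc (m ℕ.+ j)) (suc (2 ℕ.* j)) ⟩
      suc (suc (m ℕ.+ j)) C suc (suc (2 ℕ.* j))
        ≡⟨ ≡.cong₂ _C_ (≡.cong suc (≡.sym (ℕ.+-suc m j))) (≡.sym (ℕ.*-suc 2 j)) ⟩
      suc (m ℕ.+ suc j) C (2 ℕ.* suc j) ∎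

  coeff-g : ∀ m j → coeff (g m) j ≡ + lucasCoeff m j
  coeff-g m j = begin
    coeff (h m + (e m + e m)) j ≡⟨ coeff-+ (h m) (e m + e m) j ⟩
    coeff (h m) j ℤ.+ coeff (e m + e m) j
      ≡⟨ ≡.cong₂ ℤ._+_ (coeff-h m j) (≡.trans (coeff-+ (e m) (e m) j)
           (≡.cong₂ ℤ._+_ (coeff-e m j) (coeff-e m j))) ⟩
    + (a ℕ.+ (b ℕ.+ b))  ≡⟨ ≡.cong (λ x → + (a ℕ.+ x)) (m+m≡2*m b) ⟩
    + lucasCoeff m j     ∎
    where
    open ≡.≡-Reasoning
    a = (m ℕ.+ j) C (2 ℕ.* j)
    b = (m ℕ.+ j) C suc (2 ℕ.* j)

  module _ {p} (p-prime : Prime p) where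

    primeIdeal : PrimeIdeal ℤ.+-*-commutativeRing 0ℓ
    primeIdeal = record
      { Mem   = + p ℤ.∣_
      ; Mem?  = + p ℤ.∣?_
      ; resp  = λ { ≡.refl p∣a → p∣a }
      ; 0∈    = divides ℤ.0ℤ ≡.refl
      ; +-∈   = ℤ.∣m∣n⇒∣m+n
      ; *-∈   = λ a → ℤ.∣n⇒∣m*n a
      ; prime = λ a b p∣ab → Sum.map ∣ᵤ⇒∣ ∣ᵤ⇒∣
          (euclidsLemma ∣ a ∣ ∣ b ∣ p-prime (≡.subst (p ℕ.∣_) (ℤ.abs-* a b) (∣⇒∣ᵤ {i = a ℤ.* b} p∣ab)))
      }

    prime≢0 : + p ≢ + 0
    prime≢0 p≡0 = ℕ.≢-nonZero⁻¹ p {{prime⇒nonZero p-prime}} (ℤ.+-injective p≡0)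

  zeroIdeal : PrimeIdeal ℤ.+-*-commutativeRing 0ℓ
  zeroIdeal = record
    { Mem   = _≡ + 0
    ; Mem?  = ℤ._≟ + 0
    ; resp  = λ { ≡.refl a≡0 → a≡0 }
    ; 0∈    = ≡.refl
    ; +-∈   = λ { ≡.refl ≡.refl → ≡.refl }
    ; *-∈   = λ { a ≡.refl → ℤ.*-zeroʳ a }
    ; prime = λ a b → ℤ.i*j≡0⇒i≡0∨j≡0 a
    }

  *-≢0 : ∀ i j → i ≢ + 0 → j ≢ + 0 → i ℤ.* j ≢ + 0
  *-≢0 i j i≢0 j≢0 ij≡0 = [ i≢0 , j≢0 ]′ (ℤ.i*j≡0⇒i≡0∨j≡0 i ij≡0)

  open PolynomialsOverDomain zeroIdeal (λ a≡0 → a≡0) public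

  const-cancel : ∀ {n} f g → n ≢ + 0 → const n * f ≈ const n * g → f ≈ g
  const-cancel {n} f g n≢0 nf≈ng = coeffwise λ i → ℤ.*-cancelˡ-≡ n _ _ {{ℤ.≢-nonZero n≢0}}
    (≡.trans (≡.sym (coeff-const-* n f i)) (≡.trans (coeff-≈ nf≈ng i) (coeff-const-* n g i)))

  quotient : ∀ {n} f → (∀ i → n ℤ.∣ coeff f i) → ∃ λ f′ → f ≈ const n * f′
  quotient {n} []  _   = [] , ≈-sym (*-zeroʳ (const n))
  quotient {n} (a ∷ f) n∣f with n∣f 0 | quotient f (λ i → n∣f (suc i))
  ... | divides q a≡qn | f′ , f≈nf′ = q ∷ f′ , ≈-trans
    (∷-cong (≡.trans a≡qn (ℤ.*-comm q n)) (≈-trans f≈nf′ (const-* n f′)))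
    (≈-sym (const-* n (q ∷ f′)))

  ∣∣-< : ∀ {p} N′ → p ℕ.> 1 → N′ ℤ.* + p ≢ + 0 → ∣ N′ ∣ ℕ.< ∣ N′ ℤ.* + p ∣
  ∣∣-< {p} N′ p>1 N≢0 = ≡.subst (∣ N′ ∣ ℕ.<_) (≡.sym (ℤ.abs-* N′ (+ p)))
    (ℕ.m<m*n ∣ N′ ∣ p {{ℕ.≢-nonZero λ ∣N′∣≡0 → N≢0 (≡.cong (ℤ._* + p) (ℤ.∣i∣≡0⇒i≡0 {N′} ∣N′∣≡0))}} p>1)

  -- Eisenstein's criterion for integer multiples

  record Eisenstein (p : ℕ) (f : Poly) (d : ℕ) : Set where
    field
      degree   : HasDegree f d
      ∤leading : ¬ (+ p ℤ.∣ coeff f d)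
      ∣lower   : ∀ j → j ℕ.< d → + p ℤ.∣ coeff f j
      r        : ℤ
      constant : coeff f 0 ≡ + p ℤ.* r
      ∤r       : ¬ (+ p ℤ.∣ r)

  module EisensteinCriterion {p f d} (p-prime : Prime p) (E : Eisenstein p f d) where

    open Eisenstein E
    open PrimeIdeal (primeIdeal p-prime) using (prime)
    open PolynomialsModPrime (primeIdeal p-prime)

    private
      p>1 : p ℕ.> 1
      p>1 = ℕ.nonTrivial⇒n>1 p {{prime⇒nonTrivial p-prime}}

      const-degree : ∀ {n} → n ≢ + 0 → HasDegree (const n) 0
      const-degree n≢0 = record { leading = n≢0 ; above = λ { (suc i) _ → ≡.refl } }

      -- A constant term prime to p on the left pushes all of f's lower
      -- coefficients, and hence its whole degree, into the right factor.
      one-sided : ∀ N A B → ¬ (+ p ℤ.∣ N) → const N * f ≈ A * B → ¬ (+ p ℤ.∣ coeff A 0) →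
                  ∀ {a b} → HasDegree A a → HasDegree B b → a ℕ.+ b ≡ d → a ≡ 0
      one-sided N A B p∤N Nf≈AB p∤A₀ {a} {b} A-a B-b a+b≡d =
        ℕ.+-cancelʳ-≡ b a 0 (≡.trans a+b≡d (ℕ.≤-antisym d≤b b≤d))
        where
        b≤d : b ℕ.≤ d
        b≤d = ≡.subst (b ℕ.≤_) a+b≡d (ℕ.m≤n+m b a)
        p∣AB : ∀ j → j ℕ.< d → + p ℤ.∣ coeff (A * B) j
        p∣AB j j<d = ≡.subst (+ p ℤ.∣_) (≡.trans (≡.sym (coeff-const-* N f j)) (coeff-≈ Nf≈AB j))
          (ℤ.∣n⇒∣m*n N (∣lower j j<d))
        p∣B : b ℕ.< d → In B
        p∣B b<d j with ℕ.<-≤-connex j d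
        ... | inj₁ j<d = In-low A B d p∤A₀ p∣AB j j<d
        ... | inj₂ d≤j = ≡.subst (+ p ℤ.∣_) (≡.sym (HasDegree.above B-b j (ℕ.<-≤-trans b<d d≤j)))
          (divides ℤ.0ℤ ≡.refl)
        d≤b : d ℕ.≤ b
        d≤b = ℕ.≮⇒≥ λ b<d → [ p∤N , ∤leading ]′ (prime N _
          (≡.subst (+ p ℤ.∣_) (≡.trans (≡.sym (coeff-≈ Nf≈AB d)) (coeff-const-* N f d))
            (In-* A (p∣B b<d) d)))

      p∤-case : ∀ N A B → ¬ (+ p ℤ.∣ N) → const N * f ≈ A * B →
                  ∀ {a b} → HasDegree A a → HasDegree B b → a ℕ.+ b ≡ d → a ≡ 0 ⊎ b ≡ 0
      p∤-case N A B p∤N Nf≈AB {a} {b} A-a B-b a+b≡d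
        with + p ℤ.∣? coeff A 0 | + p ℤ.∣? coeff B 0
      ... | no p∤A₀ | _       = inj₁ (one-sided N A B p∤N Nf≈AB p∤A₀ A-a B-b a+b≡d)
      ... | yes _   | no p∤B₀ = inj₂ (one-sided N B A p∤N (≈-trans Nf≈AB (*-comm A B)) p∤B₀ B-b A-a
                                  (≡.trans (ℕ.+-comm b a) a+b≡d))
      -- Both constant terms are divisible, so p² divides N p r, and p divides N r.
      ... | yes (divides s A₀≡sp) | yes (divides t B₀≡tp) =
        contradiction (prime N r (divides (s ℤ.* t) Nr≡stp)) [ p∤N , ∤r ]′
        where
        Nr≡stp : N ℤ.* r ≡ s ℤ.* t ℤ.* + p
        Nr≡stp = ℤ.*-cancelˡ-≡ (+ p) _ _ {{ℤ.≢-nonZero (prime≢0 p-prime)}} (begin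
          + p ℤ.* (N ℤ.* r)            ≡⟨ swap (+ p) N r ⟩
          N ℤ.* (+ p ℤ.* r)            ≡⟨ ≡.cong (N ℤ.*_) constant ⟨
          N ℤ.* coeff f 0              ≡⟨ coeff-const-* N f 0 ⟨
          coeff (const N * f) 0        ≡⟨ coeff-≈ Nf≈AB 0 ⟩
          coeff (A * B) 0              ≡⟨ coeff-*-zero A B ⟩
          coeff A 0 ℤ.* coeff B 0      ≡⟨ ≡.cong₂ ℤ._*_ A₀≡sp B₀≡tp ⟩
          (s ℤ.* + p) ℤ.* (t ℤ.* + p)  ≡⟨ gather s t (+ p) ⟩
          + p ℤ.* (s ℤ.* t ℤ.* + p)    ∎)
          where
          open ≡.≡-Reasoning
          swap : ∀ p N r → p ℤ.* (N ℤ.* r) ≡ N ℤ.* (p ℤ.* r)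
          swap = ℤ-Tactic.solve-∀
          gather : ∀ s t p → (s ℤ.* p) ℤ.* (t ℤ.* p) ≡ p ℤ.* (s ℤ.* t ℤ.* p)
          gather = ℤ-Tactic.solve-∀

      divideˡ : ∀ N A B → const (N ℤ.* + p) * f ≈ A * B → In A → ∀ {a} → HasDegree A a →
                ∃ λ A′ → const N * f ≈ A′ * B × HasDegree A′ a
      divideˡ N A B Npf≈AB A∈ {a} A-a = A′ , Nf≈A′B , A′-a
        where
        A′ = proj₁ (quotient A A∈)
        A≈pA′ = proj₂ (quotient A A∈)
        Nf≈A′B : const N * f ≈ A′ * B
        Nf≈A′B = const-cancel (const N * f) (A′ * B) (prime≢0 p-prime) (begin
          const (+ p) * (const N * f)  ≈⟨ *-assoc (const (+ p)) (const N) f ⟨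
          const (+ p) * const N * f
            ≈⟨ *-cong (≈-trans (const-*-const (+ p) N) (const-cong (ℤ.*-comm (+ p) N))) (≈-refl {f}) ⟩
          const (N ℤ.* + p) * f        ≈⟨ Npf≈AB ⟩
          A * B                        ≈⟨ *-cong A≈pA′ (≈-refl {B}) ⟩
          const (+ p) * A′ * B         ≈⟨ *-assoc (const (+ p)) A′ B ⟩
          const (+ p) * (A′ * B)       ∎)
          where open SetoidReasoning ≈-setoid
        A′-a : HasDegree A′ a
        A′-a with degree? A′
        ... | inj₁ A′≈0 = contradiction
          (coeff-≈ (≈-trans A≈pA′ (≈-trans (*-congˡ (const (+ p)) A′≈0) (*-zeroʳ (const (+ p))))) a)
          (HasDegree.leading A-a)
        ... | inj₂ (a′ , A′-a′) = ≡.subst (HasDegree A′)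
          (degree-unique (degree-resp (≈-sym A≈pA′)
            (degree-* (const (+ p)) A′ (const-degree (prime≢0 p-prime)) A′-a′)) A-a)
          A′-a′

      -- Gauss's lemma at the single prime p. If p divides N, it divides all of A or all of B and is
      -- cancelled, which lowers the absolute value of N. Other primes may stay in N, since the
      -- criterion looks only at p.
      descent : ∀ n N A B → ∣ N ∣ ℕ.≤ n → N ≢ + 0 → const N * f ≈ A * B →
                ∀ {a b} → HasDegree A a → HasDegree B b → a ℕ.+ b ≡ d → a ≡ 0 ⊎ b ≡ 0
      descent n N A B ∣N∣≤n N≢0 Nf≈AB A-a B-b a+b≡d with + p ℤ.∣? N
      ... | no p∤N = p∤-case N A B p∤N Nf≈AB A-a B-b a+b≡d
      descent zero N A B ∣N∣≤n N≢0 Nf≈AB A-a B-b a+b≡d | yes _ =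
        contradiction (ℤ.∣i∣≡0⇒i≡0 (ℕ.n≤0⇒n≡0 ∣N∣≤n)) N≢0
      descent (suc n) N A B ∣N∣≤n N≢0 Nf≈AB {a} {b} A-a B-b a+b≡d | yes (divides N′ ≡.refl) =
        [ (λ A∈ → let A′ , N′f≈A′B , A′-a = divideˡ N′ A B Nf≈AB A∈ A-a in
            descent n N′ A′ B N′≤n N′≢0 N′f≈A′B A′-a B-b a+b≡d)
        , (λ B∈ → let B′ , N′f≈B′A , B′-b = divideˡ N′ B A (≈-trans Nf≈AB (*-comm A B)) B∈ B-b in
            Sum.swap (descent n N′ B′ A N′≤n N′≢0 N′f≈B′A B′-b A-a (≡.trans (ℕ.+-comm b a) a+b≡d)))
        ]′ (In-prime A B (In-resp Nf≈AB λ i →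
             ≡.subst (+ p ℤ.∣_) (≡.sym (coeff-const-* N f i)) (ℤ.∣m⇒∣m*n (coeff f i) (divides N′ ≡.refl))))
        where
        N′≤n : ∣ N′ ∣ ℕ.≤ n
        N′≤n = ℕ.≤-pred (ℕ.≤-trans (∣∣-< N′ p>1 N≢0) ∣N∣≤n)
        N′≢0 : N′ ≢ + 0
        N′≢0 ≡.refl = N≢0 ≡.refl

      f-multiple-degree : ∀ N → N ≢ + 0 → HasDegree (const N * f) d
      f-multiple-degree N N≢0 = degree-* (const N) f (const-degree N≢0) degree

    degree-0 : ∀ N A B → N ≢ + 0 → const N * f ≈ A * B → HasDegree A 0 ⊎ HasDegree B 0
    degree-0 N A B N≢0 Nf≈AB with degree? A | degree? B
    ... | inj₁ A≈0 | _ = contradiction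
      (coeff-≈ (≈-trans Nf≈AB (*-cong A≈0 (≈-refl {B}))) d) (HasDegree.leading (f-multiple-degree N N≢0))
    ... | inj₂ _ | inj₁ B≈0 = contradiction
      (coeff-≈ (≈-trans Nf≈AB (≈-trans (*-congˡ A B≈0) (*-zeroʳ A))) d)
      (HasDegree.leading (f-multiple-degree N N≢0))
    ... | inj₂ (a , A-a) | inj₂ (b , B-b) = Sum.map
      (λ a≡0 → ≡.subst (HasDegree A) a≡0 A-a) (λ b≡0 → ≡.subst (HasDegree B) b≡0 B-b)
      (descent ∣ N ∣ N A B ℕ.≤-refl N≢0 Nf≈AB A-a B-b
        (degree-unique (degree-* A B A-a B-b) (degree-resp Nf≈AB (f-multiple-degree N N≢0))))

  g-Eisenstein : ∀ m → Prime (suc (2 ℕ.* m)) → Eisenstein (suc (2 ℕ.* m)) (g m) m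
  g-Eisenstein m p-prime = record
    { degree   = record
      { leading = λ gₘ≡0 → contradiction (≡.trans (≡.sym gₘ≡1) gₘ≡0) λ ()
      ; above   = λ j m<j → ≡.trans (coeff-g m j) (≡.cong +_ (lucasCoeff-above m j m<j))
      }
    ; ∤leading = λ p∣gₘ → p∤1 (≡.subst (+ suc (2 ℕ.* m) ℤ.∣_) gₘ≡1 p∣gₘ)
    ; ∣lower   = λ j j<m → ≡.subst (+ suc (2 ℕ.* m) ℤ.∣_) (≡.sym (coeff-g m j))
        (∣ᵤ⇒∣ (prime∣lucasCoeff p-prime j j<m))
    ; r        = + 1
    ; constant = ≡.trans (coeff-g m 0) (≡.trans (≡.cong +_ (lucasCoeff-0 m)) (≡.sym (ℤ.*-identityʳ _)))
    ; ∤r       = p∤1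
    }
    where
    gₘ≡1 : coeff (g m) m ≡ + 1
    gₘ≡1 = ≡.trans (coeff-g m m) (≡.cong +_ (lucasCoeff-m m))
    p∤1 : ¬ (+ suc (2 ℕ.* m) ℤ.∣ + 1)
    p∤1 p∣1 = contradiction (ℕ.∣1⇒≡1 (∣⇒∣ᵤ p∣1)) (ℕ.nonTrivial⇒≢1 {{prime⇒nonTrivial p-prime}})

  -- The 2-adic descent for norm forms

  2-prime : Prime 2
  2-prime = toWitness {a? = prime? 2} _

  open PolynomialsModPrime (primeIdeal 2-prime)

  -- The quotient stands outside the disjunction, so that `proj₁ (parity n)` can be used in the
  -- types of both cases.
  parity : ∀ n → ∃ λ k → (n ≡ k ℤ.* + 2) ⊎ (n ≡ + 1 ℤ.+ k ℤ.* + 2)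
  parity n with n %ℕ 2 | n%ℕd<d n 2 | a≡a%ℕn+[a/ℕn]*n n 2
  ... | 0 | _ | n≡ = n /ℕ 2 , inj₁ (≡.trans n≡ (ℤ.+-identityˡ _))
  ... | 1 | _ | n≡ = n /ℕ 2 , inj₂ n≡
  ... | suc (suc _) | s≤s (s≤s ()) | _

  infix 4 2∣_
  2∣_ : Poly → Set
  2∣ f = In f

  two : Poly
  two = const (+ 2)

  2∣2* : ∀ {f} k → f ≈ two * k → 2∣ f
  2∣2* k f≈2k = In-resp (≈-sym (≈-trans f≈2k (*-comm two k)))
    (In-* k (In-const (divides (+ 1) ≡.refl)))

  2-cancel : ∀ f k → two * f ≈ two * k → f ≈ k
  2-cancel f k = const-cancel {+ 2} f k λ ()

  const-double : ∀ k → const (k ℤ.* + 2) ≈ const k * two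
  const-double k = ≈-sym (const-*-const k (+ 2))

  const-odd : ∀ k → const (+ 1 ℤ.+ k ℤ.* + 2) ≈ const (+ 1) + const k * two
  const-odd k = ≈-trans (const-+ (+ 1) (k ℤ.* + 2)) (+-cong (≈-refl {const (+ 1)}) (const-double k))

  -- Lets the ring solver exploit a hypothesis l ≈ r: it suffices that f - g equals l - r
  -- identically. The congruences below are all extracted from an equation in this way.
  by-difference : ∀ {f g} l r → l ≈ r → f ≈ g + (l - r) → f ≈ g
  by-difference {f} {g} l r l≈r f≈ = ≈-trans f≈ (≈-trans
    (+-cong (≈-refl {g}) (≈-trans (+-cong l≈r (≈-refl { - r})) (-‿inverseʳ r))) (+-identityʳ g))

  half : ∀ f → 2∣ f → ∃ λ f₁ → f ≈ two * f₁
  half f = quotient f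

  half-difference : ∀ f g → 2∣ (f - g) → ∃ λ f₁ → f ≈ g + two * f₁
  half-difference f g 2∣f-g with half (f - g) 2∣f-g
  ... | k , f-g≈2k = k , by-difference (f - g) (two * k) f-g≈2k
    (solve 3 (λ f g k → f := (g :+ con (+ 2) :* k) :+ ((f :- g) :- con (+ 2) :* k)) ≈-refl f g k)

  module NormObstruction (P Q : Poly) (P-odd : ¬ (2∣ P)) (Q-odd : ¬ (2∣ Q)) where

    z norm : Poly
    z    = X + const (+ 4)
    norm = P * P - z * (Q * Q)

    -- Modulo 2, z is X and signs disappear, so the norm becomes P² + X Q², which `In-f²+Xg²`
    -- controls.
    norm-odd : ¬ (2∣ norm)
    norm-odd 2∣norm = P-odd (proj₁ (In-f²+Xg² P Q (In-resp (≈-sym P²+XQ²≈)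
      (In-+ {f = norm} {g = two * (X * (Q * Q) + two * (Q * Q))} 2∣norm
        (2∣2* (X * (Q * Q) + two * (Q * Q)) ≈-refl)))))
      where
      P²+XQ²≈ : P * P + X * (Q * Q) ≈ norm + two * (X * (Q * Q) + two * (Q * Q))
      P²+XQ²≈ = solve 3 (λ p q x → p :* p :+ x :* (q :* q)
          := (p :* p :- (x :+ con (+ 4)) :* (q :* q)) :+ con (+ 2) :* (x :* (q :* q) :+ con (+ 2) :* (q :* q)))
        ≈-refl P Q X

    2∣const : ∀ n → 2∣ (const n * norm) → + 2 ℤ.∣ n
    2∣const n 2∣n*norm = [ (λ 2∣n → 2∣n 0) , (λ 2∣norm → contradiction 2∣norm norm-odd) ]′
      (In-prime (const n) norm 2∣n*norm)

    -- Modulo 2 the equation forces a ≡ P and b ≡ Q, whence the right side is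
    -- P² + z Q² modulo 4, which differs from ± norm by 2 z Q² or 2 P².
    odd≉a²+zb² : ∀ k a b → ¬ ((const (+ 1) + const k * two) * norm ≈ a * a + z * (b * b))
    -- The parity of k decides the sign: 1 + 2 k is 1 or -1 modulo 4.
    odd≉a²+zb² k a b eq = [ even-case , odd-case ]′ (proj₂ (parity k))
      where
      κ = const k
      lhs = (const (+ 1) + κ * two) * norm

      squares : 2∣ ((a - P) * (a - P) + X * ((b - Q) * (b - Q)))
      squares = 2∣2* (κ * norm + (P * P - two * (Q * Q) - two * (b * b) - a * P - X * (b * Q)))
        (by-difference (a * a + z * (b * b)) lhs (≈-sym eq)
          (solve 6 (λ p q a b x k →
              let z = x :+ con (+ 4) ; n = p :* p :- z :* (q :* q) in
              (a :- p) :* (a :- p) :+ x :* ((b :- q) :* (b :- q))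
              := con (+ 2) :* (k :* n :+ (p :* p :- con (+ 2) :* (q :* q) :- con (+ 2) :* (b :* b) :- a :* p :- x :* (b :* q)))
                 :+ ((a :* a :+ z :* (b :* b)) :- (con (+ 1) :+ k :* con (+ 2)) :* n))
            ≈-refl P Q a b X κ))

      a-half = half-difference a P (proj₁ (In-f²+Xg² (a - P) (b - Q) squares))
      b-half = half-difference b Q (proj₂ (In-f²+Xg² (a - P) (b - Q) squares))
      a₁ = proj₁ a-half
      b₁ = proj₁ b-half
      rhs = (P + two * a₁) * (P + two * a₁) + z * ((Q + two * b₁) * (Q + two * b₁))

      eq₁ : lhs ≈ rhs
      eq₁ = ≈-trans eq (+-cong (*-cong (proj₂ a-half) (proj₂ a-half))
        (*-congˡ z (*-cong (proj₂ b-half) (proj₂ b-half))))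

      even-case : ¬ (k ≡ proj₁ (parity k) ℤ.* + 2)
      even-case k≡2l = Q-odd (In-square Q (In-X* (Q * Q) (2∣2* (U - two * (Q * Q)) X*Q²≈)))
        where
        l = const (proj₁ (parity k))
        U = l * norm - (P * a₁ + a₁ * a₁ + z * (Q * b₁ + b₁ * b₁))
        eq₂ : (const (+ 1) + (l * two) * two) * norm ≈ rhs
        eq₂ = ≈-trans (*-cong (+-cong (≈-refl {const (+ 1)}) (*-cong
          (≈-sym (≈-trans (const-cong k≡2l) (const-double (proj₁ (parity k))))) (≈-refl {two}))) (≈-refl {norm})) eq₁
        X*Q²≈ : X * (Q * Q) ≈ two * (U - two * (Q * Q))
        X*Q²≈ = 2-cancel _ _ (by-difference rhs ((const (+ 1) + (l * two) * two) * norm) (≈-sym eq₂)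
          (solve 6 (λ p q a b x l →
              let z = x :+ con (+ 4) ; n = p :* p :- z :* (q :* q)
                  a′ = p :+ con (+ 2) :* a ; b′ = q :+ con (+ 2) :* b
                  u = l :* n :- (p :* a :+ a :* a :+ z :* (q :* b :+ b :* b)) in
              con (+ 2) :* (x :* (q :* q))
              := con (+ 2) :* (con (+ 2) :* (u :- con (+ 2) :* (q :* q)))
                 :+ ((a′ :* a′ :+ z :* (b′ :* b′)) :- (con (+ 1) :+ (l :* con (+ 2)) :* con (+ 2)) :* n))
            ≈-refl P Q a₁ b₁ X l))

      odd-case : ¬ (k ≡ + 1 ℤ.+ proj₁ (parity k) ℤ.* + 2)
      odd-case k≡1+2l = P-odd (In-square P (2∣2* U P²≈))
        where
        l = const (proj₁ (parity k))
        U = (l + const (+ 1)) * norm - (P * a₁ + a₁ * a₁ + z * (Q * b₁ + b₁ * b₁))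
        eq₂ : (const (+ 1) + (const (+ 1) + l * two) * two) * norm ≈ rhs
        eq₂ = ≈-trans (*-cong (+-cong (≈-refl {const (+ 1)}) (*-cong
          (≈-sym (≈-trans (const-cong k≡1+2l) (const-odd (proj₁ (parity k))))) (≈-refl {two}))) (≈-refl {norm})) eq₁
        P²≈ : P * P ≈ two * U
        P²≈ = 2-cancel _ _ (by-difference rhs ((const (+ 1) + (const (+ 1) + l * two) * two) * norm) (≈-sym eq₂)
          (solve 6 (λ p q a b x l →
              let z = x :+ con (+ 4) ; n = p :* p :- z :* (q :* q)
                  a′ = p :+ con (+ 2) :* a ; b′ = q :+ con (+ 2) :* b
                  u = (l :+ con (+ 1)) :* n :- (p :* a :+ a :* a :+ z :* (q :* b :+ b :* b)) in
              con (+ 2) :* (p :* p)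
              := con (+ 2) :* (con (+ 2) :* u)
                 :+ ((a′ :* a′ :+ z :* (b′ :* b′))
                      :- (con (+ 1) :+ (con (+ 1) :+ l :* con (+ 2)) :* con (+ 2)) :* n))
            ≈-refl P Q a₁ b₁ X l))

    -- Modulo 2 the equation reads P² + X Q² = a², that is (a - P)² + X Q² = 0, which makes Q
    -- vanish.
    odd≉a²-2zb² : ∀ k a b → ¬ ((const (+ 1) + const k * two) * norm ≈ a * a - two * (z * (b * b)))
    odd≉a²-2zb² k a b eq = Q-odd (proj₂ (In-f²+Xg² (a - P) Q
      (2∣2* (κ * norm + (P * P - two * (Q * Q) + z * (b * b) - a * P))
        (by-difference (a * a - two * (z * (b * b))) ((const (+ 1) + κ * two) * norm) (≈-sym eq)
          (solve 6 (λ p q a b x k →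
              let z = x :+ con (+ 4) ; n = p :* p :- z :* (q :* q) in
              (a :- p) :* (a :- p) :+ x :* (q :* q)
              := con (+ 2) :* (k :* n :+ (p :* p :- con (+ 2) :* (q :* q) :+ z :* (b :* b) :- a :* p))
                 :+ ((a :* a :- con (+ 2) :* (z :* (b :* b))) :- (con (+ 1) :+ k :* con (+ 2)) :* n))
            ≈-refl P Q a b X κ)))))
      where κ = const k

    -- Modulo 2 the equation reads P² + X Q² = X b², that is P² + X (Q - b)² = 0, which makes P
    -- vanish.
    odd≉2a²-zb² : ∀ k a b → ¬ ((const (+ 1) + const k * two) * norm ≈ two * (a * a) - z * (b * b))
    odd≉2a²-zb² k a b eq = P-odd (proj₁ (In-f²+Xg² P (Q - b)
      (2∣2* (X * (Q * Q) + two * (Q * Q) + a * a - two * (b * b) - X * (Q * b) - κ * norm)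
        (by-difference ((const (+ 1) + κ * two) * norm) (two * (a * a) - z * (b * b)) eq
          (solve 6 (λ p q a b x k →
              let z = x :+ con (+ 4) ; n = p :* p :- z :* (q :* q) in
              p :* p :+ x :* ((q :- b) :* (q :- b))
              := con (+ 2) :* (x :* (q :* q) :+ con (+ 2) :* (q :* q) :+ a :* a :- con (+ 2) :* (b :* b)
                               :- x :* (q :* b) :- k :* n)
                 :+ ((con (+ 1) :+ k :* con (+ 2)) :* n :- (con (+ 2) :* (a :* a) :- z :* (b :* b))))
            ≈-refl P Q a b X κ)))))
      where κ = const k

    -- Modulo 2 the right side is a² + X b², so a and b are even. The factor 2 that remains makes k
    -- even in turn, because the norm is not divisible by 2; the descent thus passes from n to n/4.
    even-step : ∀ k a b → const (k ℤ.* + 2) * norm ≈ a * a + z * (b * b) →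
                ∃ λ a₁ → ∃ λ b₁ → const k * norm ≈ two * (a₁ * a₁ + z * (b₁ * b₁))
    even-step k a b eq = a₁ , b₁ , 2-cancel _ _ (begin
      two * (const k * norm)            ≈⟨ *-assoc two (const k) norm ⟨
      two * const k * norm
        ≈⟨ *-cong (≈-trans (*-comm two (const k)) (≈-sym (const-double k))) (≈-refl {norm}) ⟩
      const (k ℤ.* + 2) * norm          ≈⟨ eq ⟩
      a * a + z * (b * b)
        ≈⟨ +-cong (*-cong a≈2a₁ a≈2a₁) (*-congˡ z (*-cong b≈2b₁ b≈2b₁)) ⟩
      (two * a₁) * (two * a₁) + z * ((two * b₁) * (two * b₁))
        ≈⟨ solve 3 (λ a b z →
               (con (+ 2) :* a) :* (con (+ 2) :* a) :+ z :* ((con (+ 2) :* b) :* (con (+ 2) :* b))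
               := con (+ 2) :* (con (+ 2) :* (a :* a :+ z :* (b :* b))))
             ≈-refl a₁ b₁ z ⟩
      two * (two * (a₁ * a₁ + z * (b₁ * b₁))) ∎)
      where
      open SetoidReasoning ≈-setoid
      squares : 2∣ (a * a + X * (b * b))
      squares = 2∣2* (const k * norm - two * (b * b))
        (by-difference (a * a + z * (b * b)) (const k * two * norm)
          (≈-trans (≈-sym eq) (*-cong (const-double k) (≈-refl {norm})))
          (solve 5 (λ a b x k n → a :* a :+ x :* (b :* b)
              := con (+ 2) :* (k :* n :- con (+ 2) :* (b :* b))
                 :+ ((a :* a :+ (x :+ con (+ 4)) :* (b :* b)) :- k :* con (+ 2) :* n))
            ≈-refl a b X (const k) norm))
      a-half = half a (proj₁ (In-f²+Xg² a b squares))
      b-half = half b (proj₂ (In-f²+Xg² a b squares))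
      a₁ = proj₁ a-half
      b₁ = proj₁ b-half
      a≈2a₁ = proj₂ a-half
      b≈2b₁ = proj₂ b-half

    halve : ∀ k f → const (k ℤ.* + 2) * norm ≈ two * f → const k * norm ≈ f
    halve k f eq = 2-cancel _ _ (begin
      two * (const k * norm)    ≈⟨ *-assoc two (const k) norm ⟨
      two * const k * norm
        ≈⟨ *-cong (≈-trans (*-comm two (const k)) (≈-sym (const-double k))) (≈-refl {norm}) ⟩
      const (k ℤ.* + 2) * norm  ≈⟨ eq ⟩
      two * f                   ∎)
      where open SetoidReasoning ≈-setoid

    odd-multiple : ∀ {n} k → n ≡ + 1 ℤ.+ k ℤ.* + 2 → ∀ {f} → const n * norm ≈ f →
                   (const (+ 1) + const k * two) * norm ≈ f
    odd-multiple k ≡.refl eq = ≈-trans (*-cong (≈-sym (const-odd k)) (≈-refl {norm})) eq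

    -- Only a is forced to be even, and halving turns a² - 2 z b² into 2 a² - z b². `even-stepʳ`
    -- turns it back, so that two halvings make one round of the descent.
    even-stepˡ : ∀ k a b → const (k ℤ.* + 2) * norm ≈ a * a - two * (z * (b * b)) →
                 ∃ λ a₁ → const k * norm ≈ two * (a₁ * a₁) - z * (b * b)
    even-stepˡ k a b eq = a₁ , halve k (two * (a₁ * a₁) - z * (b * b)) (begin
      const (k ℤ.* + 2) * norm                         ≈⟨ eq ⟩
      a * a - two * (z * (b * b))
        ≈⟨ +-cong (*-cong a≈2a₁ a≈2a₁) (≈-refl { - (two * (z * (b * b)))}) ⟩
      (two * a₁) * (two * a₁) - two * (z * (b * b))
        ≈⟨ solve 3 (λ a b z → (con (+ 2) :* a) :* (con (+ 2) :* a) :- con (+ 2) :* (z :* (b :* b))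
               := con (+ 2) :* (con (+ 2) :* (a :* a) :- z :* (b :* b)))
             ≈-refl a₁ b z ⟩
      two * (two * (a₁ * a₁) - z * (b * b))            ∎)
      where
      open SetoidReasoning ≈-setoid
      a² : a * a ≈ two * (const k * norm + z * (b * b))
      a² = by-difference (a * a - two * (z * (b * b))) (const k * two * norm)
        (≈-trans (≈-sym eq) (*-cong (const-double k) (≈-refl {norm})))
        (solve 5 (λ a b z k n → a :* a
            := con (+ 2) :* (k :* n :+ z :* (b :* b))
               :+ ((a :* a :- con (+ 2) :* (z :* (b :* b))) :- k :* con (+ 2) :* n))
          ≈-refl a b z (const k) norm)
      a-half = half a (In-square a (2∣2* (const k * norm + z * (b * b)) a²))
      a₁ = proj₁ a-half
      a≈2a₁ = proj₂ a-half

    even-stepʳ : ∀ k a b → const (k ℤ.* + 2) * norm ≈ two * (a * a) - z * (b * b) →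
                 ∃ λ b₁ → const k * norm ≈ a * a - two * (z * (b₁ * b₁))
    even-stepʳ k a b eq = b₁ , halve k (a * a - two * (z * (b₁ * b₁))) (begin
      const (k ℤ.* + 2) * norm                         ≈⟨ eq ⟩
      two * (a * a) - z * (b * b)
        ≈⟨ +-cong (≈-refl {two * (a * a)}) (-‿cong (*-congˡ z (*-cong b≈2b₁ b≈2b₁))) ⟩
      two * (a * a) - z * ((two * b₁) * (two * b₁))
        ≈⟨ solve 3 (λ a b z → con (+ 2) :* (a :* a) :- z :* ((con (+ 2) :* b) :* (con (+ 2) :* b))
               := con (+ 2) :* (a :* a :- con (+ 2) :* (z :* (b :* b))))
             ≈-refl a b₁ z ⟩
      two * (a * a - two * (z * (b₁ * b₁)))            ∎)
      where
      open SetoidReasoning ≈-setoid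
      X*b² : X * (b * b) ≈ two * (a * a - two * (b * b) - const k * norm)
      X*b² = by-difference (const k * two * norm) (two * (a * a) - z * (b * b))
        (≈-trans (*-cong (≈-sym (const-double k)) (≈-refl {norm})) eq)
        (solve 5 (λ a b x k n → x :* (b :* b)
            := con (+ 2) :* (a :* a :- con (+ 2) :* (b :* b) :- k :* n)
               :+ (k :* con (+ 2) :* n :- (con (+ 2) :* (a :* a) :- (x :+ con (+ 4)) :* (b :* b))))
          ≈-refl a b X (const k) norm)
      b-half = half b (In-square b (In-X* (b * b) (2∣2* (a * a - two * (b * b) - const k * norm) X*b²)))
      b₁ = proj₁ b-half
      b≈2b₁ = proj₂ b-half

    private
      quarter-< : ∀ l → l ℤ.* + 2 ℤ.* + 2 ≢ + 0 → ∣ l ∣ ℕ.< ∣ l ℤ.* + 2 ℤ.* + 2 ∣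
      quarter-< l 4l≢0 = ℕ.<-trans
        (∣∣-< l (s≤s (s≤s z≤n)) λ 2l≡0 → 4l≢0 (≡.cong (ℤ._* + 2) 2l≡0))
        (∣∣-< (l ℤ.* + 2) (s≤s (s≤s z≤n)) 4l≢0)

      quarter≢0 : ∀ l → l ℤ.* + 2 ℤ.* + 2 ≢ + 0 → l ≢ + 0
      quarter≢0 l 4l≢0 ≡.refl = 4l≢0 ≡.refl

      a²+zb²-fuel : ∀ fuel n a b → ∣ n ∣ ℕ.≤ fuel → n ≢ + 0 → ¬ (const n * norm ≈ a * a + z * (b * b))
      a²+zb²-fuel zero       n a b ∣n∣≤ n≢0 _  = n≢0 (ℤ.∣i∣≡0⇒i≡0 (ℕ.n≤0⇒n≡0 ∣n∣≤))
      a²+zb²-fuel (suc fuel) n a b ∣n∣≤ n≢0 eq = [ even , odd ]′ (proj₂ (parity n))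
        where
        odd : ¬ (n ≡ + 1 ℤ.+ proj₁ (parity n) ℤ.* + 2)
        odd n≡1+2k = odd≉a²+zb² (proj₁ (parity n)) a b (odd-multiple (proj₁ (parity n)) n≡1+2k eq)

        even′ : ∀ {k} → n ≡ k ℤ.* + 2 → + 2 ℤ.∣ k → ∀ a₁ b₁ →
                ¬ (const k * norm ≈ two * (a₁ * a₁ + z * (b₁ * b₁)))
        even′ ≡.refl (divides l ≡.refl) a₁ b₁ eq₁ = a²+zb²-fuel fuel l a₁ b₁
          (ℕ.≤-pred (ℕ.≤-trans (quarter-< l n≢0) ∣n∣≤)) (quarter≢0 l n≢0) (halve l _ eq₁)

        even : ¬ (n ≡ proj₁ (parity n) ℤ.* + 2)
        even n≡2k = even′ n≡2k (2∣const (proj₁ (parity n)) (2∣2* _ eq₁)) (proj₁ step) (proj₁ (proj₂ step)) eq₁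
          where
          step = even-step (proj₁ (parity n)) a b (≈-trans (*-cong (const-cong (≡.sym n≡2k)) (≈-refl {norm})) eq)
          eq₁ = proj₂ (proj₂ step)

      a²-2zb²-fuel : ∀ fuel n a b → ∣ n ∣ ℕ.≤ fuel → n ≢ + 0 → ¬ (const n * norm ≈ a * a - two * (z * (b * b)))
      a²-2zb²-fuel zero       n a b ∣n∣≤ n≢0 _  = n≢0 (ℤ.∣i∣≡0⇒i≡0 (ℕ.n≤0⇒n≡0 ∣n∣≤))
      a²-2zb²-fuel (suc fuel) n a b ∣n∣≤ n≢0 eq = [ even , odd ]′ (proj₂ (parity n))
        where
        odd : ¬ (n ≡ + 1 ℤ.+ proj₁ (parity n) ℤ.* + 2)
        odd n≡1+2k = odd≉a²-2zb² (proj₁ (parity n)) a b (odd-multiple (proj₁ (parity n)) n≡1+2k eq)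

        even : ¬ (n ≡ proj₁ (parity n) ℤ.* + 2)
        even n≡2k = [ even-even , even-odd ]′ (proj₂ (parity k))
          where
          k = proj₁ (parity n)
          step = even-stepˡ k a b (≈-trans (*-cong (const-cong (≡.sym n≡2k)) (≈-refl {norm})) eq)

          even-odd : ¬ (k ≡ + 1 ℤ.+ proj₁ (parity k) ℤ.* + 2)
          even-odd k≡1+2l = odd≉2a²-zb² (proj₁ (parity k)) (proj₁ step) b (odd-multiple (proj₁ (parity k)) k≡1+2l (proj₂ step))

          even-even : ¬ (k ≡ proj₁ (parity k) ℤ.* + 2)
          even-even k≡2l = a²-2zb²-fuel fuel l (proj₁ step) (proj₁ step′)
            (ℕ.≤-pred (ℕ.≤-trans (≡.subst (λ i → ∣ l ∣ ℕ.< ∣ i ∣) (≡.sym n≡4l) (quarter-< l 4l≢0)) ∣n∣≤))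
            (quarter≢0 l 4l≢0) (proj₂ step′)
            where
            l = proj₁ (parity k)
            n≡4l : n ≡ l ℤ.* + 2 ℤ.* + 2
            n≡4l = ≡.trans n≡2k (≡.cong (ℤ._* + 2) k≡2l)
            4l≢0 : l ℤ.* + 2 ℤ.* + 2 ≢ + 0
            4l≢0 4l≡0 = n≢0 (≡.trans n≡4l 4l≡0)
            step′ = even-stepʳ l (proj₁ step) b
              (≈-trans (*-cong (const-cong (≡.sym k≡2l)) (≈-refl {norm})) (proj₂ step))

    multiple≉a²+zb² : ∀ n a b → n ≢ + 0 → ¬ (const n * norm ≈ a * a + z * (b * b))
    multiple≉a²+zb² n a b = a²+zb²-fuel ∣ n ∣ n a b ℕ.≤-refl

    multiple≉a²-2zb² : ∀ n a b → n ≢ + 0 → ¬ (const n * norm ≈ a * a - two * (z * (b * b)))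
    multiple≉a²-2zb² n a b = a²-2zb²-fuel ∣ n ∣ n a b ℕ.≤-refl

  -- The polynomials g as norms

  2∤1 : ¬ (+ 2 ℤ.∣ + 1)
  2∤1 2∣1 with ∣⇒∣ᵤ 2∣1
  ... | ℕ.divides (suc zero) ()
  ... | ℕ.divides (suc (suc _)) ()

  g-odd-coeff : ∀ m → ¬ (2∣ g m)
  g-odd-coeff m 2∣g = 2∤1 (≡.subst (+ 2 ℤ.∣_) (≡.trans (coeff-g m m) (≡.cong +_ (lucasCoeff-m m))) (2∣g m))

  e-odd-coeff : ∀ m → ¬ (2∣ e (suc m))
  e-odd-coeff m 2∣e = 2∤1 (≡.subst (+ 2 ℤ.∣_)
    (≡.trans (coeff-e (suc m) m) (≡.cong +_ (≡.trans (≡.cong (λ n → suc n C suc (2 ℕ.* m)) (m+m≡2*m m)) (nCn≡1 (suc (2 ℕ.* m))))))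
    (2∣e m))

  const-*-assoc : ∀ n k f → const (n ℤ.* k) * f ≈ const n * (const k * f)
  const-*-assoc n k f = ≈-trans (*-cong (≈-sym (const-*-const n k)) (≈-refl {f})) (*-assoc (const n) (const k) f)

  -- The sign ε from `g-odd` is kept as a nonzero integer, to be absorbed into the multiplier of
  -- `g`.
  data IsNorm (f : Poly) : Set where
    isNorm : ∀ P Q → ¬ (2∣ P) → ¬ (2∣ Q) → ∀ ε → ε ≢ + 0 →
             f ≈ const ε * (P * P - (X + const (+ 4)) * (Q * Q)) → IsNorm f

  half-ℕ : ∀ n → ∃ λ i → n ≡ i ℕ.+ i ⊎ n ≡ i ℕ.+ suc i
  half-ℕ zero    = 0 , inj₁ ≡.refl
  half-ℕ (suc n) with half-ℕ n
  ... | i , inj₁ n≡i+i   = i , inj₂ (≡.trans (≡.cong suc n≡i+i) (≡.sym (ℕ.+-suc i i)))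
  ... | i , inj₂ n≡i+1+i = suc i , inj₁ (≡.cong suc n≡i+1+i)

  -- The index is positive because `g 0` = 1 comes from P = 1 and Q = 0. Halving a positive index
  -- always yields an `e` of positive index, which has leading coefficient 1 and so is nonzero
  -- modulo 2.
  g-isNorm : ∀ m → IsNorm (g (suc m))
  g-isNorm m with half-ℕ (suc m)
  ... | suc i , inj₁ m≡ = isNorm (g (suc i)) (e (suc i)) (g-odd-coeff (suc i)) (e-odd-coeff i) (+ 1) (λ ())
    (≈-trans (reflexive (≡.cong g m≡)) (≈-trans (g-even (suc i)) (≈-sym (*-identityˡ _))))
  ... | i , inj₂ m≡     = isNorm (g i) (e (suc i)) (g-odd-coeff i) (e-odd-coeff i) (ℤ.- + 1) (λ ())
    (≈-trans (reflexive (≡.cong g m≡)) (≈-trans (g-odd i)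
      (solve 3 (λ g e x → :- (g :* g :- (x :+ con (+ 4)) :* (e :* e))
          := con (ℤ.- + 1) :* (g :* g :- (x :+ con (+ 4)) :* (e :* e)))
        ≈-refl (g i) (e (suc i)) X)))

  multiple-g≉a²+[w+4]b² : ∀ m n a b → n ≢ + 0 →
    ¬ (const n * g (suc m) ≈ a * a + (X + const (+ 4)) * (b * b))
  multiple-g≉a²+[w+4]b² m n a b n≢0 eq with g-isNorm m
  ... | isNorm P Q P-odd Q-odd ε ε≢0 g≈ = multiple≉a²+zb² (n ℤ.* ε) a b
    (*-≢0 n ε n≢0 ε≢0)
    (≈-trans (const-*-assoc n ε norm) (≈-trans (*-congˡ (const n) (≈-sym g≈)) eq))
    where open NormObstruction P Q P-odd Q-odd

  multiple-g≉a²-2[w+4]b² : ∀ m n a b → n ≢ + 0 →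
    ¬ (const n * g (suc m) ≈ a * a - two * ((X + const (+ 4)) * (b * b)))
  multiple-g≉a²-2[w+4]b² m n a b n≢0 eq with g-isNorm m
  ... | isNorm P Q P-odd Q-odd ε ε≢0 g≈ = multiple≉a²-2zb² (n ℤ.* ε) a b
    (*-≢0 n ε n≢0 ε≢0)
    (≈-trans (const-*-assoc n ε norm) (≈-trans (*-congˡ (const n) (≈-sym g≈)) eq))
    where open NormObstruction P Q P-odd Q-odd

-- Second-order recurrences in a quadratic extension

IsUnit : ∀ {c ℓ} (R : CommutativeRing c ℓ) → CommutativeRing.Carrier R → Set (c ⊔ ℓ)
IsUnit R x = ∃ λ q → q * x ≈ 1#
  where open CommutativeRing R

-- σ = s (w + 4) and ξ² = σ; a sequence with the characteristic equation
-- t² = ξ t - s is, up to powers of s, the sequence g at odd indices and ξ e at even ones.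
module SecondOrderRecurrence {c ℓ} (W : CommutativeRing c ℓ) (w s : CommutativeRing.Carrier W) where

  open CommutativeRing W
  open IntegerSolver W
  module H = HalfAngle W w
  open H using (e; h; g; four)

  σ : Carrier
  σ = s * (w + four)

  open QuadraticExtension W σ using (commutativeRing₂)
  module E = CommutativeRing commutativeRing₂

  infixr 8 s^_
  s^_ : ℕ → Carrier
  s^ zero  = 1#
  s^ suc m = s * s^ m

  module _ (v : ℕ → E.Carrier) (v₀ : v 0 E.≈ (0# , 0#)) (v₁ : v 1 E.≈ (1# , 0#))
    (v₂₊ : ∀ n → v (suc (suc n)) E.≈ (0# , 1#) E.* v (suc n) E.- (s , 0#) E.* v n) where

    private
      step : ∀ n {a b a′ b′} → v (suc n) E.≈ (a , b) → v n E.≈ (a′ , b′) →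
             v (suc (suc n)) E.≈ (σ * b - s * a′ , a - s * b′)
      step n {a} {b} {a′} {b′} p q = E.trans (v₂₊ n)
        (E.trans (E.+-cong (E.*-congˡ p) (E.-‿cong (E.*-congˡ q)))
          ( solve 6 (λ a b a′ b′ s t →
                (con (+ 0) :* a :+ t :* (con (+ 1) :* b)) :+ :- (s :* a′ :+ t :* (con (+ 0) :* b′))
                := t :* b :- s :* a′) refl a b a′ b′ s σ
          , solve 5 (λ a b a′ b′ s →
                (con (+ 0) :* b :+ con (+ 1) :* a) :+ :- (s :* b′ :+ con (+ 0) :* a′)
                := a :- s :* b′) refl a b a′ b′ s))

    -- The two steps are g m + g (m+1) = (w + 4) e (m+1) and e (m+1) + e (m+2) = g (m+1), scaled by
    -- powers of s.
    closed-form : ∀ m → v (suc (m ℕ.* 2)) E.≈ (s^ m * g m , 0#) ×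
                        v (suc (suc (m ℕ.* 2))) E.≈ (0# , s^ m * e (suc m))
    closed-form zero    = odd , E.trans (step 0 odd v₀)
      ( solve 2 (λ s t → t :* con (+ 0) :- s :* con (+ 0) := con (+ 0)) refl s σ
      , solve 1 (λ s → con (+ 1) :* (con (+ 1) :+ (con (+ 0) :+ con (+ 0))) :- s :* con (+ 0)
          := con (+ 1) :* (con (+ 0) :+ con (+ 1))) refl s)
      where
      odd : v 1 E.≈ (1# * (1# + (0# + 0#)) , 0#)
      odd = E.trans v₁
        ( solve 0 (con (+ 1) := con (+ 1) :* (con (+ 1) :+ (con (+ 0) :+ con (+ 0)))) refl , refl)
    closed-form (suc m) = odd , even
      where
      odd : v (suc (suc m ℕ.* 2)) E.≈ (s^ suc m * g (suc m) , 0#)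
      odd = E.trans (step (suc (m ℕ.* 2)) (proj₂ (closed-form m)) (proj₁ (closed-form m)))
        ( solve 5 (λ e h x s t →
              s :* (x :+ ((con (+ 1) :+ con (+ 1)) :+ (con (+ 1) :+ con (+ 1)))) :* (t :* (e :+ h))
                :- s :* (t :* (h :+ (e :+ e)))
              := (s :* t) :* ((h :+ x :* (e :+ h)) :+ ((e :+ h) :+ (e :+ h))))
            refl (e m) (h m) w s (s^ m)
        , solve 1 (λ s → con (+ 0) :- s :* con (+ 0) := con (+ 0)) refl s)
      even : v (suc (suc (suc m ℕ.* 2))) E.≈ (0# , s^ suc m * e (suc (suc m)))
      even = E.trans (step (suc m ℕ.* 2) odd (proj₂ (closed-form m)))
        ( solve 2 (λ s t → t :* con (+ 0) :- s :* con (+ 0) := con (+ 0)) refl s σ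
        , solve 4 (λ e h s t → (s :* t) :* (h :+ (e :+ e)) :- s :* (t :* e) := (s :* t) :* (e :+ h))
            refl (e (suc m)) (h (suc m)) s (s^ m))

module RecurrenceUnderHom {c₁ ℓ₁ c₂ ℓ₂} {W : CommutativeRing c₁ ℓ₁} {B : CommutativeRing c₂ ℓ₂}
  (w s : CommutativeRing.Carrier W)
  (φ : RingHom B (QuadraticExtension.commutativeRing₂ W (SecondOrderRecurrence.σ W w s))) where

  private
    module B = CommutativeRing B
    module W = CommutativeRing W
    module φ = RingHom φ
  open SecondOrderRecurrence W w s
  open B using (_*_; _-_; _≈_)

  module _ {η t} (φη≈ξ : φ.⟦ η ⟧ E.≈ (W.0# , W.1#)) (φt≈s : φ.⟦ t ⟧ E.≈ (s , W.0#))
    (V : ℕ → B.Carrier) (V₀ : V 0 ≈ B.0#) (V₁ : V 1 ≈ B.1#)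
    (V₂₊ : ∀ n → V (suc (suc n)) ≈ η * V (suc n) - t * V n) where

    image-odd : ∀ m → φ.⟦ V (suc (m ℕ.* 2)) ⟧ E.≈ (s^ m W.* H.g m , W.0#)
    image-odd m = proj₁ (closed-form (λ n → φ.⟦ V n ⟧)
      (E.trans (φ.cong V₀) φ.0-homo) (E.trans (φ.cong V₁) φ.1-homo)
      (λ n → E.trans (φ.cong (V₂₊ n)) (E.trans (φ.sub-homo (η * V (suc n)) (t * V n))
        (E.+-cong
          (E.trans (φ.*-homo η (V (suc n))) (E.*-congʳ φη≈ξ))
          (E.-‿cong (E.trans (φ.*-homo t (V n)) (E.*-congʳ φt≈s))))))
      m)

-- Factorisations read off in the quadratic extension

module RingLemmas {c ℓ} (R : CommutativeRing c ℓ) where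
  open CommutativeRing R
  open IntegerSolver R

  *-cancel-inverse : ∀ {c′ c} → c′ * c ≈ 1# → ∀ x → c′ * (c * x) ≈ x
  *-cancel-inverse {c′} {c} c′c≈1 x = trans (sym (*-assoc c′ c x)) (trans (*-congʳ c′c≈1) (*-identityˡ x))

  s[z/s-f+f]≈z : ∀ {s s′} → s′ * s ≈ 1# → ∀ z f → s * (s′ * z - f + f) ≈ z
  s[z/s-f+f]≈z {s} {s′} s′s≈1 z f = trans
    (solve 4 (λ s s′ z f → s :* (s′ :* z :- f :+ f) := s′ :* (s :* z)) refl s s′ z f)
    (*-cancel-inverse s′s≈1 z)

  collect-η : ∀ {c′ η x} → c′ * η ≈ x → ∀ q a b →
              (q + η * η * (c′ * b)) + η * (c′ * a) ≈ q + x * (a + η * b)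
  collect-η {c′} {η} {x} c′η≈x q a b = trans
    (solve 5 (λ q c η a b → (q :+ η :* η :* (c :* b)) :+ η :* (c :* a) := q :+ (c :* η) :* (a :+ η :* b))
      refl q c′ η a b) (+-congˡ (*-congʳ c′η≈x))

  x1-t0≈x : ∀ x t → x * 1# - t * 0# ≈ x
  x1-t0≈x = solve 2 (λ x t → x :* con (+ 1) :- t :* con (+ 0) := x) refl

  x+y≈1zx-[-1]y : ∀ x z y → z * x + y ≈ 1# * z * x - - 1# * y
  x+y≈1zx-[-1]y = solve 3 (λ x z y → z :* x :+ y := con (+ 1) :* z :* x :- (:- con (+ 1)) :* y) refl

  x+y≈x-[-1]y : ∀ x y → x + y ≈ x - - 1# * y
  x+y≈x-[-1]y = solve 2 (λ x y → x :+ y := x :- (:- con (+ 1)) :* y) refl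

  cancel-constants : ∀ {d′ d k′ k D K l g n} → d′ * d ≈ 1# → k′ * k ≈ 1# → D ≈ d → K ≈ k →
                     l * g ≈ D * (K * n) → d′ * k′ * l * g ≈ n
  cancel-constants {d′} {d} {k′} {k} {D} {K} {l} {g} {n} d′d≈1 k′k≈1 D≈d K≈k eq = begin
    d′ * k′ * l * g            ≈⟨ *-assoc (d′ * k′) l g ⟩
    d′ * k′ * (l * g)          ≈⟨ *-congˡ (trans eq (*-cong D≈d (*-congʳ K≈k))) ⟩
    d′ * k′ * (d * (k * n))
      ≈⟨ solve 5 (λ d′ k′ d k n → d′ :* k′ :* (d :* (k :* n)) := d′ :* (d :* (k′ :* (k :* n)))) refl d′ k′ d k n ⟩
    d′ * (d * (k′ * (k * n)))  ≈⟨ *-cancel-inverse d′d≈1 _ ⟩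
    k′ * (k * n)               ≈⟨ *-cancel-inverse k′k≈1 n ⟩
    n                          ∎
    where open SetoidReasoning setoid

module _ {c₁ ℓ₁ c₂ ℓ₂} {W : CommutativeRing c₁ ℓ₁} {B : CommutativeRing c₂ ℓ₂} (ψ : RingHom W B) where

  private
    module W = CommutativeRing W
    module B = CommutativeRing B
    module ψ = RingHom ψ
  open B using (_*_; _-_; _≈_)

  image-σ : ∀ {w s t t′ z f} → ψ.⟦ s ⟧ ≈ t → t′ * t ≈ B.1# → ψ.⟦ SecondOrderRecurrence.H.four W w s ⟧ ≈ f →
            ψ.⟦ w ⟧ ≈ t′ * z - f → ψ.⟦ SecondOrderRecurrence.σ W w s ⟧ ≈ z
  image-σ {z = z} {f = f} s≈t t′t≈1 four≈f w≈ = B.trans (ψ.*-homo _ _)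
    (B.trans (B.*-cong s≈t (B.trans (ψ.+-homo _ _) (B.+-cong w≈ four≈f)))
      (RingLemmas.s[z/s-f+f]≈z B t′t≈1 z f))

module QuadraticFactorisation {c₁ ℓ₁ c₂ ℓ₂} {W : CommutativeRing c₁ ℓ₁} {B : CommutativeRing c₂ ℓ₂}
  (σ : CommutativeRing.Carrier W) (φ : RingHom B (QuadraticExtension.commutativeRing₂ W σ))
  (ψ : RingHom W B) (η : CommutativeRing.Carrier B) where

  private
    module W where
      open CommutativeRing W public
      open IntegerSolver W public
    module B where
      open CommutativeRing B public
      open IntegerSolver B public
    module E = CommutativeRing (QuadraticExtension.commutativeRing₂ W σ)
    module φ = RingHom φ
    module ψ = RingHom ψ
  open W using (_*_; _+_; _-_; -_; _≈_; 0#; 1#)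

  -- The substitution ξ ↦ η with `ψ` on the coefficients. Where it undoes `φ`, units found in the
  -- quadratic extension can be carried back to `B`.
  ρ : E.Carrier → B.Carrier
  ρ (a , b) = ψ.⟦ a ⟧ B.+ η B.* ψ.⟦ b ⟧

  norm : W.Carrier → W.Carrier → W.Carrier
  norm a b = a * a - σ * (b * b)

  ρ-cong : ∀ {p q} → p E.≈ q → ρ p B.≈ ρ q
  ρ-cong (a≈ , b≈) = B.+-cong (ψ.cong a≈) (B.*-congˡ (ψ.cong b≈))

  ρ-step : ∀ {C′ c′ x κ q} → ψ.⟦ σ ⟧ B.≈ η B.* η → c′ B.* η B.≈ x → ψ.⟦ C′ ⟧ B.≈ c′ → ψ.⟦ κ ⟧ B.≈ q →
           ∀ p → ρ ((κ , 0#) E.+ (0# , C′) E.* p) B.≈ q B.+ x B.* ρ p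
  ρ-step {C′} {c′} {x} {κ} {q} ψσ≈η² c′η≈x ψC′≈c′ ψκ≈q (a , b) = B.trans
    (B.+-cong
      (B.trans (ψ.cong (W.solve 5 (λ κ c a b s → κ W.:+ (W.con (+ 0) W.:* a W.:+ s W.:* (c W.:* b))
           W.:= κ W.:+ s W.:* (c W.:* b)) W.refl κ C′ a b σ))
        (B.trans (ψ.+-homo κ (σ * (C′ * b))) (B.+-cong ψκ≈q
          (B.trans (ψ.*-homo σ (C′ * b)) (B.*-cong ψσ≈η² (ψ-C′* b))))))
      (B.*-congˡ (B.trans (ψ.cong (W.solve 3 (λ c a b → W.con (+ 0) W.:+ (W.con (+ 0) W.:* b W.:+ c W.:* a)
           W.:= c W.:* a) W.refl C′ a b)) (ψ-C′* a))))
    (RingLemmas.collect-η B c′η≈x q ψ.⟦ a ⟧ ψ.⟦ b ⟧)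
    where
    ψ-C′* : ∀ k → ψ.⟦ C′ * k ⟧ B.≈ c′ B.* ψ.⟦ k ⟧
    ψ-C′* k = B.trans (ψ.*-homo C′ k) (B.*-congʳ ψC′≈c′)

  -- One Horner step of the proof that `ρ` undoes `φ`. Multiplication by the image x′ ξ of x becomes
  -- multiplication by c′ η = x, since ξ² = σ is sent to η².
  ρφ-step : ∀ {κ x f κ′ x′ c′} → ψ.⟦ σ ⟧ B.≈ η B.* η →
            φ.⟦ κ ⟧ E.≈ (κ′ , 0#) → ψ.⟦ κ′ ⟧ B.≈ κ →
            φ.⟦ x ⟧ E.≈ (0# , x′) → ψ.⟦ x′ ⟧ B.≈ c′ → c′ B.* η B.≈ x →
            ρ φ.⟦ f ⟧ B.≈ f → ρ φ.⟦ κ B.+ x B.* f ⟧ B.≈ κ B.+ x B.* f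
  ρφ-step {κ} {x} {f} ψσ≈η² φκ≈ ψκ′≈κ φx≈ ψx′≈c′ c′η≈x ρφf≈f =
    B.trans (ρ-cong (E.trans (φ.+-homo κ (x B.* f)) (E.+-cong φκ≈ (E.trans (φ.*-homo x f) (E.*-congʳ φx≈)))))
      (B.trans (ρ-step ψσ≈η² c′η≈x ψx′≈c′ ψκ′≈κ φ.⟦ f ⟧) (B.+-congˡ (B.*-congˡ ρφf≈f)))

  module _ (ψσ≈η² : ψ.⟦ σ ⟧ B.≈ η B.* η) (ρ∘φ : ∀ f → ρ φ.⟦ f ⟧ B.≈ f) where

    -- ρ (k (a + b ξ)) divides ψ (k (a² - σ b²)).
    unit-of-norm : ∀ {x k a b} → φ.⟦ x ⟧ E.≈ (k * a , k * b) → IsUnit W (k * norm a b) → IsUnit B x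
    unit-of-norm {x} {k} {a} {b} φx≈ (q , qkN≈1) = ψ.⟦ q ⟧ B.* (a′ B.- η B.* b′) , (begin
      ψ.⟦ q ⟧ B.* (a′ B.- η B.* b′) B.* x
        ≈⟨ B.*-congˡ (B.trans (B.sym (ρ∘φ x)) (B.trans (ρ-cong φx≈)
             (B.+-cong (ψ.*-homo k a) (B.*-congˡ (ψ.*-homo k b))))) ⟩
      ψ.⟦ q ⟧ B.* (a′ B.- η B.* b′) B.* (ψ.⟦ k ⟧ B.* a′ B.+ η B.* (ψ.⟦ k ⟧ B.* b′))
        ≈⟨ B.solve 5 (λ q k a b η →
               q B.:* (a B.:- η B.:* b) B.:* (k B.:* a B.:+ η B.:* (k B.:* b))
               B.:= q B.:* (k B.:* (a B.:* a B.:- η B.:* η B.:* (b B.:* b))))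
             B.refl ψ.⟦ q ⟧ ψ.⟦ k ⟧ a′ b′ η ⟩
      ψ.⟦ q ⟧ B.* (ψ.⟦ k ⟧ B.* (a′ B.* a′ B.- η B.* η B.* (b′ B.* b′)))
        ≈⟨ B.*-congˡ (B.*-congˡ (B.+-cong (ψ.*-homo a a) (B.-‿cong
             (B.trans (ψ.*-homo σ (b * b)) (B.*-cong ψσ≈η² (ψ.*-homo b b)))))) ⟨
      ψ.⟦ q ⟧ B.* (ψ.⟦ k ⟧ B.* (ψ.⟦ a * a ⟧ B.- ψ.⟦ σ * (b * b) ⟧))
        ≈⟨ B.*-congˡ (B.*-congˡ (ψ.sub-homo (a * a) (σ * (b * b)))) ⟨
      ψ.⟦ q ⟧ B.* (ψ.⟦ k ⟧ B.* ψ.⟦ norm a b ⟧)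
        ≈⟨ B.*-congˡ (ψ.*-homo k (norm a b)) ⟨
      ψ.⟦ q ⟧ B.* ψ.⟦ k * norm a b ⟧
        ≈⟨ ψ.*-homo q (k * norm a b) ⟨
      ψ.⟦ q * (k * norm a b) ⟧
        ≈⟨ ψ.cong qkN≈1 ⟩
      ψ.⟦ 1# ⟧
        ≈⟨ ψ.1-homo ⟩
      B.1# ∎)
      where
      open SetoidReasoning B.setoid
      a′ = ψ.⟦ a ⟧
      b′ = ψ.⟦ b ⟧

    module _ {f G} (φf≈G : φ.⟦ f ⟧ E.≈ (G , 0#)) where

      -- The image of f has no ξ-part, so the W-part of the image of an inverse of f inverts G.
      nonunit : ¬ IsUnit W G → ¬ IsUnit B f
      nonunit G-nonunit (q , qf≈1) = G-nonunit (proj₁ φ.⟦ q ⟧ , W.trans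
        (W.solve 4 (λ a b g s → a W.:* g W.:= a W.:* g W.:+ s W.:* (b W.:* W.con (+ 0)))
          W.refl (proj₁ φ.⟦ q ⟧) (proj₂ φ.⟦ q ⟧) G σ)
        (proj₁ (E.trans (E.sym (E.trans (φ.*-homo q f) (E.*-congˡ φf≈G))) (E.trans (φ.cong qf≈1) φ.1-homo))))

      -- With x = D (a + b ξ), a and b coprime, the vanishing of the ξ-part of
      -- x y forces y = K (a - b ξ), so that G = D K (a² - σ b²).
      split : ∀ {p} (Const : W.Carrier → Set p) →
        (∀ {A} → Const A → IsUnit W A) →
        (∀ A B → A * B ≈ 0# → A ≈ 0# ⊎ B ≈ 0#) →
        (∀ A B → Bézout W A B) →
        ¬ (G ≈ 0#) →
        (∀ A B → G ≈ A * B → Const A ⊎ Const B) →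
        (∀ D K A B → Const D → Const K → ¬ (G ≈ D * (K * norm A B))) →
        ∀ {x y} → f B.≈ x B.* y → IsUnit B x ⊎ IsUnit B y
      split Const const⇒unit domain bézout G≉0 factor not-norm {x} {y} f≈xy =
        -- With N the norm of a + b ξ, `factor` is applied to the two groupings D (K N) and K (D N).
        -- If K N is constant, y is a unit; if D N is constant, so is x; D and K both constant is
        -- what `not-norm` forbids.
        [ (λ D-const → [ (λ K-const → contradiction G≈DKN (not-norm gcd K a b D-const K-const))
                       , (λ DN-const → inj₁ (unit-of-norm (f≈ , g≈) (const⇒unit DN-const)))
                       ]′ (factor K (gcd * norm a b) G≈KDN))
        , (λ KN-const → inj₂ (unit-of-norm {k = K} {a = a} {b = - b} φy≈ (unit-resp (const⇒unit KN-const))))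
        ]′ (factor gcd (K * norm a b) G≈DKN)
        where
        open Bézout (bézout (proj₁ φ.⟦ x ⟧) (proj₂ φ.⟦ x ⟧)) renaming (f/gcd to a; g/gcd to b)
        open SetoidReasoning W.setoid
        open W using (solve; con; _:+_; _:*_; _:-_; :-_; _:=_)
        r = proj₁ φ.⟦ y ⟧
        t = proj₂ φ.⟦ y ⟧
        -- Forced by the intended r = K a and t = - K b, together with u a + v b = 1.
        K = u * r - v * t

        φf≈φxφy : (G , 0#) E.≈ φ.⟦ x ⟧ E.* φ.⟦ y ⟧
        φf≈φxφy = E.trans (E.sym φf≈G) (E.trans (φ.cong f≈xy) (φ.*-homo x y))

        G≈gcd* : G ≈ gcd * (a * r + σ * (b * t))
        G≈gcd* = begin
          G
            ≈⟨ proj₁ φf≈φxφy ⟩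
          proj₁ φ.⟦ x ⟧ * r + σ * (proj₂ φ.⟦ x ⟧ * t)
            ≈⟨ W.+-cong (W.*-congʳ f≈) (W.*-congˡ (W.*-congʳ g≈)) ⟩
          gcd * a * r + σ * (gcd * b * t)
            ≈⟨ solve 6 (λ d a b r t s → d :* a :* r :+ s :* (d :* b :* t) := d :* (a :* r :+ s :* (b :* t)))
                 W.refl gcd a b r t σ ⟩
          gcd * (a * r + σ * (b * t)) ∎

        gcd*≈0 : gcd * (a * t + b * r) ≈ 0#
        gcd*≈0 = begin
          gcd * (a * t + b * r)
            ≈⟨ solve 5 (λ d a b r t → d :* (a :* t :+ b :* r) := d :* a :* t :+ d :* b :* r)
                 W.refl gcd a b r t ⟩
          gcd * a * t + gcd * b * r
            ≈⟨ W.+-cong (W.*-congʳ f≈) (W.*-congʳ g≈) ⟨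
          proj₁ φ.⟦ x ⟧ * t + proj₂ φ.⟦ x ⟧ * r
            ≈⟨ proj₂ φf≈φxφy ⟨
          0# ∎

        ξ-part≈0 : a * t + b * r ≈ 0#
        ξ-part≈0 = [ (λ gcd≈0 → contradiction (W.trans G≈gcd* (W.trans (W.*-congʳ gcd≈0) (W.zeroˡ _))) G≉0)
                   , id ]′ (domain gcd (a * t + b * r) gcd*≈0)

        r≈Ka : r ≈ K * a
        r≈Ka = begin
          r                              ≈⟨ W.*-identityʳ r ⟨
          r * 1#                         ≈⟨ W.*-congˡ identity ⟨
          r * (u * a + v * b)
            ≈⟨ solve 6 (λ a b r t u v → r :* (u :* a :+ v :* b)
                   := (u :* r :- v :* t) :* a :+ v :* (a :* t :+ b :* r)) W.refl a b r t u v ⟩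
          K * a + v * (a * t + b * r)    ≈⟨ W.+-congˡ (W.*-congˡ ξ-part≈0) ⟩
          K * a + v * 0#                 ≈⟨ W.+-congˡ (W.zeroʳ v) ⟩
          K * a + 0#                     ≈⟨ W.+-identityʳ (K * a) ⟩
          K * a                          ∎

        t≈-Kb : t ≈ K * - b
        t≈-Kb = begin
          t                              ≈⟨ W.*-identityʳ t ⟨
          t * 1#                         ≈⟨ W.*-congˡ identity ⟨
          t * (u * a + v * b)
            ≈⟨ solve 6 (λ a b r t u v → t :* (u :* a :+ v :* b)
                   := (u :* r :- v :* t) :* (:- b) :+ u :* (a :* t :+ b :* r)) W.refl a b r t u v ⟩
          K * - b + u * (a * t + b * r)  ≈⟨ W.+-congˡ (W.*-congˡ ξ-part≈0) ⟩
          K * - b + u * 0#               ≈⟨ W.+-congˡ (W.zeroʳ u) ⟩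
          K * - b + 0#                   ≈⟨ W.+-identityʳ (K * - b) ⟩
          K * - b                        ∎

        φy≈ : φ.⟦ y ⟧ E.≈ (K * a , K * - b)
        φy≈ = r≈Ka , t≈-Kb

        G≈DKN : G ≈ gcd * (K * norm a b)
        G≈DKN = begin
          G                                            ≈⟨ G≈gcd* ⟩
          gcd * (a * r + σ * (b * t))
            ≈⟨ W.*-congˡ (W.+-cong (W.*-congˡ r≈Ka) (W.*-congˡ (W.*-congˡ t≈-Kb))) ⟩
          gcd * (a * (K * a) + σ * (b * (K * - b)))
            ≈⟨ solve 5 (λ d k a b s → d :* (a :* (k :* a) :+ s :* (b :* (k :* (:- b))))
                   := d :* (k :* (a :* a :- s :* (b :* b)))) W.refl gcd K a b σ ⟩
          gcd * (K * norm a b)                         ∎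

        G≈KDN : G ≈ K * (gcd * norm a b)
        G≈KDN = W.trans G≈DKN
          (solve 3 (λ d k n → d :* (k :* n) := k :* (d :* n)) W.refl gcd K (norm a b))

        unit-resp : IsUnit W (K * norm a b) → IsUnit W (K * norm a (- b))
        unit-resp (q , qKN≈1) = q , W.trans
          (solve 5 (λ q k a b s → q :* (k :* (a :* a :- s :* ((:- b) :* (:- b))))
              := q :* (k :* (a :* a :- s :* (b :* b)))) W.refl q K a b σ) qKN≈1

module RecurrenceFactorisation {c₁ ℓ₁ c₂ ℓ₂} {W : CommutativeRing c₁ ℓ₁} {B : CommutativeRing c₂ ℓ₂}
  (w s : CommutativeRing.Carrier W)
  (φ : RingHom B (QuadraticExtension.commutativeRing₂ W (SecondOrderRecurrence.σ W w s)))
  (ψ : RingHom W B) where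

  private
    module B = CommutativeRing B
    module W = CommutativeRing W
    module φ = RingHom φ
    module ψ = RingHom ψ
  open SecondOrderRecurrence W w s using (σ; s^_; module H; module E)
  open B using (_*_; _-_; _≈_)

  image-ξ : ∀ {γ x c c′} → φ.⟦ γ ⟧ E.≈ (c , W.0#) → φ.⟦ x ⟧ E.≈ (W.0# , c′) → c W.* c′ W.≈ W.1# →
            φ.⟦ γ * x ⟧ E.≈ (W.0# , W.1#)
  image-ξ {γ} {x} {c} {c′} φγ φx cc′≈1 = E.trans (φ.*-homo γ x) (E.trans (E.*-cong φγ φx)
    (E.trans (QuadraticExtension.embed-*-ξ W σ c c′) (W.refl , cc′≈1)))

  image-ρφ-0 : ∀ η → QuadraticFactorisation.ρ σ φ ψ η φ.⟦ B.0# ⟧ ≈ B.0#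
  image-ρφ-0 η = B.trans (QuadraticFactorisation.ρ-cong σ φ ψ η φ.0-homo)
    (B.trans (B.+-cong ψ.0-homo (B.trans (B.*-congˡ ψ.0-homo) (B.zeroʳ η))) (B.+-identityˡ B.0#))

  module _ {η t t′ f}
    (φη≈ξ : φ.⟦ η ⟧ E.≈ (W.0# , W.1#)) (φt≈s : φ.⟦ t ⟧ E.≈ (s , W.0#))
    (ψs≈t : ψ.⟦ s ⟧ ≈ t) (t′t≈1 : t′ * t ≈ B.1#)
    (ψf≈f : ψ.⟦ H.four ⟧ ≈ f) (ψw≈ : ψ.⟦ w ⟧ ≈ t′ * (η * η) - f)
    (ρ∘φ : ∀ x → QuadraticFactorisation.ρ σ φ ψ η φ.⟦ x ⟧ ≈ x)
    (V : ℕ → B.Carrier) (V₀ : V 0 ≈ B.0#) (V₁ : V 1 ≈ B.1#)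
    (V₂₊ : ∀ n → V (suc (suc n)) ≈ η * V (suc n) - t * V n)
    (m : ℕ)
    where

    private
      module F = QuadraticFactorisation σ φ ψ η
      φVₘ : φ.⟦ V (suc (m ℕ.* 2)) ⟧ E.≈ (s^ m W.* H.g m , W.0#)
      φVₘ = RecurrenceUnderHom.image-odd w s φ φη≈ξ φt≈s V V₀ V₁ V₂₊ m
      ψσ≈η² : ψ.⟦ σ ⟧ ≈ η * η
      ψσ≈η² = image-σ ψ ψs≈t t′t≈1 ψf≈f ψw≈

    nonunit : ¬ IsUnit W (s^ m W.* H.g m) → ¬ IsUnit B (V (suc (m ℕ.* 2)))
    nonunit = F.nonunit ψσ≈η² ρ∘φ φVₘ

    split : ∀ {p} (Const : W.Carrier → Set p) →
      (∀ {a} → Const a → IsUnit W a) →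
      (∀ a b → a W.* b W.≈ W.0# → a W.≈ W.0# ⊎ b W.≈ W.0#) →
      (∀ a b → Bézout W a b) →
      ¬ (s^ m W.* H.g m W.≈ W.0#) →
      (∀ a b → s^ m W.* H.g m W.≈ a W.* b → Const a ⊎ Const b) →
      (∀ D K a b → Const D → Const K → ¬ (s^ m W.* H.g m W.≈ D W.* (K W.* (a W.* a W.- σ W.* (b W.* b))))) →
      ∀ {x y} → V (suc (m ℕ.* 2)) ≈ x * y → IsUnit B x ⊎ IsUnit B y
    split = F.split ψσ≈η² ρ∘φ φVₘ

-- From integer to rational polynomials

open IntegerPolynomials

module Q = PolynomialRing ℚ-ring

ι : ℤ → ℚ
ι i = i / 1

private
  toℚᵘ-ι : ∀ i → toℚᵘ (ι i) ℚᵘ.≃ mkℚᵘ i 0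
  toℚᵘ-ι i = ℚ.toℚᵘ-fromℚᵘ (mkℚᵘ i 0)

  ι-+ : ∀ i j → ι (i ℤ.+ j) ≡ ι i ℚ.+ ι j
  ι-+ i j = ℚ.toℚᵘ-injective (begin
    toℚᵘ (ι (i ℤ.+ j))            ≈⟨ toℚᵘ-ι (i ℤ.+ j) ⟩
    mkℚᵘ (i ℤ.+ j) 0              ≈⟨ *≡* (units i j) ⟩
    mkℚᵘ i 0 ℚᵘ.+ mkℚᵘ j 0        ≈⟨ ℚᵘ.+-cong (toℚᵘ-ι i) (toℚᵘ-ι j) ⟨
    toℚᵘ (ι i) ℚᵘ.+ toℚᵘ (ι j)    ≈⟨ ℚ.toℚᵘ-homo-+ (ι i) (ι j) ⟨
    toℚᵘ (ι i ℚ.+ ι j)            ∎)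
    where
    open SetoidReasoning ℚᵘ.≃-setoid
    units : ∀ i j → (i ℤ.+ j) ℤ.* + 1 ≡ (i ℤ.* + 1 ℤ.+ j ℤ.* + 1) ℤ.* + 1
    units = ℤ-Tactic.solve-∀

  ι-* : ∀ i j → ι (i ℤ.* j) ≡ ι i ℚ.* ι j
  ι-* i j = ℚ.toℚᵘ-injective (begin
    toℚᵘ (ι (i ℤ.* j))            ≈⟨ toℚᵘ-ι (i ℤ.* j) ⟩
    mkℚᵘ i 0 ℚᵘ.* mkℚᵘ j 0        ≈⟨ ℚᵘ.*-cong (toℚᵘ-ι i) (toℚᵘ-ι j) ⟨
    toℚᵘ (ι i) ℚᵘ.* toℚᵘ (ι j)    ≈⟨ ℚ.toℚᵘ-homo-* (ι i) (ι j) ⟨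
    toℚᵘ (ι i ℚ.* ι j)            ∎)
    where open SetoidReasoning ℚᵘ.≃-setoid

ι-injective : ∀ {i j} → ι i ≡ ι j → i ≡ j
ι-injective {i} {j} eq with ℚ.fromℚᵘ-injective {mkℚᵘ i 0} {mkℚᵘ j 0} eq
... | *≡* i*1≡j*1 = ≡.trans (≡.sym (ℤ.*-identityʳ i)) (≡.trans i*1≡j*1 (ℤ.*-identityʳ j))

ι-≢0 : ∀ {i} → i ≢ + 0 → ι i ≢ ℚ.0ℚ
ι-≢0 i≢0 ιi≡0 = i≢0 (ι-injective ιi≡0)

↧*q≡↥ : ∀ q → ι (↧ q) ℚ.* q ≡ ι (↥ q)
↧*q≡↥ q@(ℚ.mkℚ _ _ _) = ℚ.toℚᵘ-injective (begin
  toℚᵘ (ι (↧ q) ℚ.* q)          ≈⟨ ℚ.toℚᵘ-homo-* (ι (↧ q)) q ⟩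
  toℚᵘ (ι (↧ q)) ℚᵘ.* toℚᵘ q    ≈⟨ ℚᵘ.*-congʳ (toℚᵘ-ι (↧ q)) ⟩
  mkℚᵘ (↧ q) 0 ℚᵘ.* toℚᵘ q      ≈⟨ *≡* (cross (↧ q) (↥ q)) ⟩
  mkℚᵘ (↥ q) 0                  ≈⟨ toℚᵘ-ι (↥ q) ⟨
  toℚᵘ (ι (↥ q))                ∎)
  where
  open SetoidReasoning ℚᵘ.≃-setoid
  cross : ∀ d n → (d ℤ.* n) ℤ.* + 1 ≡ n ℤ.* (+ 1 ℤ.* d)
  cross = ℤ-Tactic.solve-∀

ιHom : RingHom ℤ.+-*-commutativeRing ℚ-ring
ιHom = record
  { ⟦_⟧ = ι ; cong = ≡.cong ι ; +-homo = ι-+ ; *-homo = ι-* ; 0-homo = ≡.refl ; 1-homo = ≡.refl }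

ℚ-inverse : HasInverses ℚ-ring
ℚ-inverse q with q ℚ.≟ ℚ.0ℚ
... | yes q≡0 = inj₁ q≡0
... | no  q≢0 = inj₂ (ℚ.1/ q , ℚ.*-inverseˡ q)
  where instance _ = ℚ.≢-nonZero q≢0

ℚ-domain : ∀ p q → p ℚ.* q ≡ ℚ.0ℚ → p ≡ ℚ.0ℚ ⊎ q ≡ ℚ.0ℚ
ℚ-domain p q pq≡0 with ℚ-inverse p
... | inj₁ p≡0 = inj₁ p≡0
... | inj₂ (p′ , p′p≡1) = inj₂ (begin
  q                    ≡⟨ ℚ.*-identityˡ q ⟨
  ℚ.1ℚ ℚ.* q           ≡⟨ ≡.cong (ℚ._* q) p′p≡1 ⟨
  p′ ℚ.* p ℚ.* q       ≡⟨ ℚ.*-assoc p′ p q ⟩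
  p′ ℚ.* (p ℚ.* q)     ≡⟨ ≡.cong (p′ ℚ.*_) pq≡0 ⟩
  p′ ℚ.* ℚ.0ℚ          ≡⟨ ℚ.*-zeroʳ p′ ⟩
  ℚ.0ℚ                 ∎)
  where open ≡.≡-Reasoning

ℚ-zeroIdeal : PrimeIdeal ℚ-ring 0ℓ
ℚ-zeroIdeal = record
  { Mem   = _≡ ℚ.0ℚ
  ; Mem?  = ℚ._≟ ℚ.0ℚ
  ; resp  = λ { ≡.refl q≡0 → q≡0 }
  ; 0∈    = ≡.refl
  ; +-∈   = λ { ≡.refl ≡.refl → ≡.refl }
  ; *-∈   = λ { q ≡.refl → ℚ.*-zeroʳ q }
  ; prime = ℚ-domain
  }

constHom : ∀ {c ℓ} (R : CommutativeRing c ℓ) → RingHom R (R [X])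
constHom R = record
  { ⟦_⟧    = const
  ; cong   = const-cong
  ; +-homo = const-+
  ; *-homo = λ a b → ≈-sym (const-*-const a b)
  ; 0-homo = 0∷-≈[] (CommutativeRing.refl R) ≈-refl
  ; 1-homo = ≈-refl
  }
  where open PolynomialRing R

infixr 9 _∘ʰ_
_∘ʰ_ : ∀ {a b c d e f} {R : CommutativeRing a b} {S : CommutativeRing c d} {T : CommutativeRing e f} →
       RingHom S T → RingHom R S → RingHom R T
_∘ʰ_ {T = T} φ ψ = record
  { ⟦_⟧    = λ x → φ.⟦ ψ.⟦ x ⟧ ⟧
  ; cong   = λ p → φ.cong (ψ.cong p)
  ; +-homo = λ x y → trans (φ.cong (ψ.+-homo x y)) (φ.+-homo _ _)
  ; *-homo = λ x y → trans (φ.cong (ψ.*-homo x y)) (φ.*-homo _ _)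
  ; 0-homo = trans (φ.cong ψ.0-homo) φ.0-homo
  ; 1-homo = trans (φ.cong ψ.1-homo) φ.1-homo
  }
  where
  module φ = RingHom φ
  module ψ = RingHom ψ
  open CommutativeRing T using (trans)

module Extend = Evaluation (constHom ℚ-ring ∘ʰ ιHom) Q.X
module extend = RingHom Extend.evalHom

extend : ℤ[w].Poly → Q.Poly
extend = Extend.eval

coeff-extend : ∀ f n → Q.coeff (extend f) n ≡ ι (ℤ[w].coeff f n)
coeff-extend []      n       = ≡.refl
coeff-extend (a ∷ f) zero    = Q.coeff-≈ (Q.≈-sym (Q.∷-split (ι a) (extend f))) 0
coeff-extend (a ∷ f) (suc n) =
  ≡.trans (Q.coeff-≈ (Q.≈-sym (Q.∷-split (ι a) (extend f))) (suc n)) (coeff-extend f n)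

extend-injective : ∀ f g → extend f Q.≈ extend g → f ℤ[w].≈ g
extend-injective f g p = ℤ[w].coeffwise λ n →
  ι-injective (≡.trans (≡.sym (coeff-extend f n)) (≡.trans (Q.coeff-≈ p n) (coeff-extend g n)))

extend-const-* : ∀ n f → extend (ℤ[w].const n ℤ[w].* f) Q.≈ Q.const (ι n) Q.* extend f
extend-const-* n f = Q.≈-trans (extend.*-homo (ℤ[w].const n) f)
  (Q.*-cong (Extend.eval-const n) (Q.≈-refl {extend f}))

clear-denominators : ∀ f → ∃₂ λ d f′ → d ≢ + 0 × extend f′ Q.≈ Q.const (ι d) Q.* f
clear-denominators []      = + 1 , [] , (λ ()) , Q.≈-sym (Q.*-zeroʳ (Q.const (ι (+ 1))))
clear-denominators (q ∷ f) with clear-denominators f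
... | d , f′ , d≢0 , f′≈df = ↧ q ℤ.* d , (d ℤ.* ↥ q) ∷ (ℤ[w].const (↧ q) ℤ[w].* f′)
  , *-≢0 (↧ q) d (λ ()) d≢0
  , Q.coeffwise λ
    { zero    → ≡.trans (coeff-extend ((d ℤ.* ↥ q) ∷ (ℤ[w].const (↧ q) ℤ[w].* f′)) 0)
        (≡.trans head (≡.sym (Q.coeff-const-* (ι (↧ q ℤ.* d)) (q ∷ f) 0)))
    ; (suc n) → ≡.trans (coeff-extend ((d ℤ.* ↥ q) ∷ (ℤ[w].const (↧ q) ℤ[w].* f′)) (suc n))
        (≡.trans (tail n) (≡.sym (Q.coeff-const-* (ι (↧ q ℤ.* d)) (q ∷ f) (suc n))))
    }
  where
  open ≡.≡-Reasoning
  head : ι (d ℤ.* ↥ q) ≡ ι (↧ q ℤ.* d) ℚ.* q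
  head = begin
    ι (d ℤ.* ↥ q)               ≡⟨ ι-* d (↥ q) ⟩
    ι d ℚ.* ι (↥ q)             ≡⟨ ≡.cong (ι d ℚ.*_) (↧*q≡↥ q) ⟨
    ι d ℚ.* (ι (↧ q) ℚ.* q)     ≡⟨ ℚ.*-assoc (ι d) (ι (↧ q)) q ⟨
    ι d ℚ.* ι (↧ q) ℚ.* q       ≡⟨ ≡.cong (ℚ._* q) (ℚ.*-comm (ι d) (ι (↧ q))) ⟩
    ι (↧ q) ℚ.* ι d ℚ.* q       ≡⟨ ≡.cong (ℚ._* q) (ι-* (↧ q) d) ⟨
    ι (↧ q ℤ.* d) ℚ.* q         ∎
  tail : ∀ n → ι (ℤ[w].coeff (ℤ[w].const (↧ q) ℤ[w].* f′) n) ≡ ι (↧ q ℤ.* d) ℚ.* Q.coeff f n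
  tail n = begin
    ι (ℤ[w].coeff (ℤ[w].const (↧ q) ℤ[w].* f′) n)  ≡⟨ ≡.cong ι (ℤ[w].coeff-const-* (↧ q) f′ n) ⟩
    ι (↧ q ℤ.* ℤ[w].coeff f′ n)                    ≡⟨ ι-* (↧ q) (ℤ[w].coeff f′ n) ⟩
    ι (↧ q) ℚ.* ι (ℤ[w].coeff f′ n)                ≡⟨ ≡.cong (ι (↧ q) ℚ.*_) (coeff-extend f′ n) ⟨
    ι (↧ q) ℚ.* Q.coeff (extend f′) n              ≡⟨ ≡.cong (ι (↧ q) ℚ.*_) (Q.coeff-≈ f′≈df n) ⟩
    ι (↧ q) ℚ.* Q.coeff (Q.const (ι d) Q.* f) n    ≡⟨ ≡.cong (ι (↧ q) ℚ.*_) (Q.coeff-const-* (ι d) f n) ⟩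
    ι (↧ q) ℚ.* (ι d ℚ.* Q.coeff f n)              ≡⟨ ℚ.*-assoc (ι (↧ q)) (ι d) (Q.coeff f n) ⟨
    ι (↧ q) ℚ.* ι d ℚ.* Q.coeff f n                ≡⟨ ≡.cong (ℚ._* Q.coeff f n) (ι-* (↧ q) d) ⟨
    ι (↧ q ℤ.* d) ℚ.* Q.coeff f n                  ∎

IsNonzeroConstant : Q.Poly → Set
IsNonzeroConstant f = ∃ λ u → u ≢ ℚ.0ℚ × f Q.≈ Q.const u

module QS = IntegerSolver (ℚ-ring [X])

-- Multiplying a rational factorisation of k f by denominators a and b of its factors gives an
-- integral factorisation of a b k f. This is why the criterion was stated for integer multiples.
irreducible-up-to-constants : ∀ {p f d} (p-prime : Prime p) → Eisenstein p f d →
  ∀ k A B → k ≢ + 0 → Q.const (ι k) Q.* extend f Q.≈ A Q.* B → IsNonzeroConstant A ⊎ IsNonzeroConstant B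
irreducible-up-to-constants {f = f} p-prime E k A B k≢0 kf≈AB
  with clear-denominators A | clear-denominators B
... | a , A′ , a≢0 , A′≈aA | b , B′ , b≢0 , B′≈bB =
  Sum.map (nonzero-constant a≢0 A A′ A′≈aA) (nonzero-constant b≢0 B B′ B′≈bB)
    (degree-0 (a ℤ.* b ℤ.* k) A′ B′ abk≢0 (extend-injective _ _ abkf≈A′B′))
  where
  open EisensteinCriterion p-prime E
  abk≢0 : a ℤ.* b ℤ.* k ≢ + 0
  abk≢0 = *-≢0 (a ℤ.* b) k (*-≢0 a b a≢0 b≢0) k≢0
  const-ι-* : ∀ i j → Q.const (ι (i ℤ.* j)) Q.≈ Q.const (ι i) Q.* Q.const (ι j)
  const-ι-* i j = Q.≈-trans (Q.const-cong (ι-* i j)) (Q.≈-sym (Q.const-*-const (ι i) (ι j)))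
  abkf≈A′B′ : extend (ℤ[w].const (a ℤ.* b ℤ.* k) ℤ[w].* f) Q.≈ extend (A′ ℤ[w].* B′)
  abkf≈A′B′ = begin
    extend (ℤ[w].const (a ℤ.* b ℤ.* k) ℤ[w].* f)
      ≈⟨ extend-const-* (a ℤ.* b ℤ.* k) f ⟩
    Q.const (ι (a ℤ.* b ℤ.* k)) Q.* extend f
      ≈⟨ Q.*-cong (Q.≈-trans (const-ι-* (a ℤ.* b) k) (Q.*-cong (const-ι-* a b) (Q.≈-refl {Q.const (ι k)}))) (Q.≈-refl {extend f}) ⟩
    Q.const (ι a) Q.* Q.const (ι b) Q.* Q.const (ι k) Q.* extend f
      ≈⟨ Q.*-assoc (Q.const (ι a) Q.* Q.const (ι b)) (Q.const (ι k)) (extend f) ⟩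
    Q.const (ι a) Q.* Q.const (ι b) Q.* (Q.const (ι k) Q.* extend f)
      ≈⟨ Q.*-congˡ (Q.const (ι a) Q.* Q.const (ι b)) kf≈AB ⟩
    Q.const (ι a) Q.* Q.const (ι b) Q.* (A Q.* B)
      ≈⟨ QS.solve 4 (λ a b x y → a QS.:* b QS.:* (x QS.:* y) QS.:= (a QS.:* x) QS.:* (b QS.:* y))
           Q.≈-refl (Q.const (ι a)) (Q.const (ι b)) A B ⟩
    Q.const (ι a) Q.* A Q.* (Q.const (ι b) Q.* B)
      ≈⟨ Q.*-cong A′≈aA B′≈bB ⟨
    extend A′ Q.* extend B′
      ≈⟨ extend.*-homo A′ B′ ⟨
    extend (A′ ℤ[w].* B′) ∎
    where open SetoidReasoning Q.≈-setoid

  nonzero-constant : ∀ {d} → d ≢ + 0 → ∀ A A′ → extend A′ Q.≈ Q.const (ι d) Q.* A →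
                     HasDegree A′ 0 → IsNonzeroConstant A
  nonzero-constant {d} d≢0 A A′ A′≈dA A′-0 = Q.coeff A 0
    , (λ A₀≡0 → HasDegree.leading A′-0 (ι-injective (≡.trans (scaled 0)
        (≡.trans (≡.cong (ι d ℚ.*_) A₀≡0) (ℚ.*-zeroʳ (ι d))))))
    , Q.coeffwise λ
      { zero    → ≡.refl
      ; (suc n) → [ (λ ιd≡0 → contradiction ιd≡0 (ι-≢0 d≢0)) , id ]′
          (ℚ-domain (ι d) _ (≡.trans (≡.sym (scaled (suc n)))
            (≡.cong ι (HasDegree.above A′-0 (suc n) (s≤s z≤n)))))
      }
    where
    scaled : ∀ n → ι (ℤ[w].coeff A′ n) ≡ ι d ℚ.* Q.coeff A n
    scaled n = ≡.trans (≡.sym (coeff-extend A′ n)) (≡.trans (Q.coeff-≈ A′≈dA n) (Q.coeff-const-* (ι d) A n))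

module H = HalfAngle (ℚ-ring [X]) Q.X
open Q
open QS
open PolynomialsOverDomain ℚ-zeroIdeal (λ q≡0 → q≡0) using () renaming
  (HasDegree to HasDegreeℚ; degree? to degreeℚ?; degree-* to degreeℚ-*; degree-resp to degreeℚ-resp
  ; degree-unique to degreeℚ-unique; *-zero-divisor to *-zero-divisorℚ)

const-ι-* : ∀ i j → const (ι (i ℤ.* j)) ≈ const (ι i) * const (ι j)
const-ι-* i j = ≈-trans (const-cong (RingHom.*-homo ιHom i j)) (≈-sym (const-*-const (ι i) (ι j)))

four : Poly
four = H.four

four≈4 : const (ι (+ 4)) ≈ four
four≈4 = const-cong ≡.refl

extend-g : ∀ m → extend (ℤ[w].g m) ≈ H.g m
extend-g = g-homo Extend.evalHom Extend.eval-X

NotRationalNorm : ℤ → Set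
NotRationalNorm s = ∀ m κ a b → κ ≢ ℚ.0ℚ →
  ¬ (const κ * H.g (suc m) ≈ a * a - const (ι s) * (X + four) * (b * b))

NotIntegralNorm : ℤ → Set
NotIntegralNorm s = ∀ m n a b → n ≢ + 0 →
  ¬ (ℤ[w].const n ℤ[w].* ℤ[w].g (suc m) ℤ[w].≈
     a ℤ[w].* a ℤ[w].- ℤ[w].const s ℤ[w].* (ℤ[w].X ℤ[w].+ ℤ[w].const (+ 4)) ℤ[w].* (b ℤ[w].* b))

-- The equation is multiplied by the square of d e μ, where d and e clear the denominators of a and
-- b, and μ is the denominator of κ. A square preserves the norm form, and μ² κ is the integer μ ν,
-- with ν the numerator of κ.
rational-norm : ∀ s → NotIntegralNorm s → NotRationalNorm s
rational-norm s ¬norm m κ a b κ≢0 κg≈ with clear-denominators a | clear-denominators b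
... | d , a′ , d≢0 , a′≈da | e , b′ , e≢0 , b′≈eb = ¬norm m N A B N≢0 (extend-injective _ _ (begin
    extend (ℤ[w].const N ℤ[w].* ℤ[w].g (suc m))
      ≈⟨ extend-const-* N (ℤ[w].g (suc m)) ⟩
    const (ι N) * extend (ℤ[w].g (suc m))
      ≈⟨ *-cong N-split (extend-g (suc m)) ⟩
    δ * δ * (η * η) * (μ * ν) * G
      ≈⟨ *-cong (*-congˡ (δ * δ * (η * η)) (*-congˡ μ ν≈μκ)) (≈-refl {G}) ⟩
    δ * δ * (η * η) * (μ * (μ * const κ)) * G
      ≈⟨ solve 5 (λ d e m k g → d :* d :* (e :* e) :* (m :* (m :* k)) :* g
             := d :* d :* (e :* e) :* (m :* m) :* (k :* g)) ≈-refl δ η μ (const κ) G ⟩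
    δ * δ * (η * η) * (μ * μ) * (const κ * G)
      ≈⟨ *-congˡ (δ * δ * (η * η) * (μ * μ)) κg≈ ⟩
    δ * δ * (η * η) * (μ * μ) * (a * a - σ * (b * b))
      ≈⟨ solve 6 (λ d e m a b s → d :* d :* (e :* e) :* (m :* m) :* (a :* a :- s :* (b :* b))
             := (m :* e :* (d :* a)) :* (m :* e :* (d :* a))
                :- s :* ((m :* d :* (e :* b)) :* (m :* d :* (e :* b))))
           ≈-refl δ η μ a b σ ⟩
    (μ * η * (δ * a)) * (μ * η * (δ * a)) - σ * ((μ * δ * (η * b)) * (μ * δ * (η * b)))
      ≈⟨ +-cong (*-cong A≈ A≈) (-‿cong (*-cong σ≈ (*-cong B≈ B≈))) ⟨
    extend A * extend A - extend σ′ * (extend B * extend B)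
      ≈⟨ +-cong (extend.*-homo A A) (-‿cong (≈-trans (extend.*-homo σ′ (B ℤ[w].* B)) (*-congˡ (extend σ′) (extend.*-homo B B)))) ⟨
    extend (A ℤ[w].* A) - extend (σ′ ℤ[w].* (B ℤ[w].* B))
      ≈⟨ extend.sub-homo (A ℤ[w].* A) (σ′ ℤ[w].* (B ℤ[w].* B)) ⟨
    extend (A ℤ[w].* A ℤ[w].- σ′ ℤ[w].* (B ℤ[w].* B)) ∎))
  where
  open SetoidReasoning ≈-setoid
  δ = const (ι d)
  η = const (ι e)
  μ = const (ι (↧ κ))
  ν = const (ι (↥ κ))
  G = H.g (suc m)
  σ = const (ι s) * (X + four)
  σ′ = ℤ[w].const s ℤ[w].* (ℤ[w].X ℤ[w].+ ℤ[w].const (+ 4))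
  N = d ℤ.* d ℤ.* (e ℤ.* e) ℤ.* (↧ κ ℤ.* ↥ κ)
  A = ℤ[w].const (↧ κ ℤ.* e) ℤ[w].* a′
  B = ℤ[w].const (↧ κ ℤ.* d) ℤ[w].* b′
  ↥κ≢0 : ↥ κ ≢ + 0
  ↥κ≢0 ↥κ≡0 = κ≢0 (ℚ.↥p≡0⇒p≡0 κ ↥κ≡0)
  N≢0 : N ≢ + 0
  N≢0 = *-≢0 (d ℤ.* d ℤ.* (e ℤ.* e)) (↧ κ ℤ.* ↥ κ)
    (*-≢0 (d ℤ.* d) (e ℤ.* e) (*-≢0 d d d≢0 d≢0) (*-≢0 e e e≢0 e≢0))
    (*-≢0 (↧ κ) (↥ κ) (λ ()) ↥κ≢0)
  N-split : const (ι N) ≈ δ * δ * (η * η) * (μ * ν)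
  N-split = ≈-trans (const-ι-* (d ℤ.* d ℤ.* (e ℤ.* e)) (↧ κ ℤ.* ↥ κ)) (*-cong (≈-trans (const-ι-* (d ℤ.* d) (e ℤ.* e))
    (*-cong (const-ι-* d d) (const-ι-* e e))) (const-ι-* (↧ κ) (↥ κ)))
  ν≈μκ : ν ≈ μ * const κ
  ν≈μκ = ≈-sym (≈-trans (const-*-const (ι (↧ κ)) κ) (const-cong (↧*q≡↥ κ)))
  A≈ : extend A ≈ μ * η * (δ * a)
  A≈ = ≈-trans (extend-const-* (↧ κ ℤ.* e) a′) (*-cong (const-ι-* (↧ κ) e) a′≈da)
  B≈ : extend B ≈ μ * δ * (η * b)
  B≈ = ≈-trans (extend-const-* (↧ κ ℤ.* d) b′) (*-cong (const-ι-* (↧ κ) d) b′≈eb)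
  σ≈ : extend σ′ ≈ σ
  σ≈ = ≈-trans (extend-const-* s (ℤ[w].X ℤ[w].+ ℤ[w].const (+ 4))) (*-congˡ (const (ι s))
    (≈-trans (extend.+-homo ℤ[w].X (ℤ[w].const (+ 4))) (+-cong {f = extend ℤ[w].X} {g = extend (ℤ[w].const (+ 4))} Extend.eval-X (≈-trans (Extend.eval-const (+ 4)) four≈4))))

not-norm-1 : NotIntegralNorm (ℤ.- + 1)
not-norm-1 m n a b n≢0 eq = multiple-g≉a²+[w+4]b² m n a b n≢0 (ℤ[w].≈-trans eq
  (S.solve 3 (λ a b z → a S.:* a S.:- S.con (ℤ.- + 1) S.:* z S.:* (b S.:* b) S.:= a S.:* a S.:+ z S.:* (b S.:* b))
    ℤ[w].≈-refl a b (ℤ[w].X ℤ[w].+ ℤ[w].const (+ 4))))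
  where module S = IntegerSolver ℤ[w].commutativeRing

not-norm-2 : NotIntegralNorm (+ 2)
not-norm-2 m n a b n≢0 eq = multiple-g≉a²-2[w+4]b² m n a b n≢0 (ℤ[w].≈-trans eq
  (S.solve 3 (λ a b z → a S.:* a S.:- S.con (+ 2) S.:* z S.:* (b S.:* b)
      S.:= a S.:* a S.:- S.con (+ 2) S.:* (z S.:* (b S.:* b)))
    ℤ[w].≈-refl a b (ℤ[w].X ℤ[w].+ ℤ[w].const (+ 4))))
  where module S = IntegerSolver ℤ[w].commutativeRing

g-degree : ∀ k m → k ≢ + 0 → HasDegreeℚ (const (ι k) * H.g m) m
g-degree k m k≢0 = degreeℚ-resp (≈-trans (extend-const-* k (ℤ[w].g m)) (*-congˡ (const (ι k)) (extend-g m))) record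
  { leading = λ kgₘ≡0 → k≢0 (ι-injective (≡.trans (≡.sym kgₘ≡k) kgₘ≡0))
  ; above   = λ i m<i → ≡.trans (kg i) (≡.cong ι
      (≡.trans (≡.cong (k ℤ.*_) (≡.trans (coeff-g m i) (≡.cong +_ (lucasCoeff-above m i m<i)))) (ℤ.*-zeroʳ k)))
  }
  where
  kg : ∀ i → coeff (extend (ℤ[w].const k ℤ[w].* ℤ[w].g m)) i ≡ ι (k ℤ.* ℤ[w].coeff (ℤ[w].g m) i)
  kg i = ≡.trans (coeff-extend (ℤ[w].const k ℤ[w].* ℤ[w].g m) i) (≡.cong ι (ℤ[w].coeff-const-* k (ℤ[w].g m) i))
  kgₘ≡k : coeff (extend (ℤ[w].const k ℤ[w].* ℤ[w].g m)) m ≡ ι k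
  kgₘ≡k = ≡.trans (kg m) (≡.cong ι (≡.trans (≡.cong (k ℤ.*_)
    (≡.trans (coeff-g m m) (≡.cong +_ (lucasCoeff-m m)))) (ℤ.*-identityʳ k)))

open PolynomialsOverField ℚ-ring ℚ-inverse using (bézout)

open RingLemmas (ℚ-ring [X])

private
  module W = CommutativeRing (ℚ-ring [X])

inverse≢0 : ∀ u u′ → u′ ℚ.* u ≡ ℚ.1ℚ → u′ ≢ ℚ.0ℚ
inverse≢0 u u′ u′u≡1 u′≡0 = contradiction
  (≡.trans (≡.sym (ℚ.*-zeroˡ u)) (≡.trans (≡.cong (ℚ._* u) (≡.sym u′≡0)) u′u≡1)) λ ()

constant⇒unit : ∀ {f} → IsNonzeroConstant f → IsUnit (ℚ-ring [X]) f
constant⇒unit {f} (ω , ω≢0 , f≈ω) with ℚ-inverse ω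
... | inj₁ ω≡0 = contradiction ω≡0 ω≢0
... | inj₂ (ω′ , ω′ω≡1) = const ω′ , (begin
  const ω′ * f          ≈⟨ *-congˡ (const ω′) f≈ω ⟩
  const ω′ * const ω    ≈⟨ const-*-const ω′ ω ⟩
  const (ω′ ℚ.* ω)      ≈⟨ const-cong ω′ω≡1 ⟩
  const ℚ.1ℚ            ∎)
  where open SetoidReasoning ≈-setoid

-- One recurrence at an odd prime index

module Family
  (c c′ : ℚ) (c′c≡1 : c′ ℚ.* c ≡ ℚ.1ℚ)
  (s : ℤ) (s′ : ℚ) (s′s≡1 : s′ ℚ.* ι s ≡ ℚ.1ℚ) (s≢0 : s ≢ + 0)
  (not-norm : NotRationalNorm s)
  (V : ℕ → Poly) (V₀ : V 0 W.≈ W.0#) (V₁ : V 1 W.≈ W.1#)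
  (V₂₊ : ∀ n → V (suc (suc n)) W.≈ const c W.* X W.* V (suc n) W.- const (ι s) W.* V n)
  where

  private
    γ γ′ S S′ η w-image : Poly
    γ  = const c
    γ′ = const c′
    S  = const (ι s)
    S′ = const s′
    η  = γ W.* X
    -- w ↦ (c x)² / s - 4 and ξ ↦ c x invert φ.
    w-image = S′ W.* (η W.* η) W.- H.four

    γ′γ≈1 : γ′ W.* γ W.≈ W.1#
    γ′γ≈1 = ≈-trans (const-*-const c′ c) (const-cong c′c≡1)

    S′S≈1 : S′ W.* S W.≈ W.1#
    S′S≈1 = ≈-trans (const-*-const s′ (ι s)) (const-cong s′s≡1)

  open SecondOrderRecurrence (ℚ-ring [X]) X (const (ι s)) using (σ; s^_; module E)

  module φ = PolynomialHom {R = ℚ-ring}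
    {S = QuadraticExtension.commutativeRing₂ (ℚ-ring [X])
           (SecondOrderRecurrence.σ (ℚ-ring [X]) X (const (ι s)))}
    (QuadraticExtension.embed (ℚ-ring [X])
      (SecondOrderRecurrence.σ (ℚ-ring [X]) X (const (ι s))) ∘ʰ constHom ℚ-ring)
    -- The image of x is ξ / c, so that η = c x goes to ξ.
    ([] , const c′)
  module ψ = PolynomialHom {R = ℚ-ring} {S = ℚ-ring [X]}
    (constHom ℚ-ring) w-image

  open RecurrenceFactorisation {W = ℚ-ring [X]} {B = ℚ-ring [X]}
    X (const (ι s)) φ.hom ψ.hom
  module F = QuadraticFactorisation {W = ℚ-ring [X]} {B = ℚ-ring [X]}
    (SecondOrderRecurrence.σ (ℚ-ring [X]) X (const (ι s))) φ.hom ψ.hom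

  private
    φ-γ : RingHom.⟦_⟧ φ.hom γ E.≈ (γ , W.0#)
    φ-γ = φ.hom-const c

    φ-X : RingHom.⟦_⟧ φ.hom X E.≈ (W.0# , γ′)
    φ-X = φ.hom-X

    φ-S : RingHom.⟦_⟧ φ.hom S E.≈ (S , W.0#)
    φ-S = φ.hom-const (ι s)

    φ-η : RingHom.⟦_⟧ φ.hom η E.≈ (W.0# , W.1#)
    φ-η = image-ξ {γ} {X} {γ} {γ′} φ-γ φ-X (W.trans (W.*-comm γ γ′) γ′γ≈1)

    ψ-four : RingHom.⟦_⟧ ψ.hom H.four W.≈ H.four
    ψ-four = ≈-trans (RingHom.cong ψ.hom {H.four} {const (ι (+ 4))} (≈-sym four≈4))
      (≈-trans (ψ.hom-const (ι (+ 4))) four≈4)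

    ψ-σ : RingHom.⟦_⟧ ψ.hom σ W.≈ η W.* η
    ψ-σ = image-σ {W = ℚ-ring [X]} {B = ℚ-ring [X]} ψ.hom
      {w = X} {s = S} {t = S} {t′ = S′} {z = η W.* η} {f = H.four} (ψ.hom-const (ι s)) S′S≈1 ψ-four ψ.hom-X

    γ′η≈X : γ′ W.* η W.≈ X
    γ′η≈X = *-cancel-inverse {γ′} {γ} γ′γ≈1 X

    ρφ : Poly → Poly
    ρφ f = F.ρ η (RingHom.⟦_⟧ φ.hom f)

    ρφ-cong : ∀ f g → f W.≈ g → ρφ f W.≈ ρφ g
    ρφ-cong f g f≈g = F.ρ-cong η {RingHom.⟦_⟧ φ.hom f} {RingHom.⟦_⟧ φ.hom g} (RingHom.cong φ.hom {f} {g} f≈g)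

    ρφ-∷ : ∀ q f → ρφ f W.≈ f → ρφ (const q W.+ X W.* f) W.≈ const q W.+ X W.* f
    ρφ-∷ q f = F.ρφ-step η {κ = const q} {x = X} {f = f} {κ′ = const q} {x′ = γ′} {c′ = γ′} ψ-σ
      (φ.hom-const q) (ψ.hom-const q) φ-X (ψ.hom-const c′) γ′η≈X

    ρ∘φ : ∀ f → ρφ f W.≈ f
    ρ∘φ []      = image-ρφ-0 η
    ρ∘φ (q ∷ f) = begin
      ρφ (q ∷ f)                   ≈⟨ ρφ-cong (q ∷ f) (const q W.+ X W.* f) (∷-split q f) ⟩
      ρφ (const q W.+ X W.* f)     ≈⟨ ρφ-∷ q f (ρ∘φ f) ⟩
      const q W.+ X W.* f          ≈⟨ ∷-split q f ⟨
      q ∷ f                        ∎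
      where open SetoidReasoning W.setoid

  s^m≢0 : ∀ m → s ℤ.^ m ≢ + 0
  s^m≢0 zero    ()
  s^m≢0 (suc m) = *-≢0 s (s ℤ.^ m) s≢0 (s^m≢0 m)

  s^-const : ∀ m → s^ m W.≈ const (ι (s ℤ.^ m))
  s^-const zero    = ≈-refl
  s^-const (suc m) = W.trans {s^ suc m} {S W.* const (ι (s ℤ.^ m))} {const (ι (s ℤ.^ suc m))}
    (W.*-congˡ {S} {s^ m} {const (ι (s ℤ.^ m))} (s^-const m)) (≈-sym (const-ι-* s (s ℤ.^ m)))

  module _ (m : ℕ) (p-prime : Prime (suc (2 ℕ.* suc m))) where

    private
      k : ℤ
      k = s ℤ.^ suc m

      G G′ : Poly
      G  = s^ suc m W.* H.g (suc m)
      G′ = const (ι k) W.* H.g (suc m)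

      G≈G′ : G W.≈ G′
      G≈G′ = W.*-congʳ {H.g (suc m)} {s^ suc m} {const (ι k)} (s^-const (suc m))

      G-degree : HasDegreeℚ G (suc m)
      G-degree = degreeℚ-resp {G′} {G} (W.sym G≈G′) (g-degree k (suc m) (s^m≢0 (suc m)))

      G≉0 : ¬ (G W.≈ W.0#)
      G≉0 G≈0 = PolynomialsOverDomain.HasDegree.leading G-degree (coeff-≈ G≈0 (suc m))

      -- Degrees add up, and G has the positive degree m + 1.
      G-nonunit : ¬ IsUnit (ℚ-ring [X]) G
      G-nonunit (q , qG≈1) with degreeℚ? q
      ... | inj₁ q≈0 = contradiction (coeff-≈ {W.1#} {W.0#} 1≈0 0) λ ()
        where
        1≈0 : W.1# W.≈ W.0#
        1≈0 = W.trans {W.1#} {q W.* G} {W.0#} (W.sym {q W.* G} {W.1#} qG≈1)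
          (W.trans {q W.* G} {W.0# W.* G} {W.0#} (W.*-congʳ {G} {q} {W.0#} q≈0) (W.zeroˡ G))
      ... | inj₂ (d , q-d) = ℕ.1+n≢0 (≡.trans (≡.sym (ℕ.+-suc d m))
        (degreeℚ-unique {W.1#} (degreeℚ-resp {q W.* G} {W.1#} qG≈1 (degreeℚ-* q G q-d G-degree)) 1-degree))
        where
        1-degree : HasDegreeℚ W.1# 0
        1-degree = record { leading = λ () ; above = λ { (suc i) _ → ≡.refl } }

      factor : ∀ A B → G W.≈ A W.* B → IsNonzeroConstant A ⊎ IsNonzeroConstant B
      factor A B G≈AB = irreducible-up-to-constants p-prime (g-Eisenstein (suc m) p-prime)
        k A B (s^m≢0 (suc m))
        (W.trans {const (ι k) W.* extend (ℤ[w].g (suc m))} {G′} {A W.* B}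
          (W.*-congˡ {const (ι k)} (extend-g (suc m))) (W.trans {G′} {G} {A W.* B} (W.sym G≈G′) G≈AB))

      -- Moving the constants D and K to the left side turns the equation into one between a nonzero
      -- rational multiple of `g` and a norm.
      not-scaled-norm : ∀ D K a b → IsNonzeroConstant D → IsNonzeroConstant K →
                        ¬ (G W.≈ D W.* (K W.* (a W.* a W.- σ W.* (b W.* b))))
      not-scaled-norm D K a b (δ , δ≢0 , D≈δ) (κ , κ≢0 , K≈κ) G≈ with ℚ-inverse δ | ℚ-inverse κ
      ... | inj₁ δ≡0 | _        = δ≢0 δ≡0
      ... | inj₂ _   | inj₁ κ≡0 = κ≢0 κ≡0
      ... | inj₂ (δ′ , δ′δ≡1) | inj₂ (κ′ , κ′κ≡1) = not-norm m (δ′ ℚ.* κ′ ℚ.* ι k) a b δ′κ′k≢0 (begin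
          const (δ′ ℚ.* κ′ ℚ.* ι k) W.* H.g (suc m)
            ≈⟨ W.*-congʳ {H.g (suc m)} {const (δ′ ℚ.* κ′ ℚ.* ι k)} {const δ′ W.* const κ′ W.* const (ι k)} const-split ⟩
          const δ′ W.* const κ′ W.* const (ι k) W.* H.g (suc m)
            ≈⟨ cancel-constants {const δ′} {const δ} {const κ′} {const κ} {D} {K} {const (ι k)} {H.g (suc m)} {norm}
                 (≈-trans (const-*-const δ′ δ) (const-cong δ′δ≡1))
                 (≈-trans (const-*-const κ′ κ) (const-cong κ′κ≡1))
                 D≈δ K≈κ (W.trans {G′} {G} {D W.* (K W.* norm)} (W.sym {G} {G′} G≈G′) G≈) ⟩
          norm ∎)
        where
        open SetoidReasoning W.setoid
        norm : Poly
        norm = a W.* a W.- σ W.* (b W.* b)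
        const-split : const (δ′ ℚ.* κ′ ℚ.* ι k) W.≈ const δ′ W.* const κ′ W.* const (ι k)
        const-split = ≈-sym (≈-trans (*-cong (const-*-const δ′ κ′) (≈-refl {const (ι k)}))
          (const-*-const (δ′ ℚ.* κ′) (ι k)))
        δ′κ′k≢0 : δ′ ℚ.* κ′ ℚ.* ι k ≢ ℚ.0ℚ
        δ′κ′k≢0 eq = [ (λ δ′κ′≡0 → [ inverse≢0 δ δ′ δ′δ≡1 , inverse≢0 κ κ′ κ′κ≡1 ]′ (ℚ-domain δ′ κ′ δ′κ′≡0))
                     , ι-≢0 (s^m≢0 (suc m)) ]′ (ℚ-domain (δ′ ℚ.* κ′) (ι k) eq)

    V-nonunit : ¬ IsUnit (ℚ-ring [X]) (V (suc (suc m ℕ.* 2)))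
    V-nonunit = nonunit {η} {S} {S′} {H.four} φ-η φ-S (ψ.hom-const (ι s)) S′S≈1 ψ-four ψ.hom-X ρ∘φ V V₀ V₁ V₂₊ (suc m) G-nonunit

    V-split : ∀ {x y} → V (suc (suc m ℕ.* 2)) W.≈ x W.* y →
              IsUnit (ℚ-ring [X]) x ⊎ IsUnit (ℚ-ring [X]) y
    V-split = split {η} {S} {S′} {H.four} φ-η φ-S (ψ.hom-const (ι s)) S′S≈1 ψ-four ψ.hom-X ρ∘φ V V₀ V₁ V₂₊ (suc m)
      IsNonzeroConstant constant⇒unit *-zero-divisorℚ bézout G≉0 factor not-scaled-norm

-- The prime 2 and the three sequences

irreducible : ∀ {f} → ¬ IsUnit (ℚ-ring [X]) f →
  (∀ {x y} → f W.≈ x W.* y → IsUnit (ℚ-ring [X]) x ⊎ IsUnit (ℚ-ring [X]) y) →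
  ℚ[X].Irreducible f
irreducible f-nonunit f-split = mkIrred
  (λ (q , qf≈1) → f-nonunit (q , qf≈1))
  (λ f≈xy → Sum.map (λ (q , qx≈1) → q , qx≈1) (λ (q , qy≈1) → q , qy≈1) (f-split f≈xy))

-- Needed for p = 2, where V 2 = c x lies outside the odd-index theory. One factor has constant term
-- zero; cancelling X from it shows that the other divides the constant c.
monomial-irreducible : ∀ {f} c c′ → c′ ℚ.* c ≡ ℚ.1ℚ → f W.≈ const c W.* X → ℚ[X].Irreducible f
monomial-irreducible {f} c c′ c′c≡1 f≈cX = irreducible nonunit split
  where
  constant-term : coeff f 0 ≡ ℚ.0ℚ
  constant-term = ≡.trans (coeff-≈ {f} f≈cX 0) (≡.trans (coeff-const-* c X 0) (ℚ.*-zeroʳ c))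

  nonunit : ¬ IsUnit (ℚ-ring [X]) f
  nonunit (q , qf≈1) = contradiction (≡.trans (≡.sym (coeff-≈ {q W.* f} {W.1#} qf≈1 0))
    (≡.trans (coeff-*-zero q f) (≡.trans (≡.cong (coeff q 0 ℚ.*_) constant-term) (ℚ.*-zeroʳ (coeff q 0))))) λ ()

  cofactor : ∀ x y → f W.≈ x W.* y → coeff x 0 ≡ ℚ.0ℚ → IsUnit (ℚ-ring [X]) y
  cofactor []      y f≈xy _    = contradiction
    (≡.trans (≡.sym (ℚ.*-identityʳ c)) (≡.trans (≡.sym (coeff-const-* c X 1))
      (coeff-≈ {const c W.* X} {[]} (W.trans {const c W.* X} {f} {[]} (W.sym {f} {const c W.* X} f≈cX) f≈xy) 1)))
    (inverse≢0 c′ c (≡.trans (ℚ.*-comm c c′) c′c≡1))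
  cofactor (a ∷ x) y f≈xy a≡0 = const c′ W.* x , (begin
    const c′ W.* x W.* y        ≈⟨ W.*-assoc (const c′) x y ⟩
    const c′ W.* (x W.* y)      ≈⟨ W.*-congˡ {const c′} {x W.* y} {const c} xy≈c ⟩
    const c′ W.* const c        ≈⟨ const-*-const c′ c ⟩
    const (c′ ℚ.* c)            ≈⟨ const-cong c′c≡1 ⟩
    W.1#                        ∎)
    where
    open SetoidReasoning W.setoid
    X*xy≈X*c : ℚ.0ℚ ∷ (x W.* y) W.≈ ℚ.0ℚ ∷ const c
    X*xy≈X*c = begin
      ℚ.0ℚ ∷ (x W.* y)      ≈⟨ 0∷-* x y ⟨
      (ℚ.0ℚ ∷ x) W.* y      ≈⟨ *-cong (∷-cong a≡0 (≈-refl {x})) (≈-refl {y}) ⟨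
      (a ∷ x) W.* y         ≈⟨ f≈xy ⟨
      f                     ≈⟨ f≈cX ⟩
      const c W.* X         ≈⟨ *-comm (const c) X ⟩
      X W.* const c         ≈⟨ X-* (const c) ⟩
      ℚ.0ℚ ∷ const c        ∎
    xy≈c : x W.* y W.≈ const c
    xy≈c = tail-≈ X*xy≈X*c

  split : ∀ {x y} → f W.≈ x W.* y →
          IsUnit (ℚ-ring [X]) x ⊎ IsUnit (ℚ-ring [X]) y
  split {x} {y} f≈xy = [ (λ x₀≡0 → inj₂ (cofactor x y f≈xy x₀≡0))
    , (λ y₀≡0 → inj₁ (cofactor y x (W.trans {f} {x W.* y} {y W.* x} f≈xy (*-comm x y)) y₀≡0))
    ]′ (ℚ-domain (coeff x 0) (coeff y 0)
      (≡.trans (≡.sym (coeff-*-zero x y)) (≡.trans (≡.sym (coeff-≈ {f} {x W.* y} f≈xy 0)) constant-term)))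

-- The odd case has the index form of `closed-form`, with m + 1 in the place of m, since the norm
-- argument requires a positive index of `g`.
prime-cases : ∀ p → Prime p → p ≡ 2 ⊎ ∃ λ m → p ≡ suc (suc m ℕ.* 2)
prime-cases p p-prime with half-ℕ p
... | zero  , inj₂ ≡.refl = contradiction p-prime ¬prime[1]
... | suc m , inj₂ p≡     = inj₂ (m , ≡.trans p≡ (odd m))
  where
  odd : ∀ m → suc m ℕ.+ suc (suc m) ≡ suc (suc m ℕ.* 2)
  odd m = ≡.trans (ℕ.+-suc (suc m) (suc m)) (≡.cong suc (≡.trans (m+m≡2*m (suc m)) (ℕ.*-comm 2 (suc m))))
... | i     , inj₁ p≡i+i  = inj₁ ([ (λ ()) , ≡.sym ]′ (prime⇒irreducible p-prime 2∣p))
  where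
  2∣p : 2 ℕ.∣ p
  2∣p = ℕ.divides i (≡.trans p≡i+i (≡.trans (m+m≡2*m i) (ℕ.*-comm 2 i)))

module FamilyIrreducible
  (c c′ : ℚ) (c′c≡1 : c′ ℚ.* c ≡ ℚ.1ℚ)
  (s : ℤ) (s′ : ℚ) (s′s≡1 : s′ ℚ.* ι s ≡ ℚ.1ℚ) (s≢0 : s ≢ + 0)
  (not-norm : NotRationalNorm s)
  (V : ℕ → Poly) (V₀ : V 0 W.≈ W.0#) (V₁ : V 1 W.≈ W.1#)
  (V₂₊ : ∀ n → V (suc (suc n)) W.≈ const c W.* X W.* V (suc n) W.- const (ι s) W.* V n)
  where

  open Family c c′ c′c≡1 s s′ s′s≡1 s≢0 not-norm V V₀ V₁ V₂₊

  V₂ : V 2 W.≈ const c W.* X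
  V₂ = begin
    V 2                                                   ≈⟨ V₂₊ 0 ⟩
    const c W.* X W.* V 1 W.- const (ι s) W.* V 0
      ≈⟨ W.+-cong {const c W.* X W.* V 1} {const c W.* X W.* W.1#} {W.- (const (ι s) W.* V 0)} {W.- (const (ι s) W.* W.0#)}
           (W.*-congˡ {const c W.* X} {V 1} {W.1#} V₁)
           (W.-‿cong {const (ι s) W.* V 0} {const (ι s) W.* W.0#} (W.*-congˡ {const (ι s)} {V 0} {W.0#} V₀)) ⟩
    const c W.* X W.* W.1# W.- const (ι s) W.* W.0#       ≈⟨ x1-t0≈x (const c W.* X) (const (ι s)) ⟩
    const c W.* X ∎
    where open SetoidReasoning W.setoid

  V-irreducible : ∀ p → Prime p → ℚ[X].Irreducible (V p)
  V-irreducible p p-prime with prime-cases p p-prime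
  ... | inj₁ ≡.refl = monomial-irreducible c c′ c′c≡1 V₂
  ... | inj₂ (m , ≡.refl) = irreducible (V-nonunit m p-prime′) (V-split m p-prime′)
    where
    p-prime′ : Prime (suc (2 ℕ.* suc m))
    p-prime′ = ≡.subst (λ n → Prime (suc n)) (ℕ.*-comm (suc m) 2) p-prime


-- The recurrence adds its last term, which in the pattern c x V (n+1) - s V n means s = -1; the
-- same holds for `pell`, with c = 2.
fibonacci-irreducible : ∀ p → Prime p → ℚ[X].Irreducible (fibonacci p)
fibonacci-irreducible = FamilyIrreducible.V-irreducible ℚ.1ℚ ℚ.1ℚ ≡.refl (ℤ.- + 1) (ℚ.- ℚ.1ℚ) ≡.refl (λ ())
  (rational-norm (ℤ.- + 1) not-norm-1) fibonacci ≈-refl ≈-refl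
  (λ n → x+y≈1zx-[-1]y (fibonacci (suc n)) X (fibonacci n))

pell-irreducible : ∀ p → Prime p → ℚ[X].Irreducible (pell p)
pell-irreducible = FamilyIrreducible.V-irreducible (+ 2 / 1) (+ 1 / 2) ≡.refl (ℤ.- + 1) (ℚ.- ℚ.1ℚ) ≡.refl (λ ())
  (rational-norm (ℤ.- + 1) not-norm-1) pell ≈-refl ≈-refl
  (λ n → x+y≈x-[-1]y (const (+ 2 / 1) W.* X W.* pell (suc n)) (pell n))

fermat-irreducible : ∀ p → Prime p → ℚ[X].Irreducible (fermat p)
fermat-irreducible = FamilyIrreducible.V-irreducible (+ 3 / 1) (+ 1 / 3) ≡.refl (+ 2) (+ 1 / 2) ≡.refl (λ ())
  (rational-norm (+ 2) not-norm-2) fermat ≈-refl ≈-refl (λ n → ≈-refl)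

mainTheorem8 : (p : ℕ) → Prime p →
    ℚ[X].Irreducible (fibonacci p) × ℚ[X].Irreducible (pell p) × ℚ[X].Irreducible (fermat p)
mainTheorem8 p p-prime =
  fibonacci-irreducible p p-prime , pell-irreducible p p-prime , fermat-irreducible p p-prime
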